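{- Let $G$ be a finite simple graph and $\theta$ a real number. A set $X\subseteq V(G)$ is a maximal $\theta$-Tutte set in $G$ if and only if $X$ is a maximal $\theta$-extreme set in $G$.
   Context: $\mu(G,x)=\sum_{r\ge 0}(-1)^r p(G,r)x^{|V(G)|-2r}$ is the matching polynomial ($p(G,r)$ = number of $r$-matchings, $p(G,0)=1$, empty graph has $\mu=1$); $\textnormal{mult}(\theta,G)$ is the multiplicity of $\theta$ as a root of $\mu(G,x)$ ($0$ if not a root). $G\setminus X$ denotes deletion of the vertices in $X$. A vertex $u$ is $\theta$-essential in $G$ if $\textnormal{mult}(\theta,G\setminus u)=\textnormal{mult}(\theta,G)-1$. A connected graph is $\theta$-critical if all its vertices are $\theta$-essential in it; $c_\theta(G)$ is the number of $\theta$-critical connected components of $G$. $X$ is a $\theta$-Tutte set if $c_\theta(G\setminus X)=\textnormal{mult}(\theta,G)+|X|$ and a $\theta$-extreme set if $\textnormal{mult}(\theta,G\setminus X)=\textnormal{mult}(\theta,G)+|X|$. Maximal means maximal with respect to inclusion among sets of the same kind. -}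

module Defs where

open import Level using (0ℓ)
open import Data.Nat as ℕ using (ℕ; zero; suc)
open import Data.Bool using (Bool; true; false; _∧_; not; if_then_else_)
open import Data.Fin using (Fin; toℕ)
open import Data.Vec using (lookup)
open import Data.Fin.Properties using (_≟_)
open import Data.Fin.Subset as Sub using (Subset; ∁; ⁅_⁆; _─_; ∣_∣)
open import Data.List using (List; []; _∷_; length; filterᵇ; concatMap; allFin; map; upTo; foldr; _++_; replicate)
open import Data.List.Relation.Unary.Unique.Propositional using (Unique)
open import Data.List.Membership.Propositional as LM using ()
open import Data.Product using (Σ; ∃; _×_; _,_)
open import Data.Sum using (_⊎_)
open import Relation.Nullary using (¬_; does)
open import Relation.Binary.PropositionalEquality using (_≡_)
open import Relation.Binary.Definitions using (Tri)
open import Algebra.Bundles using (CommutativeRing)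
open import Function.Bundles using (_⇔_)

-- The real numbers, axiomatised as a Dedekind-complete ordered field
-- (unique up to isomorphism).  Trichotomy is part of the axioms.

record RealField : Set₁ where
  field
    commRing : CommutativeRing 0ℓ 0ℓ
  open CommutativeRing commRing public
  infix 4 _<_ _≤_
  field
    _<_       : Carrier → Carrier → Set
    <-irrefl  : ∀ x → ¬ (x < x)
    <-trans   : ∀ {x y z} → x < y → y < z → x < z
    <-tri     : ∀ x y → Tri (x < y) (x ≈ y) (y < x)
    <-resp-≈  : ∀ {x x′ y y′} → x ≈ x′ → y ≈ y′ → x < y → x′ < y′
    +-mono-<  : ∀ {x y} z → x < y → x + z < y + z
    *-pos     : ∀ {x y} → 0# < x → 0# < y → 0# < x * y
    0≉1       : ¬ (0# ≈ 1#)
    inverse   : ∀ x → ¬ (x ≈ 0#) → ∃ λ y → x * y ≈ 1#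
  _≤_ : Carrier → Carrier → Set
  x ≤ y = x < y ⊎ x ≈ y
  field
    complete  : (P : Carrier → Set) → (∃ λ x → P x) →
                (∃ λ b → ∀ x → P x → x ≤ b) →
                ∃ λ s → (∀ x → P x → x ≤ s) ×
                        (∀ b → (∀ x → P x → x ≤ b) → s ≤ b)

-- Polynomials over R as ascending coefficient lists; equality is
-- coefficientwise (so trailing zeros do not matter).

module Poly (R : RealField) where
  open RealField R

  Pol : Set
  Pol = List Carrier

  coeff : Pol → ℕ → Carrier
  coeff []       _       = 0#
  coeff (a ∷ p)  zero    = a
  coeff (a ∷ p)  (suc i) = coeff p i

  _≃_ : Pol → Pol → Set
  p ≃ q = ∀ i → coeff p i ≈ coeff q i

  _⊕_ : Pol → Pol → Pol
  []      ⊕ q       = q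
  p       ⊕ []      = p
  (a ∷ p) ⊕ (b ∷ q) = (a + b) ∷ (p ⊕ q)

  scale : Carrier → Pol → Pol
  scale c = map (c *_)

  _⊗_ : Pol → Pol → Pol
  []      ⊗ q = []
  (a ∷ p) ⊗ q = scale a q ⊕ (0# ∷ (p ⊗ q))

  _^ₚ_ : Pol → ℕ → Pol
  p ^ₚ zero  = 1# ∷ []
  p ^ₚ suc k = p ⊗ (p ^ₚ k)

  monomial : Carrier → ℕ → Pol
  monomial c d = replicate d 0# ++ (c ∷ [])

  fromℕ : ℕ → Carrier
  fromℕ zero    = 0#
  fromℕ (suc k) = 1# + fromℕ k

  signed : ℕ → Carrier → Carrier
  signed zero    c = c
  signed (suc r) c = - signed r c

  Divides : Carrier → ℕ → Pol → Set
  Divides θ k p = ∃ λ q → p ≃ (((- θ ∷ 1# ∷ []) ^ₚ k) ⊗ q)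

  -- θ is a root of p of multiplicity exactly k (k = 0 if not a root)
  IsMult : Carrier → Pol → ℕ → Set
  IsMult θ p k = Divides θ k p × ¬ Divides θ (suc k) p

record Graph : Set where
  field
    n      : ℕ
    adj    : Fin n → Fin n → Bool
    sym    : ∀ u v → adj u v ≡ adj v u
    irrefl : ∀ u → adj u u ≡ false

sublists : {A : Set} → List A → List (List A)
sublists []       = [] ∷ []
sublists (x ∷ xs) = sublists xs ++ map (x ∷_) (sublists xs)

module GraphDefs (G : Graph) where
  open Graph G public

  -- edges of the induced subgraph G[S], each listed once as (i , j), i < j
  edges : Subset n → List (Fin n × Fin n)
  edges S = concatMap (λ i → map (λ j → (i , j))
              (filterᵇ (λ j → does (toℕ i ℕ.<? toℕ j) ∧ (adj i j ∧ (mem i ∧ mem j))) (allFin n)))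
              (allFin n)
    where
    mem : Fin n → Bool
    mem i = lookup S i

  _=ᶠ_ : Fin n → Fin n → Bool
  a =ᶠ b = does (a ≟ b)

  disjointᵇ : Fin n × Fin n → Fin n × Fin n → Bool
  disjointᵇ (a , b) (c , d) = not (a =ᶠ c) ∧ not (a =ᶠ d) ∧ not (b =ᶠ c) ∧ not (b =ᶠ d)

  isMatchingᵇ : List (Fin n × Fin n) → Bool
  isMatchingᵇ []      = true
  isMatchingᵇ (e ∷ M) = foldr (λ f b → disjointᵇ e f ∧ b) true M ∧ isMatchingᵇ M

  numMatchings : Subset n → ℕ → ℕ
  numMatchings S r =
    length (filterᵇ (λ M → (length M ℕ.≡ᵇ r) ∧ isMatchingᵇ M) (sublists (edges S)))

  data Reach (C : Subset n) : Fin n → Fin n → Set where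
    here : ∀ {u} → u Sub.∈ C → Reach C u u
    step : ∀ {u w v} → u Sub.∈ C → adj u w ≡ true → Reach C w v → Reach C u v

  Component : Subset n → Subset n → Set
  Component S C =
    C Sub.⊆ S × Sub.Nonempty C ×
    (∀ u v → u Sub.∈ C → v Sub.∈ C → Reach C u v) ×
    (∀ u v → u Sub.∈ C → v Sub.∈ S → adj u v ≡ true → v Sub.∈ C)

module Theory (R : RealField) (G : Graph) (θ : RealField.Carrier R) where
  open RealField R
  open Poly R
  open GraphDefs G

  μ : Subset n → Pol
  μ S = foldr (λ r acc → term r ⊕ acc) [] (upTo (suc ∣ S ∣))
    where
    term : ℕ → Pol
    term r = if (r ℕ.+ r) ℕ.≤ᵇ ∣ S ∣
             then monomial (signed r (fromℕ (numMatchings S r))) (∣ S ∣ ℕ.∸ (r ℕ.+ r))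
             else []

  Mult : Subset n → ℕ → Set
  Mult S k = IsMult θ (μ S) k

  Essential : Subset n → Fin n → Set
  Essential T u = ∃ λ m → Mult (T Sub.- u) m × Mult T (suc m)

  Critical : Subset n → Set
  Critical C = ∀ u → u Sub.∈ C → Essential C u

  CritCount : Subset n → ℕ → Set
  CritCount S k = ∃ λ (L : List (Subset n)) →
    length L ≡ k × Unique L × (∀ C → (C LM.∈ L) ⇔ (Component S C × Critical C))

  V : Subset n
  V = Sub.⊤

  TutteSet : Subset n → Set
  TutteSet X = ∃ λ m → Mult V m × CritCount (∁ X) (m ℕ.+ ∣ X ∣)

  ExtremeSet : Subset n → Set
  ExtremeSet X = ∃ λ m → Mult V m × Mult (∁ X) (m ℕ.+ ∣ X ∣)

  MaximalTutteSet : Subset n → Set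
  MaximalTutteSet X = TutteSet X × (∀ Y → X Sub.⊆ Y → TutteSet Y → Y ≡ X)

  MaximalExtremeSet : Subset n → Set
  MaximalExtremeSet X = ExtremeSet X × (∀ Y → X Sub.⊆ Y → ExtremeSet Y → Y ≡ X)

{-# OPTIONS --safe #-}
module Submission where

-- Every critical component has multiplicity at least 1 and deleting a vertex raises the
-- multiplicity by at most 1, so a Tutte set is extreme.  Conversely, an extreme set can be
-- enlarged until no vertex of the complement is positive (raises the multiplicity), and such
-- an extreme set is Tutte: a component with multiplicity k ≥ 1 has an essential vertex, since
-- μ′(S) = Σ_u μ(S−u); a vertex adjacent to an essential one is essential or positive, so the
-- component is critical; and critical components have multiplicity 1 (Gallai's lemma).
--
-- All of this rests on the parity of vanishing orders at θ.  By Heilmann and Lieb,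
-- μ(S−u) μ(S−v) − μ(S) μ(S−u−v) is a sum of squares, one of which is μ(S−u−v)² if u ~ v; a sum
-- of squares vanishes to even order, and its summands vanish at least to that order.
-- For Gallai's lemma, suppose mult S = k ≥ 2 and all vertices are essential.  The relation
-- mult(S−u−v) ≥ k−1 holds for adjacent u, v; it is transitive by the same parity argument
-- applied with the weight of the middle vertex changed from x to x + 1.  So no vertex is
-- essential in S−u, although mult(S−u) = k−1 ≥ 1.

open import Defs
open import Algebra.Bundles using (AbelianGroup; CommutativeRing)
import Algebra.Properties.AbelianGroup as AbelianGroupProperties
import Algebra.Properties.CommutativeSemigroup as CommutativeSemigroupProperties
import Algebra.Properties.Group as GroupProperties
import Algebra.Properties.Ring as RingProperties
open import Data.Bool as Bool using (Bool; true; false; _∧_; not; if_then_else_; T; T?)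
import Data.Bool.Properties as Boolₚ
open import Data.Bool.Solver using (module ∨-∧-Solver)
open import Data.Empty using (⊥; ⊥-elim)
open import Data.Fin using (Fin; zero; suc; toℕ)
import Data.Fin.Properties as Finₚ
open Finₚ using (_≟_)
open import Data.Fin.Subset as Sub using (Subset; _∈_; _∉_; _⊆_; ∣_∣; _∩_; _∪_; _─_; ∁; ⁅_⁆)
open import Data.Fin.Subset.Properties as Subₚ using (_∈?_)
open import Data.List using (List; []; _∷_; _++_; length; map; filterᵇ; foldr; concatMap; allFin; tabulate; applyUpTo)
open import Data.List.Membership.Propositional as LM using ()
open import Data.List.Membership.Propositional.Properties using (∈-allFin; ∈-map⁺; ∈-map⁻; ∈-filter⁺; ∈-filter⁻; ∈-concatMap⁺; ∈-concatMap⁻)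
open import Data.List.Relation.Unary.All as All using (All; []; _∷_)
open import Data.List.Relation.Unary.AllPairs using ([]; _∷_)
import Data.List.Relation.Unary.Any as Any
open Any using (here; there)
open import Data.List.Relation.Unary.Unique.Propositional using (Unique)
open import Data.Maybe.Base using (nothing)
open import Data.Nat as ℕ using (ℕ; zero; suc; z≤n; s≤s)
import Data.Nat.Properties as ℕₚ
open import Data.Product using (∃; ∃₂; _×_; _,_; proj₁; proj₂)
open import Data.Sum using (_⊎_; inj₁; inj₂)
open import Data.Vec using ([]; _∷_; here; there; lookup)
import Data.Vec.Properties as Vecₚ
open import Function.Base using (_∘_; id)
open import Function.Bundles using (_⇔_; mk⇔; Equivalence)
open import Function.Construct.Composition using (_⇔-∘_)
open import Function.Construct.Symmetry using (⇔-sym)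
open import Level using (0ℓ)
open import Relation.Binary.Definitions using (tri<; tri≈; tri>)
import Relation.Binary.PropositionalEquality as ≡
open ≡ using (_≡_; _≢_)
import Relation.Binary.Reasoning.Setoid as SetoidReasoning
open import Relation.Nullary using (¬_; ¬?; Dec; yes; no; does; _×-dec_)
open import Tactic.RingSolver using (solve-∀)
open import Tactic.RingSolver.Core.AlmostCommutativeRing using (AlmostCommutativeRing; fromCommutativeRing)

-- No list of squares is ever stored: `Positive` keeps only an even order at θ and a positive
-- leading coefficient, and these survive addition because positive leading terms cannot cancel.
-- Paths and matchings are avoided in the same way. With an independent weight on each vertex the
-- matching polynomial is affine in each weight, deleting a vertex is a partial derivative, and each
-- edge is an operator commuting with all such derivatives. The identities for `W` are therefore
-- proved by induction on the edge list, or from the expansion at one vertex. The freedom in the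
-- weights is what makes transitivity in Gallai's lemma work. There mult S = j + 2 while every S-u
-- has multiplicity j + 1, so μ(S) μ(S-u-w) vanishes to order 2j + 2 in any case and Heilmann-Lieb
-- for u, w says nothing about S-u-w. Adding 1 to the weight of v turns μ(S) into μ(S) + μ(S-v), of
-- order exactly j + 1, and parity becomes effective. The 1 matters only as a nonzero constant.

private
  variable
    A B : Set
    m : ℕ

-- Ring identities and ordered-field arithmetic

module RingIdentities (P : CommutativeRing 0ℓ 0ℓ) where
  open CommutativeRing P using (_≈_)

  solverRing : AlmostCommutativeRing 0ℓ 0ℓ
  solverRing = fromCommutativeRing P (λ _ → nothing)

  open AlmostCommutativeRing solverRing using (_+_; _*_; -_)

  xy-zw : ∀ x y z w → (x * y) * (z * w) ≈ (x * z) * (y * w)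
  xy-zw = solve-∀ solverRing

  x-yz : ∀ x y z → x * (y * z) ≈ y * (x * z)
  x-yz = solve-∀ solverRing

  +-interchange : ∀ x y z w → (x + y) + (z + w) ≈ (x + z) + (y + w)
  +-interchange = solve-∀ solverRing

  sub-interchange : ∀ p q r s → (p + - q) + (r + - s) ≈ (p + r) + - (q + s)
  sub-interchange = solve-∀ solverRing

  *-sub : ∀ x p q → x * p + - (x * q) ≈ x * (p + - q)
  *-sub x p q = P.trans (P.+-congˡ (RingProperties.-‿distribʳ-* P.ring x q)) (P.sym (P.distribˡ x p (- q)))
    where module P = CommutativeRing P

  +-exchange : ∀ x m y z → (x + m) + (y + z) ≈ (x + z) + (y + m)
  +-exchange = solve-∀ solverRing

  expand-left : ∀ p q g → p * q + p * g ≈ p * (q + g)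
  expand-left = solve-∀ solverRing

  expand-right : ∀ q s f → q * (s + f) ≈ s * q + q * f
  expand-right = solve-∀ solverRing

  rotate-last : ∀ a d e → a + (d + e) ≈ (d + a) + e
  rotate-last = solve-∀ solverRing

module OrderedField (R : RealField) where
  open RealField R
  open Poly R using (fromℕ)
  open RingProperties ring using (-‿distribˡ-*; -‿distribʳ-*; -‿involutive)
  open SetoidReasoning setoid

  +-pos : ∀ {x y} → 0# < x → 0# < y → 0# < x + y
  +-pos {x} {y} 0<x 0<y =
    <-trans 0<y (<-resp-≈ (+-identityˡ y) refl (+-mono-< y 0<x))

  square-pos : ∀ {x} → ¬ (x ≈ 0#) → 0# < x * x
  square-pos {x} x≉0 with <-tri x 0#
  ... | tri< x<0 _ _ = <-resp-≈ refl neg-square (*-pos 0<-x 0<-x)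
    where
    0<-x : 0# < - x
    0<-x = <-resp-≈ (-‿inverseʳ x) (+-identityˡ (- x)) (+-mono-< (- x) x<0)
    neg-square : - x * - x ≈ x * x
    neg-square = begin
      - x * - x      ≈⟨ sym (-‿distribˡ-* x (- x)) ⟩
      - (x * - x)    ≈⟨ -‿cong (sym (-‿distribʳ-* x x)) ⟩
      - (- (x * x))  ≈⟨ -‿involutive (x * x) ⟩
      x * x          ∎
  ... | tri≈ _ x≈0 _ = ⊥-elim (x≉0 x≈0)
  ... | tri> _ _ 0<x = *-pos 0<x 0<x

  pos⇒≉0 : ∀ {x} → 0# < x → ¬ (x ≈ 0#)
  pos⇒≉0 0<x x≈0 = <-irrefl 0# (<-resp-≈ refl x≈0 0<x)

  0<1 : 0# < 1#
  0<1 = <-resp-≈ refl (*-identityˡ 1#) (square-pos (λ 1≈0 → 0≉1 (sym 1≈0)))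

  fromℕ-pos : ∀ k → 0# < fromℕ (suc k)
  fromℕ-pos zero    = <-resp-≈ refl (sym (+-identityʳ 1#)) 0<1
  fromℕ-pos (suc k) = +-pos 0<1 (fromℕ-pos k)

  *-≉0 : ∀ {x y} → ¬ (x ≈ 0#) → ¬ (y ≈ 0#) → ¬ (x * y ≈ 0#)
  *-≉0 {x} {y} x≉0 y≉0 xy≈0 with inverse x x≉0
  ... | z , xz≈1 = y≉0 (begin
    y            ≈⟨ sym (*-identityˡ y) ⟩
    1# * y       ≈⟨ *-congʳ (sym xz≈1) ⟩
    x * z * y    ≈⟨ *-congʳ (*-comm x z) ⟩
    z * x * y    ≈⟨ *-assoc z x y ⟩
    z * (x * y)  ≈⟨ *-congˡ xy≈0 ⟩
    z * 0#       ≈⟨ zeroʳ z ⟩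
    0#           ∎)

module Power (P : CommutativeRing 0ℓ 0ℓ) where
  open CommutativeRing P hiding (zero)

  pow : Carrier → ℕ → Carrier
  pow t zero    = 1#
  pow t (suc k) = t * pow t k

-- Vanishing orders, positivity and differentiation at θ

-- The ring of polynomials, seen through its vanishing orders at θ: evaluation
-- at θ, the uniformiser t = x − θ and the derivation d/dx.
record Germs (R : RealField) : Set₁ where
  private module F = RealField R
  field
    ring : CommutativeRing 0ℓ 0ℓ
  open CommutativeRing ring public hiding (ring; zero)
  open Power ring public
  field
    eval      : Carrier → F.Carrier
    eval-cong : ∀ {p q} → p ≈ q → eval p F.≈ eval q
    eval-+    : ∀ p q → eval (p + q) F.≈ eval p F.+ eval q
    eval-*    : ∀ p q → eval (p * q) F.≈ eval p F.* eval q
    eval-1    : eval 1# F.≈ F.1#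
    t         : Carrier
    eval-t    : eval t F.≈ F.0#
    factor    : ∀ p → eval p F.≈ F.0# → ∃ λ q → p ≈ t * q
    t-cancel  : ∀ p q → t * p ≈ t * q → p ≈ q
    order     : ∀ p → p ≈ 0# ⊎ ∃₂ λ k q → p ≈ pow t k * q × ¬ (eval q F.≈ F.0#)
    ∂         : Carrier → Carrier
    ∂-cong    : ∀ {p q} → p ≈ q → ∂ p ≈ ∂ q
    ∂-+       : ∀ p q → ∂ (p + q) ≈ ∂ p + ∂ q
    ∂-1       : ∂ 1# ≈ 0#
    ∂-t*      : ∀ p → ∂ (t * p) ≈ p + t * ∂ p
    X         : Carrier
    ∂-X*      : ∀ p → ∂ (X * p) ≈ p + X * ∂ p

module Order {R : RealField} (Γ : Germs R) where
  private module F = RealField R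
  open Poly R using (fromℕ)
  open OrderedField R
  open Germs Γ
  open RingIdentities ring
  open SetoidReasoning setoid
  private module FR = SetoidReasoning F.setoid

  record Vanishes (k : ℕ) (p : Carrier) : Set where
    constructor vanishes
    field
      quotient : Carrier
      equation : p ≈ pow t k * quotient

  record Ord (k : ℕ) (p : Carrier) : Set where
    constructor ord
    field
      quotient : Carrier
      equation : p ≈ pow t k * quotient
      nonzero  : ¬ (eval quotient F.≈ F.0#)

  pow-+ : ∀ k l → pow t (k ℕ.+ l) ≈ pow t k * pow t l
  pow-+ zero    l = sym (*-identityˡ _)
  pow-+ (suc k) l = trans (*-congˡ (pow-+ k l)) (sym (*-assoc _ _ _))

  pow-cancel : ∀ k {p q} → pow t k * p ≈ pow t k * q → p ≈ q
  pow-cancel zero    {p} {q} e = trans (sym (*-identityˡ p)) (trans e (*-identityˡ q))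
  pow-cancel (suc k) {p} {q} e = pow-cancel k (t-cancel _ _
    (trans (sym (*-assoc t (pow t k) p)) (trans e (*-assoc t (pow t k) q))))

  Vanishes-cong : ∀ {k p q} → p ≈ q → Vanishes k p → Vanishes k q
  Vanishes-cong p≈q (vanishes r e) = vanishes r (trans (sym p≈q) e)

  Vanishes-zero : ∀ p → Vanishes 0 p
  Vanishes-zero p = vanishes p (sym (*-identityˡ p))

  Vanishes-0# : ∀ k {p} → p ≈ 0# → Vanishes k p
  Vanishes-0# k p≈0 = vanishes 0# (trans p≈0 (sym (zeroʳ _)))

  Vanishes-+ : ∀ {k p q} → Vanishes k p → Vanishes k q → Vanishes k (p + q)
  Vanishes-+ (vanishes r e) (vanishes s f) =
    vanishes (r + s) (trans (+-cong e f) (sym (distribˡ _ r s)))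

  Vanishes-* : ∀ {k l p q} → Vanishes k p → Vanishes l q → Vanishes (k ℕ.+ l) (p * q)
  Vanishes-* {k} {l} (vanishes r e) (vanishes s f) = vanishes (r * s) (begin
    _                              ≈⟨ *-cong e f ⟩
    (pow t k * r) * (pow t l * s)  ≈⟨ xy-zw _ _ _ _ ⟩
    (pow t k * pow t l) * (r * s)  ≈⟨ *-congʳ (sym (pow-+ k l)) ⟩
    pow t (k ℕ.+ l) * (r * s)      ∎)

  Vanishes-mono : ∀ {k l p} → k ℕ.≤ l → Vanishes l p → Vanishes k p
  Vanishes-mono {k} {l} {p} k≤l (vanishes r e) = vanishes (pow t (l ℕ.∸ k) * r) (begin
    p                                   ≈⟨ e ⟩
    pow t l * r                         ≡⟨ ≡.cong (λ m → pow t m * r) (≡.sym (ℕₚ.m+[n∸m]≡n k≤l)) ⟩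
    pow t (k ℕ.+ (l ℕ.∸ k)) * r         ≈⟨ *-congʳ (pow-+ k (l ℕ.∸ k)) ⟩
    pow t k * pow t (l ℕ.∸ k) * r       ≈⟨ *-assoc _ _ _ ⟩
    pow t k * (pow t (l ℕ.∸ k) * r)     ∎)

  Vanishes-cancel : ∀ {k p q} → Vanishes k (p + q) → Vanishes k q → Vanishes k p
  Vanishes-cancel {k} {p} {q} (vanishes r e) (vanishes s f) = vanishes (r + - s) (begin
    p                                    ≈⟨ sym (+-identityʳ p) ⟩
    p + 0#                               ≈⟨ +-congˡ (sym (-‿inverseʳ q)) ⟩
    p + (q + - q)                        ≈⟨ sym (+-assoc p q (- q)) ⟩
    p + q + - q                          ≈⟨ +-cong e (-‿cong f) ⟩
    pow t k * r + - (pow t k * s)        ≈⟨ +-congˡ (-‿distribʳ-* (pow t k) s) ⟩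
    pow t k * r + pow t k * - s          ≈⟨ sym (distribˡ _ r (- s)) ⟩
    pow t k * (r + - s)                  ∎)
    where open RingProperties (CommutativeRing.ring ring) using (-‿distribʳ-*)

  Ord⇒Vanishes : ∀ {k p} → Ord k p → Vanishes k p
  Ord⇒Vanishes (ord q e _) = vanishes q e

  eval-t* : ∀ p → eval (t * p) F.≈ F.0#
  eval-t* p = F.trans (eval-* t p) (F.trans (F.*-congʳ eval-t) (F.zeroˡ _))

  -- Were `l` greater, cancelling `pow t k` would leave the quotient divisible by `t`, hence zero at
  -- θ.
  Ord-bound : ∀ {k l p} → Ord k p → Vanishes l p → l ℕ.≤ k
  Ord-bound {k} {l} {p} (ord q e q≉0) v with l ℕ.≤? k
  ... | yes l≤k = l≤k
  ... | no  l≰k with Vanishes-mono (ℕₚ.≰⇒> l≰k) v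
  ... | vanishes r f = ⊥-elim (q≉0 (F.trans (eval-cong q≈tr) (eval-t* r)))
    where
    q≈tr : q ≈ t * r
    q≈tr = pow-cancel k (begin
      pow t k * q        ≈⟨ sym e ⟩
      p                  ≈⟨ f ⟩
      t * pow t k * r    ≈⟨ *-congʳ (*-comm t (pow t k)) ⟩
      pow t k * t * r    ≈⟨ *-assoc _ _ _ ⟩
      pow t k * (t * r)  ∎)

  Ord-¬Vanishes : ∀ {k p} → Ord k p → ¬ Vanishes (suc k) p
  Ord-¬Vanishes o v = ℕₚ.<-irrefl ≡.refl (Ord-bound o v)

  Ord-unique : ∀ {k l p} → Ord k p → Ord l p → k ≡ l
  Ord-unique o o′ = ℕₚ.≤-antisym (Ord-bound o′ (Ord⇒Vanishes o)) (Ord-bound o (Ord⇒Vanishes o′))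

  Ord-intro : ∀ {k p} → Vanishes k p → ¬ Vanishes (suc k) p → Ord k p
  Ord-intro {k} {p} (vanishes q e) ¬v = ord q e (λ q≈0 → ¬v (lift (factor q q≈0)))
    where
    lift : (∃ λ r → q ≈ t * r) → Vanishes (suc k) p
    lift (r , f) = vanishes r (begin
      p                  ≈⟨ e ⟩
      pow t k * q        ≈⟨ *-congˡ f ⟩
      pow t k * (t * r)  ≈⟨ x-yz _ _ _ ⟩
      t * (pow t k * r)  ≈⟨ sym (*-assoc _ _ _) ⟩
      t * pow t k * r    ∎)

  Ord-cong : ∀ {k p q} → p ≈ q → Ord k p → Ord k q
  Ord-cong p≈q (ord r e r≉0) = ord r (trans (sym p≈q) e) r≉0

  Ord-* : ∀ {k l p q} → Ord k p → Ord l q → Ord (k ℕ.+ l) (p * q)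
  Ord-* {k} {l} (ord r e r≉0) (ord s f s≉0) =
    ord (r * s) (Vanishes.equation (Vanishes-* {k} {l} (vanishes r e) (vanishes s f)))
      (λ rs≈0 → *-≉0 r≉0 s≉0 (F.trans (F.sym (eval-* r s)) rs≈0))

  Ord-+ : ∀ {k p q} → Ord k p → Vanishes (suc k) q → Ord k (p + q)
  Ord-+ {k} o v = Ord-intro
    (Vanishes-+ (Ord⇒Vanishes o) (Vanishes-mono (ℕₚ.n≤1+n k) v))
    (λ w → Ord-¬Vanishes o (Vanishes-cancel w v))

  order-Ord : ∀ p → p ≈ 0# ⊎ ∃ λ k → Ord k p
  order-Ord p with order p
  ... | inj₁ p≈0                 = inj₁ p≈0
  ... | inj₂ (k , q , e , q≉0)   = inj₂ (k , ord q e q≉0)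

  Ord-1 : Ord 0 1#
  Ord-1 = ord 1# (sym (*-identityˡ 1#)) (λ e → F.0≉1 (F.trans (F.sym e) eval-1))

  -- The shape of a sum of squares of polynomials: even vanishing order and
  -- positive leading coefficient at θ.
  record Leads (k : ℕ) (p : Carrier) : Set where
    constructor leads
    field
      quotient : Carrier
      equation : p ≈ pow t (k ℕ.+ k) * quotient
      positive : F.0# F.< eval quotient

  Positive : Carrier → Set
  Positive p = p ≈ 0# ⊎ ∃ λ k → Leads k p

  Leads⇒Ord : ∀ {k p} → Leads k p → Ord (k ℕ.+ k) p
  Leads⇒Ord (leads q e 0<q) = ord q e (pos⇒≉0 0<q)

  eval-pow-double : ∀ d {q} → F.0# F.< eval q →
    (eval (pow t (d ℕ.+ d) * q) F.≈ F.0#) ⊎ (F.0# F.< eval (pow t (d ℕ.+ d) * q))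
  eval-pow-double zero    0<q = inj₂ (F.<-resp-≈ F.refl (eval-cong (sym (*-identityˡ _))) 0<q)
  eval-pow-double (suc d) 0<q = inj₁ (F.trans (eval-cong (*-assoc _ _ _)) (eval-t* _))

  Leads-cong : ∀ {k p q} → p ≈ q → Leads k p → Leads k q
  Leads-cong p≈q (leads r e 0<r) = leads r (trans (sym p≈q) e) 0<r

  -- After taking out t^(2k), the second summand contributes 0 at θ if `k < l` and a positive value
  -- if `k = l`; neither can cancel the first.
  Leads-+-≤ : ∀ {k l p q} → k ℕ.≤ l → Leads k p → Leads l q → Leads k (p + q)
  Leads-+-≤ {k} {l} {p} {q} k≤l (leads r e 0<r) (leads s f 0<s) =
    leads (r + pow t (d ℕ.+ d) * s) eq pos
    where
    d : ℕ
    d = l ℕ.∸ k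
    l+l≡ : l ℕ.+ l ≡ (k ℕ.+ k) ℕ.+ (d ℕ.+ d)
    l+l≡ = ≡.trans (≡.cong₂ ℕ._+_ (≡.sym (ℕₚ.m+[n∸m]≡n k≤l)) (≡.sym (ℕₚ.m+[n∸m]≡n k≤l)))
                   (ℕ-interchange k d k d)
      where open CommutativeSemigroupProperties ℕₚ.+-commutativeSemigroup using () renaming (interchange to ℕ-interchange)
    eq : p + q ≈ pow t (k ℕ.+ k) * (r + pow t (d ℕ.+ d) * s)
    eq = begin
      p + q
        ≈⟨ +-cong e f ⟩
      pow t (k ℕ.+ k) * r + pow t (l ℕ.+ l) * s
        ≡⟨ ≡.cong (λ m → pow t (k ℕ.+ k) * r + pow t m * s) l+l≡ ⟩
      pow t (k ℕ.+ k) * r + pow t ((k ℕ.+ k) ℕ.+ (d ℕ.+ d)) * s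
        ≈⟨ +-congˡ (trans (*-congʳ (pow-+ (k ℕ.+ k) (d ℕ.+ d))) (*-assoc _ _ _)) ⟩
      pow t (k ℕ.+ k) * r + pow t (k ℕ.+ k) * (pow t (d ℕ.+ d) * s)
        ≈⟨ sym (distribˡ _ _ _) ⟩
      pow t (k ℕ.+ k) * (r + pow t (d ℕ.+ d) * s) ∎
    pos : F.0# F.< eval (r + pow t (d ℕ.+ d) * s)
    pos with eval-pow-double d {s} 0<s
    ... | inj₁ z = F.<-resp-≈ F.refl
      (F.sym (F.trans (eval-+ _ _) (F.trans (F.+-congˡ z) (F.+-identityʳ _)))) 0<r
    ... | inj₂ g = F.<-resp-≈ F.refl (F.sym (eval-+ _ _)) (+-pos 0<r g)

  Leads-+ : ∀ {k l p q} → Leads k p → Leads l q → ∃ λ m → m ℕ.≤ l × Leads m (p + q)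
  Leads-+ {k} {l} a b with ℕₚ.≤-total k l
  ... | inj₁ k≤l = k , k≤l , Leads-+-≤ k≤l a b
  ... | inj₂ l≤k = l , ℕₚ.≤-refl , Leads-cong (+-comm _ _) (Leads-+-≤ l≤k b a)

  Positive-cong : ∀ {p q} → p ≈ q → Positive p → Positive q
  Positive-cong p≈q (inj₁ z)       = inj₁ (trans (sym p≈q) z)
  Positive-cong p≈q (inj₂ (k , l)) = inj₂ (k , Leads-cong p≈q l)

  Positive-+ : ∀ {p q} → Positive p → Positive q → Positive (p + q)
  Positive-+ (inj₁ p≈0) g = Positive-cong (sym (trans (+-congʳ p≈0) (+-identityˡ _))) g
  Positive-+ g@(inj₂ _) (inj₁ q≈0) = Positive-cong (sym (trans (+-congˡ q≈0) (+-identityʳ _))) g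
  Positive-+ (inj₂ (_ , a)) (inj₂ (_ , b)) with Leads-+ a b
  ... | m , _ , c = inj₂ (m , c)

  Positive-square : ∀ p → Positive (p * p)
  Positive-square p with order p
  ... | inj₁ p≈0 = inj₁ (trans (*-congʳ p≈0) (zeroˡ p))
  ... | inj₂ (k , q , e , q≉0) = inj₂ (k , leads (q * q)
    (Vanishes.equation (Vanishes-* {k} {k} (vanishes q e) (vanishes q e)))
    (F.<-resp-≈ F.refl (F.sym (eval-* q q)) (square-pos q≉0)))

  Positive-even : ∀ {k p} → Positive p → ¬ Ord (suc (k ℕ.+ k)) p
  Positive-even {k} (inj₁ p≈0) o = Ord-¬Vanishes o (Vanishes-0# _ p≈0)
  Positive-even {k} (inj₂ (l , a)) o = odd≢even k l (Ord-unique o (Leads⇒Ord a))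
    where
    odd≢even : ∀ k l → ¬ (suc (k ℕ.+ k) ≡ l ℕ.+ l)
    odd≢even k zero ()
    odd≢even zero (suc l) e with ≡.trans (≡.cong ℕ.pred e) (ℕₚ.+-suc l l)
    ... | ()
    odd≢even (suc k) (suc l) e = odd≢even k l (ℕₚ.suc-injective
      (≡.trans (≡.cong suc (≡.sym (ℕₚ.+-suc k k))) (≡.trans (ℕₚ.suc-injective e) (ℕₚ.+-suc l l))))

  -- An exact order 2k+1 is odd and thus impossible. This is the parity gain on which the later
  -- arguments rest.
  Positive-Vanishes-suc : ∀ {k p} → Positive p →
    Vanishes (suc (k ℕ.+ k)) p → Vanishes (suc (suc (k ℕ.+ k))) p
  Positive-Vanishes-suc {k} {p} g v with order-Ord p
  ... | inj₁ p≈0 = Vanishes-0# _ p≈0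
  ... | inj₂ (l , o) with ℕₚ.m≤n⇒m<n∨m≡n (Ord-bound o v)
  ... | inj₁ lt     = Vanishes-mono lt (Ord⇒Vanishes o)
  ... | inj₂ ≡.refl = ⊥-elim (Positive-even {k} g o)

  -- Since leading terms do not cancel, the order of the sum is at most that of each nonzero
  -- summand.
  Positive-summand : ∀ {m p q} → Positive p → Positive q → Vanishes m (p + q) → Vanishes m q
  Positive-summand (inj₁ p≈0) _ v = Vanishes-cong (trans (+-congʳ p≈0) (+-identityˡ _)) v
  Positive-summand (inj₂ _) (inj₁ q≈0) v = Vanishes-0# _ q≈0
  Positive-summand (inj₂ (_ , a)) (inj₂ (_ , b)) v with Leads-+ a b
  ... | _ , m≤l , c = Vanishes-mono
    (ℕₚ.≤-trans (Ord-bound (Leads⇒Ord c) v) (ℕₚ.+-mono-≤ m≤l m≤l)) (Ord⇒Vanishes (Leads⇒Ord b))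

  -- Each factor `t` adds one copy of `q` by the product rule, so the new quotient takes the value
  -- (k+1) q(θ) at θ. As k+1 is nonzero in an ordered field, differentiation lowers a positive order
  -- by exactly one.
  ∂-pow : ∀ k q → ∃ λ r →
    ∂ (pow t (suc k) * q) ≈ pow t k * r × eval r F.≈ fromℕ (suc k) F.* eval q
  ∂-pow zero q = q + t * ∂ q ,
    (begin
      ∂ (t * 1# * q)     ≈⟨ ∂-cong (*-congʳ (*-identityʳ t)) ⟩
      ∂ (t * q)          ≈⟨ ∂-t* q ⟩
      q + t * ∂ q        ≈⟨ sym (*-identityˡ _) ⟩
      1# * (q + t * ∂ q) ∎) ,
    (FR.begin
      eval (q + t * ∂ q)           FR.≈⟨ eval-+ _ _ ⟩
      eval q F.+ eval (t * ∂ q)    FR.≈⟨ F.+-congˡ (eval-t* _) ⟩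
      eval q F.+ F.0#              FR.≈⟨ F.+-identityʳ _ ⟩
      eval q                       FR.≈⟨ F.sym (F.*-identityˡ _) ⟩
      F.1# F.* eval q              FR.≈⟨ F.*-congʳ (F.sym (F.+-identityʳ _)) ⟩
      (F.1# F.+ F.0#) F.* eval q   FR.∎)
  ∂-pow (suc k) q with ∂-pow k q
  ... | r , e , er = q + r ,
    (begin
      ∂ (t * pow t (suc k) * q)                    ≈⟨ ∂-cong (*-assoc _ _ _) ⟩
      ∂ (t * (pow t (suc k) * q))                  ≈⟨ ∂-t* _ ⟩
      pow t (suc k) * q + t * ∂ (pow t (suc k) * q) ≈⟨ +-congˡ (*-congˡ e) ⟩
      pow t (suc k) * q + t * (pow t k * r)        ≈⟨ +-congˡ (sym (*-assoc _ _ _)) ⟩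
      pow t (suc k) * q + pow t (suc k) * r        ≈⟨ sym (distribˡ _ _ _) ⟩
      pow t (suc k) * (q + r)                      ∎) ,
    (FR.begin
      eval (q + r)                                       FR.≈⟨ eval-+ _ _ ⟩
      eval q F.+ eval r                                  FR.≈⟨ F.+-cong (F.sym (F.*-identityˡ _)) er ⟩
      F.1# F.* eval q F.+ fromℕ (suc k) F.* eval q       FR.≈⟨ F.sym (F.distribʳ _ _ _) ⟩
      (F.1# F.+ fromℕ (suc k)) F.* eval q                FR.∎)

  Vanishes-∂ : ∀ {k p} → Vanishes (suc k) p → Vanishes k (∂ p)
  Vanishes-∂ {k} (vanishes q e) with ∂-pow k q
  ... | r , f , _ = vanishes r (trans (∂-cong e) f)

  Ord-∂ : ∀ {k p} → Ord (suc k) p → Ord k (∂ p)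
  Ord-∂ {k} (ord q e q≉0) with ∂-pow k q
  ... | r , f , er = ord r (trans (∂-cong e) f)
    (λ r≈0 → *-≉0 (pos⇒≉0 (fromℕ-pos k)) q≉0 (F.trans (F.sym er) r≈0))

-- Vertex deletion and edge lists

x∉p-x : ∀ (p : Subset m) x → x ∉ p Sub.- x
x∉p-x (_ ∷ p) zero    ()
x∉p-x (_ ∷ p) (suc x) (there x∈) = x∉p-x p x x∈

x∈p-y⇒x∈p : ∀ {p : Subset m} {x} y → x ∈ p Sub.- y → x ∈ p
x∈p-y⇒x∈p {p = p} y = Subₚ.p─q⊆p p Sub.⁅ y ⁆

x∉p⇒x∉p-y : ∀ {p : Subset m} {x} y → x ∉ p → x ∉ p Sub.- y
x∉p⇒x∉p-y y x∉p = x∉p ∘ x∈p-y⇒x∈p y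

∣p-x∣ : ∀ {p : Subset m} {x} → x ∈ p → suc ∣ p Sub.- x ∣ ≡ ∣ p ∣
∣p-x∣ {p = true ∷ p}  here       = ≡.cong (suc ∘ ∣_∣) (Subₚ.p─⊥≡p p)
∣p-x∣ {p = true ∷ p}  (there x∈) = ≡.cong suc (∣p-x∣ x∈)
∣p-x∣ {p = false ∷ p} (there x∈) = ∣p-x∣ x∈

Edge : ℕ → Set
Edge n = Fin n × Fin n

Proper : List (Edge m) → Set
Proper = All (λ e → proj₁ e ≢ proj₂ e)

-- An edge may be listed in either orientation, so both ends are compared with `u`. Repeated edges
-- give repeated neighbours, in step with the repeated operators in `W`.
neighbours : Fin m → List (Edge m) → List (Fin m)
neighbours u [] = []
neighbours u ((a , b) ∷ L) with a ≟ u | b ≟ u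
... | yes _ | _     = b ∷ neighbours u L
... | no _  | yes _ = a ∷ neighbours u L
... | no _  | no _  = neighbours u L

neighboursˡ : ∀ {u v : Fin m} {L} → (u , v) LM.∈ L → v LM.∈ neighbours u L
neighboursˡ {u = u} {v} {(a , b) ∷ L} (here ≡.refl) with u ≟ u
... | yes _   = here ≡.refl
... | no  u≢u = ⊥-elim (u≢u ≡.refl)
neighboursˡ {u = u} {v} {(a , b) ∷ L} (there e) with a ≟ u | b ≟ u
... | yes _ | _     = there (neighboursˡ e)
... | no _  | yes _ = there (neighboursˡ e)
... | no _  | no _  = neighboursˡ e

neighboursʳ : ∀ {u v : Fin m} {L} → u ≢ v → (v , u) LM.∈ L → v LM.∈ neighbours u L
neighboursʳ {u = u} {v} {(a , b) ∷ L} u≢v (here ≡.refl) with v ≟ u | u ≟ u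
... | yes v≡u | _       = ⊥-elim (u≢v (≡.sym v≡u))
... | no _    | yes _   = here ≡.refl
... | no _    | no  u≢u = ⊥-elim (u≢u ≡.refl)
neighboursʳ {u = u} {v} {(a , b) ∷ L} u≢v (there e) with a ≟ u | b ≟ u
... | yes _ | _     = there (neighboursʳ u≢v e)
... | no _  | yes _ = there (neighboursʳ u≢v e)
... | no _  | no _  = neighboursʳ u≢v e

-- Vertex-weighted matching polynomials and their expansion at a vertex

module Sums (P : CommutativeRing 0ℓ 0ℓ) where
  open CommutativeRing P hiding (zero)
  open RingIdentities P
  open RingProperties (CommutativeRing.ring P) using (-0#≈0#)

  sumOver : {A : Set} → List A → (A → Carrier) → Carrier
  sumOver []       f = 0#
  sumOver (w ∷ ws) f = f w + sumOver ws f

  sum-cong : {A : Set} (N : List A) {f g : A → Carrier} →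
    (∀ w → f w ≈ g w) → sumOver N f ≈ sumOver N g
  sum-cong []      f≈g = refl
  sum-cong (w ∷ N) f≈g = +-cong (f≈g w) (sum-cong N f≈g)

  sum-sub : {A : Set} (N : List A) (f g : A → Carrier) →
    sumOver N (λ w → f w + - g w) ≈ sumOver N f + - sumOver N g
  sum-sub []      f g = sym (trans (+-identityˡ _) -0#≈0#)
  sum-sub (w ∷ N) f g = trans (+-congˡ (sum-sub N f g)) (sub-interchange _ _ _ _)

  sum-0 : {A : Set} (N : List A) {f : A → Carrier} → (∀ w → f w ≈ 0#) → sumOver N f ≈ 0#
  sum-0 []      f≈0 = refl
  sum-0 (w ∷ N) f≈0 = trans (+-cong (f≈0 w) (sum-0 N f≈0)) (+-identityˡ 0#)

  sum-* : {A : Set} (N : List A) (c : Carrier) (f : A → Carrier) →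
    sumOver N (λ w → c * f w) ≈ c * sumOver N f
  sum-* []      c f = sym (zeroʳ c)
  sum-* (w ∷ N) c f = trans (+-congˡ (sum-* N c f)) (sym (distribˡ c _ _))

  sum-tabulate : ∀ {k m} (h : Fin k → Fin m) (f : Fin m → Carrier) →
    sumOver (tabulate h) f ≡ sumOver (allFin k) (f ∘ h)
  sum-tabulate {zero}  h f = ≡.refl
  sum-tabulate {suc k} h f = ≡.cong (f (h zero) +_)
    (≡.trans (sum-tabulate (h ∘ suc) f) (≡.sym (sum-tabulate suc (f ∘ h))))

-- Functions on vertex sets, with (δ w F) S the value at S − w (zero if w ∉ S).
-- On F S = Π_{v ∈ S} x_v, and on matching polynomials in these variables, δ w is ∂/∂x_w.
module SetFunctions (P : CommutativeRing 0ℓ 0ℓ) {n : ℕ} where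
  open CommutativeRing P hiding (zero)
  open RingIdentities P
  open Sums P
  open SetoidReasoning setoid
  open RingProperties (CommutativeRing.ring P) using (-0#≈0#)

  SetFunction : Set
  SetFunction = Subset n → Carrier

  δ : Fin n → SetFunction → SetFunction
  δ w F S with w ∈? S
  ... | yes _ = F (S Sub.- w)
  ... | no _  = 0#

  δ-∈ : ∀ {w S} F → w ∈ S → δ w F S ≡ F (S Sub.- w)
  δ-∈ {w} {S} F w∈S with w ∈? S
  ... | yes _  = ≡.refl
  ... | no w∉S = ⊥-elim (w∉S w∈S)

  δ-∉ : ∀ {w S} F → w ∉ S → δ w F S ≡ 0#
  δ-∉ {w} {S} F w∉S with w ∈? S
  ... | yes w∈S = ⊥-elim (w∉S w∈S)
  ... | no _    = ≡.refl

  δ-cong : ∀ w {F G} → (∀ S → F S ≈ G S) → ∀ S → δ w F S ≈ δ w G S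
  δ-cong w F≈G S with w ∈? S
  ... | yes _ = F≈G (S Sub.- w)
  ... | no _  = refl

  δ-comm : ∀ a b F S → δ a (δ b F) S ≡ δ b (δ a F) S
  δ-comm a b F S with a ≟ b
  ... | yes ≡.refl = ≡.refl
  ... | no a≢b with a ∈? S | b ∈? S
  ... | yes a∈S | yes b∈S =
    ≡.trans (δ-∈ F (Subₚ.x∈p∧x≢y⇒x∈p-y b∈S (a≢b ∘ ≡.sym)))
      (≡.trans (≡.cong F (Subₚ.p─x─y≡p─y─x S a b)) (≡.sym (δ-∈ F (Subₚ.x∈p∧x≢y⇒x∈p-y a∈S a≢b))))
  ... | yes a∈S | no b∉S  = δ-∉ F (x∉p⇒x∉p-y a b∉S)
  ... | no a∉S  | yes b∈S = ≡.sym (δ-∉ F (x∉p⇒x∉p-y b a∉S))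
  ... | no a∉S  | no b∉S  = ≡.refl

  δ-+ : ∀ w F G S → δ w (λ T → F T + G T) S ≈ δ w F S + δ w G S
  δ-+ w F G S with w ∈? S
  ... | yes _ = refl
  ... | no _  = sym (+-identityˡ 0#)

  δ-sub : ∀ w F G S → δ w (λ T → F T + - G T) S ≈ δ w F S + - δ w G S
  δ-sub w F G S with w ∈? S
  ... | yes _ = refl
  ... | no _  = sym (trans (+-identityˡ _) -0#≈0#)

  δδ-∈ : ∀ {a b S} F → a ≢ b → a ∈ S → b ∈ S → δ a (δ b F) S ≡ F (S Sub.- a Sub.- b)
  δδ-∈ F a≢b a∈S b∈S = ≡.trans (δ-∈ _ a∈S) (δ-∈ F (Subₚ.x∈p∧x≢y⇒x∈p-y b∈S (a≢b ∘ ≡.sym)))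

  δδ-∉ˡ : ∀ a b {S} F → a ∉ S → δ a (δ b F) S ≡ 0#
  δδ-∉ˡ a b F a∉S = δ-∉ _ a∉S

  δδ-∉ʳ : ∀ a b {S} F → b ∉ S → δ a (δ b F) S ≡ 0#
  δδ-∉ʳ a b {S} F b∉S = ≡.trans (δ-comm a b F S) (δ-∉ _ b∉S)

  δδ-sum : {A : Set} (N : List A) → ∀ a b (F : A → SetFunction) S →
    δ a (δ b (λ T → sumOver N (λ w → F w T))) S ≈ sumOver N (λ w → δ a (δ b (F w)) S)
  δδ-sum [] a b F S = trans (δ-cong a zero-δ S) (zero-δ′ S)
    where
    zero-δ : ∀ T → δ b (λ _ → 0#) T ≈ 0#
    zero-δ T with b ∈? T
    ... | yes _ = refl
    ... | no _  = refl
    zero-δ′ : ∀ T → δ a (λ _ → 0#) T ≈ 0#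
    zero-δ′ T with a ∈? T
    ... | yes _ = refl
    ... | no _  = refl
  δδ-sum (w ∷ N) a b F S = trans
    (trans (δ-cong a (δ-+ b _ _) S) (δ-+ a _ _ S)) (+-congˡ (δδ-sum N a b F S))

  -- The matching polynomial of the graph with edge list L; B S is the product of
  -- the vertex weights over S, and every edge acts as 1 − ∂²/∂x_a∂x_b.
  W : List (Edge n) → SetFunction → SetFunction
  W []            B = B
  W ((a , b) ∷ L) B = λ S → W L B S + - δ a (δ b (W L B)) S

  δ-W-∷ : ∀ w a b L B S →
    δ w (W ((a , b) ∷ L) B) S ≈ δ w (W L B) S + - δ a (δ b (δ w (W L B))) S
  δ-W-∷ w a b L B S = trans (δ-sub w _ _ S) (+-congˡ (-‿cong (begin
    δ w (δ a (δ b (W L B))) S  ≡⟨ δ-comm w a _ S ⟩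
    δ a (δ w (δ b (W L B))) S  ≈⟨ δ-cong a (λ T → reflexive (δ-comm w b _ T)) S ⟩
    δ a (δ b (δ w (W L B))) S  ∎)))

  -- Raising the weight of v by 1 replaces the product B of the weights by B + ∂B/∂x_v.
  W-raise : ∀ v L B S → W L (λ T → B T + δ v B T) S ≈ W L B S + δ v (W L B) S
  W-raise v []            B S = refl
  W-raise v ((a , b) ∷ L) B S = begin
    W L B′ S + - δ a (δ b (W L B′)) S
      ≈⟨ +-cong (W-raise v L B S) (-‿cong (δ-cong a (δ-cong b (W-raise v L B)) S)) ⟩
    (W L B S + δ v (W L B) S) + - δ a (δ b (λ T → W L B T + δ v (W L B) T)) S
      ≈⟨ +-congˡ (-‿cong (trans (δ-cong a (δ-+ b _ _) S) (δ-+ a _ _ S))) ⟩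
    (W L B S + δ v (W L B) S) + - (δ a (δ b (W L B)) S + δ a (δ b (δ v (W L B))) S)
      ≈⟨ sym (sub-interchange _ _ _ _) ⟩
    (W L B S + - δ a (δ b (W L B)) S) + (δ v (W L B) S + - δ a (δ b (δ v (W L B))) S)
      ≈⟨ +-congˡ (sym (δ-W-∷ v a b L B S)) ⟩
    W ((a , b) ∷ L) B S + δ v (W ((a , b) ∷ L) B) S ∎
    where
    B′ : SetFunction
    B′ T = B T + δ v B T

  -- Makes `B S` the product of the `x u` over `S`, up to the factor that is the value of `B` at the
  -- empty set. As a recursion it can be used directly in the expansion at a vertex, and it is
  -- easily checked for raised weights.
  Weights : SetFunction → (Fin n → Carrier) → Set
  Weights B x = ∀ {u S} → u ∈ S → B S ≈ x u * B (S Sub.- u)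

  Weights-raise : ∀ {B x} v → Weights B x → ∃ λ y → Weights (λ T → B T + δ v B T) y
  Weights-raise {B} {x} v wt = y , wt′
    where
    y : Fin n → Carrier
    y u with u ≟ v
    ... | yes _ = x u + 1#
    ... | no _  = x u
    wt′ : Weights (λ T → B T + δ v B T) y
    wt′ {u} {S} u∈S with u ≟ v
    ... | yes ≡.refl = begin
      B S + δ u B S
        ≈⟨ +-cong (wt u∈S) (trans (reflexive (δ-∈ B u∈S)) (sym (*-identityˡ _))) ⟩
      x u * B (S Sub.- u) + 1# * B (S Sub.- u)
        ≈⟨ sym (distribʳ _ _ _) ⟩
      (x u + 1#) * B (S Sub.- u)
        ≈⟨ *-congˡ (sym (trans (+-congˡ (reflexive (δ-∉ B (x∉p-x S u)))) (+-identityʳ _))) ⟩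
      (x u + 1#) * (B (S Sub.- u) + δ u B (S Sub.- u)) ∎
    ... | no u≢v = begin
      B S + δ v B S                                         ≈⟨ +-cong (wt u∈S) δδ ⟩
      x u * B (S Sub.- u) + x u * δ v B (S Sub.- u)         ≈⟨ sym (distribˡ _ _ _) ⟩
      x u * (B (S Sub.- u) + δ v B (S Sub.- u))             ∎
      where
      δδ : δ v B S ≈ x u * δ v B (S Sub.- u)
      δδ with v ∈? S
      ... | no v∉S  = sym (trans (*-congˡ (reflexive (δ-∉ B (x∉p⇒x∉p-y u v∉S)))) (zeroʳ _))
      ... | yes v∈S = begin
        B (S Sub.- v)                       ≈⟨ wt (Subₚ.x∈p∧x≢y⇒x∈p-y u∈S u≢v) ⟩
        x u * B (S Sub.- v Sub.- u)         ≡⟨ ≡.cong (λ T → x u * B T) (Subₚ.p─x─y≡p─y─x S v u) ⟩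
        x u * B (S Sub.- u Sub.- v)         ≡⟨ ≡.cong (x u *_) (≡.sym (δ-∈ B
                                                 (Subₚ.x∈p∧x≢y⇒x∈p-y v∈S (u≢v ∘ ≡.sym)))) ⟩
        x u * δ v B (S Sub.- u)             ∎

  module _ {B : SetFunction} {x : Fin n → Carrier} (wt : Weights B x) where

    private
      -- An edge (a , b) containing u contributes nothing to sets avoiding u.
      vertex-edge : ∀ L u w a b S → u ∈ S → (∀ F T → u ∉ T → δ a (δ b F) T ≡ 0#) →
        (∀ F → δ a (δ b F) S ≡ δ w F (S Sub.- u)) →
        W L B S + sumOver (neighbours u L) (λ z → δ z (W L B) (S Sub.- u)) ≈ x u * W L B (S Sub.- u) →
        W ((a , b) ∷ L) B S +
          sumOver (w ∷ neighbours u L) (λ z → δ z (W ((a , b) ∷ L) B) (S Sub.- u))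
        ≈ x u * W ((a , b) ∷ L) B (S Sub.- u)
      vertex-edge L u w a b S u∈S zero! top ih = begin
        (F S + - δ a (δ b F) S) + (δ w G (S Sub.- u) + sumOver N (λ z → δ z G (S Sub.- u)))
          ≈⟨ +-cong (+-congˡ (-‿cong (reflexive (top F)))) (+-cong (same w) (sum-cong N same)) ⟩
        (F S + - δ w F (S Sub.- u)) + (δ w F (S Sub.- u) + sumOver N (λ z → δ z F (S Sub.- u)))
          ≈⟨ +-exchange _ _ _ _ ⟩
        (F S + sumOver N (λ z → δ z F (S Sub.- u))) + (δ w F (S Sub.- u) + - δ w F (S Sub.- u))
          ≈⟨ trans (+-congˡ (-‿inverseʳ _)) (+-identityʳ _) ⟩
        F S + sumOver N (λ z → δ z F (S Sub.- u))
          ≈⟨ ih ⟩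
        x u * F (S Sub.- u)
          ≈⟨ *-congˡ (sym (trans (+-congˡ (drop F)) (+-identityʳ _))) ⟩
        x u * G (S Sub.- u) ∎
        where
        F G : SetFunction
        F = W L B
        G = W ((a , b) ∷ L) B
        N : List (Fin n)
        N = neighbours u L
        drop : ∀ H → - δ a (δ b H) (S Sub.- u) ≈ 0#
        drop H = trans (-‿cong (reflexive (zero! H _ (x∉p-x S u)))) -0#≈0#
        same : ∀ z → δ z G (S Sub.- u) ≈ δ z F (S Sub.- u)
        same z = trans (δ-W-∷ z a b L B _) (trans (+-congˡ (drop _)) (+-identityʳ _))

    -- The expansion F(S) = x_u F(S-u) - Σ F(S-u-w) over the neighbours w of u, written with the sum
    -- on the left. An edge at `u` adds one neighbour and subtracts precisely its term. Any other
    -- edge inside `S` subtracts the same identity for S-a-b, and an edge not inside `S` subtracts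
    -- nothing.
    vertex-recurrence : ∀ {L} → Proper L → ∀ {u S} → u ∈ S →
      W L B S + sumOver (neighbours u L) (λ w → δ w (W L B) (S Sub.- u)) ≈ x u * W L B (S Sub.- u)
    vertex-recurrence [] u∈S = trans (+-identityʳ _) (wt u∈S)
    vertex-recurrence {(a , b) ∷ L} (a≢b ∷ pr) {u} {S} u∈S with a ≟ u | b ≟ u
    ... | yes ≡.refl | _ = vertex-edge L u b u b S u∈S (λ F T → δδ-∉ˡ u b F)
      (λ F → δ-∈ _ u∈S) (vertex-recurrence pr u∈S)
    ... | no _ | yes ≡.refl = vertex-edge L u a a u S u∈S (λ F T → δδ-∉ʳ a u F)
      (λ F → ≡.trans (δ-comm a u F S) (δ-∈ _ u∈S)) (vertex-recurrence pr u∈S)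
    ... | no a≢u | no b≢u = begin
      (F S + - δ a (δ b F) S) + sumOver N (λ z → δ z G (S Sub.- u))
        ≈⟨ +-congˡ (trans (sum-cong N (λ z → δ-W-∷ z a b L B _)) (sum-sub N _ _)) ⟩
      (F S + - δ a (δ b F) S) +
        (sumOver N (λ z → δ z F (S Sub.- u)) + - sumOver N (λ z → δ a (δ b (δ z F)) (S Sub.- u)))
        ≈⟨ sub-interchange _ _ _ _ ⟩
      (F S + sumOver N (λ z → δ z F (S Sub.- u))) +
        - (δ a (δ b F) S + sumOver N (λ z → δ a (δ b (δ z F)) (S Sub.- u)))
        ≈⟨ +-cong (vertex-recurrence pr u∈S) (-‿cong (by-cases (a ∈? S) (b ∈? S))) ⟩
      x u * F (S Sub.- u) + - (x u * δ a (δ b F) (S Sub.- u))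
        ≈⟨ *-sub _ _ _ ⟩
      x u * (F (S Sub.- u) + - δ a (δ b F) (S Sub.- u)) ∎
      where
      F G : SetFunction
      F = W L B
      G = W ((a , b) ∷ L) B
      N : List (Fin n)
      N = neighbours u L
      off : (∀ H → δ a (δ b H) S ≡ 0#) → (∀ H → δ a (δ b H) (S Sub.- u) ≡ 0#) →
        δ a (δ b F) S + sumOver N (λ z → δ a (δ b (δ z F)) (S Sub.- u)) ≈
        x u * δ a (δ b F) (S Sub.- u)
      off z z′ = trans (+-cong (reflexive (z F)) (sum-0 N (λ w → reflexive (z′ (δ w F)))))
        (trans (+-identityˡ 0#) (sym (trans (*-congˡ (reflexive (z′ F))) (zeroʳ _))))
      by-cases : Dec (a ∈ S) → Dec (b ∈ S) →
        δ a (δ b F) S + sumOver N (λ z → δ a (δ b (δ z F)) (S Sub.- u)) ≈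
        x u * δ a (δ b F) (S Sub.- u)
      by-cases (no a∉S) _ = off (λ H → δδ-∉ˡ a b H a∉S) (λ H → δδ-∉ˡ a b H (x∉p⇒x∉p-y u a∉S))
      by-cases (yes _) (no b∉S) = off (λ H → δδ-∉ʳ a b H b∉S) (λ H → δδ-∉ʳ a b H (x∉p⇒x∉p-y u b∉S))
      by-cases (yes a∈S) (yes b∈S) = begin
        δ a (δ b F) S + sumOver N (λ z → δ a (δ b (δ z F)) (S Sub.- u))
          ≈⟨ +-cong (reflexive (δδ-∈ F a≢b a∈S b∈S)) (sum-cong N (λ z → reflexive (inner (δ z F)))) ⟩
        F (S Sub.- a Sub.- b) + sumOver N (λ z → δ z F (S Sub.- a Sub.- b Sub.- u))
          ≈⟨ vertex-recurrence pr (Subₚ.x∈p∧x≢y⇒x∈p-y (Subₚ.x∈p∧x≢y⇒x∈p-y u∈S (a≢u ∘ ≡.sym)) (b≢u ∘ ≡.sym)) ⟩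
        x u * F (S Sub.- a Sub.- b Sub.- u)
          ≡⟨ ≡.cong (x u *_) (≡.sym (inner F)) ⟩
        x u * δ a (δ b F) (S Sub.- u) ∎
        where
        inner : ∀ H → δ a (δ b H) (S Sub.- u) ≡ H (S Sub.- a Sub.- b Sub.- u)
        inner H = ≡.trans
          (δδ-∈ H a≢b (Subₚ.x∈p∧x≢y⇒x∈p-y a∈S a≢u) (Subₚ.x∈p∧x≢y⇒x∈p-y b∈S b≢u))
          (≡.cong H (≡.trans (≡.cong (Sub._- b) (Subₚ.p─x─y≡p─y─x S u a))
                             (Subₚ.p─x─y≡p─y─x (S Sub.- a) u b)))

-- The Heilmann-Lieb identity

module SumsOfSquares {R : RealField} (Γ : Germs R) {n : ℕ} where
  open Germs Γ
  open Order Γ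
  open RingIdentities ring
  open Sums ring
  open SetFunctions ring {n}
  open SetoidReasoning setoid
  open GroupProperties +-group using () renaming (∙-cancelʳ to +-cancelʳ)

  -- lhs − rhs is a sum of squares; if A holds, q is one of its summands.
  record Excess (lhs rhs : Carrier) (A : Set) (q : Carrier) : Set where
    constructor excess
    field
      difference : Carrier
      positive   : Positive difference
      balance    : lhs ≈ difference + rhs
      absorbs    : A → ∀ {m} → Vanishes m difference → Vanishes m q

  Excess-map : ∀ {l l′ r r′ A A′ q} → l ≈ l′ → r ≈ r′ → (A′ → A) →
    Excess l r A q → Excess l′ r′ A′ q
  Excess-map l≈ r≈ f (excess d g e a) =
    excess d g (trans (sym l≈) (trans e (+-congˡ r≈))) (a ∘ f)

  Excess-trivial : ∀ {l r A q} → l ≈ 0# → r ≈ 0# → ¬ A → Excess l r A q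
  Excess-trivial l≈0 r≈0 ¬A =
    excess 0# (inj₁ refl) (trans l≈0 (sym (trans (+-identityˡ _) r≈0))) (⊥-elim ∘ ¬A)

  Excess-square : ∀ {l r A} p → l ≈ p * p → r ≈ 0# → Excess l r A (p * p)
  Excess-square p l≈ r≈0 = excess (p * p) (Positive-square p)
    (trans l≈ (sym (trans (+-congˡ r≈0) (+-identityʳ _)))) (λ _ v → v)

  -- The marked square comes from an index equal to `s`. All other differences are positive, so they
  -- cannot hide it.
  Excess-sum : ∀ (N : List (Fin n)) {c e f g s q} →
    (∀ w → Excess (c * f w) (e * g w) (w ≡ s) q) →
    Excess (c * sumOver N f) (e * sumOver N g) (s LM.∈ N) q
  Excess-sum [] each = Excess-trivial (zeroʳ _) (zeroʳ _) (λ ())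
  Excess-sum (w ∷ N) {c} {e} {f} {g} {s} {q} each with each w | Excess-sum N {c} {e} {f} {g} each
  ... | excess d₁ g₁ e₁ a₁ | excess d₂ g₂ e₂ a₂ =
    excess (d₁ + d₂) (Positive-+ g₁ g₂) balance absorbs
    where
    balance : c * (f w + sumOver N f) ≈ (d₁ + d₂) + e * (g w + sumOver N g)
    balance = begin
      c * (f w + sumOver N f)                          ≈⟨ distribˡ _ _ _ ⟩
      c * f w + c * sumOver N f                        ≈⟨ +-cong e₁ e₂ ⟩
      (d₁ + e * g w) + (d₂ + e * sumOver N g)          ≈⟨ +-interchange _ _ _ _ ⟩
      (d₁ + d₂) + (e * g w + e * sumOver N g)          ≈⟨ +-congˡ (sym (distribˡ _ _ _)) ⟩
      (d₁ + d₂) + e * (g w + sumOver N g)              ∎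
    absorbs : s LM.∈ w ∷ N → ∀ {m} → Vanishes m (d₁ + d₂) → Vanishes m q
    absorbs (here s≡w) v = a₁ (≡.sym s≡w) (Positive-summand g₂ g₁ (Vanishes-cong (+-comm _ _) v))
    absorbs (there s∈) v = a₂ s∈ (Positive-summand g₁ g₂ v)

  module Weighted (L : List (Edge n)) (proper : Proper L)
                  (B : SetFunction) (x : Fin n → Carrier) (wt : Weights B x) where

    private
      F : SetFunction
      F = W L B

    -- The Heilmann–Lieb identity F(S−u) F(S−v) − F(S) F(S−u−v) = Σ_P F(S∖P)² (sum over
    -- the paths P from u to v), in the form of the recursion that generates the paths.
    heilmann-lieb : ∀ k {S} → ∣ S ∣ ℕ.≤ k → ∀ {u v} → u ∈ S → v ∈ S → u ≢ v →
      Excess (F (S Sub.- u) * F (S Sub.- v)) (F S * F (S Sub.- u Sub.- v))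
             (v LM.∈ neighbours u L) (F (S Sub.- u Sub.- v) * F (S Sub.- u Sub.- v))
    heilmann-lieb zero ∣S∣≤0 u∈S v∈S u≢v with ≡.trans (∣p-x∣ u∈S) (ℕₚ.n≤0⇒n≡0 ∣S∣≤0)
    ... | ()
    heilmann-lieb (suc k) {S} ∣S∣≤k {u} {v} u∈S v∈S u≢v =
      combine (Excess-sum (neighbours u L) {s = v} (λ w → each w (w ≟ v) (w ∈? S Sub.- u)))
      where
      Su Suv : Subset n
      Su  = S Sub.- u
      Suv = S Sub.- u Sub.- v
      v∈Su : v ∈ Su
      v∈Su = Subₚ.x∈p∧x≢y⇒x∈p-y v∈S (u≢v ∘ ≡.sym)
      ∣Su∣≤k : ∣ Su ∣ ℕ.≤ k
      ∣Su∣≤k = ℕₚ.≤-pred (≡.subst (ℕ._≤ suc k) (≡.sym (∣p-x∣ u∈S)) ∣S∣≤k)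

      each : ∀ w → Dec (w ≡ v) → Dec (w ∈ Su) →
        Excess (F Suv * δ w F Su) (F Su * δ w F Suv) (w ≡ v) (F Suv * F Suv)
      -- A neighbour `w` of `u` is the second vertex of a path. If `w = v` the path ends and
      -- contributes F(S-u-v)²; otherwise it goes on as a path from `w` to `v` in S-u, which is the
      -- induction hypothesis.
      each w (yes ≡.refl) _ = Excess-square (F Suv) (*-congˡ (reflexive (δ-∈ F v∈Su)))
        (trans (*-congˡ (reflexive (δ-∉ F (x∉p-x Su v)))) (zeroʳ _))
      each w (no w≢v) (no w∉) = Excess-trivial
        (trans (*-congˡ (reflexive (δ-∉ F w∉))) (zeroʳ _))
        (trans (*-congˡ (reflexive (δ-∉ F (x∉p⇒x∉p-y v w∉)))) (zeroʳ _)) w≢v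
      each w (no w≢v) (yes w∈) with heilmann-lieb k ∣Su∣≤k w∈ v∈Su w≢v
      ... | excess d g e _ = excess d g (begin
        F Suv * δ w F Su                  ≈⟨ *-comm _ _ ⟩
        δ w F Su * F Suv                  ≡⟨ ≡.cong (_* F Suv) (δ-∈ F w∈) ⟩
        F (Su Sub.- w) * F Suv            ≈⟨ e ⟩
        d + F Su * F (Su Sub.- w Sub.- v) ≡⟨ ≡.cong (λ T → d + F Su * F T) (Subₚ.p─x─y≡p─y─x Su w v) ⟩
        d + F Su * F (Suv Sub.- w)        ≡⟨ ≡.cong (λ y → d + F Su * y) (≡.sym (δ-∈ F
                                              (Subₚ.x∈p∧x≢y⇒x∈p-y w∈ w≢v))) ⟩
        d + F Su * δ w F Suv              ∎) (⊥-elim ∘ w≢v)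

      -- Expand F(S) and F(S-v) at `u`: the two terms with `x u` are both x_u F(S-u) F(S-u-v) and
      -- cancel, which leaves the two sums over the neighbours of `u`.
      combine : ∀ {A q} →
        Excess (F Suv * sumOver (neighbours u L) (λ w → δ w F Su))
               (F Su * sumOver (neighbours u L) (λ w → δ w F Suv)) A q →
        Excess (F Su * F (S Sub.- v)) (F S * F Suv) A q
      combine (excess d g e a) = excess d g (+-cancelʳ (F Su * Σv) _ _ (begin
        F Su * F (S Sub.- v) + F Su * Σv  ≈⟨ expand-left _ _ _ ⟩
        F Su * (F (S Sub.- v) + Σv)       ≈⟨ *-congˡ rec-v ⟩
        F Su * (x u * F Suv)              ≈⟨ x-yz _ _ _ ⟩
        x u * (F Su * F Suv)              ≈⟨ sym (*-assoc _ _ _) ⟩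
        x u * F Su * F Suv                ≈⟨ *-comm _ _ ⟩
        F Suv * (x u * F Su)              ≈⟨ *-congˡ (sym (vertex-recurrence wt proper u∈S)) ⟩
        F Suv * (F S + Σu)                ≈⟨ expand-right _ _ _ ⟩
        F S * F Suv + F Suv * Σu          ≈⟨ +-congˡ e ⟩
        F S * F Suv + (d + F Su * Σv)     ≈⟨ rotate-last _ _ _ ⟩
        (d + F S * F Suv) + F Su * Σv     ∎)) a
        where
        Σu Σv : Carrier
        Σu = sumOver (neighbours u L) (λ w → δ w F Su)
        Σv = sumOver (neighbours u L) (λ w → δ w F Suv)
        rec-v : F (S Sub.- v) + Σv ≈ x u * F Suv
        rec-v = ≡.subst
          (λ T → F (S Sub.- v) + sumOver (neighbours u L) (λ w → δ w F T) ≈ x u * F T)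
          (Subₚ.p─x─y≡p─y─x S v u)
          (vertex-recurrence wt proper (Subₚ.x∈p∧x≢y⇒x∈p-y u∈S u≢v))

-- The derivative as a sum over deleted vertices

module Monomials {R : RealField} (Γ : Germs R) where
  open Germs Γ
  open Sums ring
  open SetFunctions ring
  open SetoidReasoning setoid
  private
    variable
      n : ℕ

  monomials : Subset n → Carrier
  monomials S = pow X ∣ S ∣

  monomials-weights : Weights {n} monomials (λ _ → X)
  monomials-weights {u} {S} u∈S = reflexive (≡.cong (pow X) (≡.sym (∣p-x∣ u∈S)))

  ∂-0 : ∂ 0# ≈ 0#
  ∂-0 = GroupProperties.identityʳ-unique +-group (∂ 0#) (∂ 0#)
    (trans (sym (∂-+ 0# 0#)) (∂-cong (+-identityˡ 0#)))

  ∂-neg : ∀ p → ∂ (- p) ≈ - ∂ p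
  ∂-neg p = GroupProperties.inverseˡ-unique +-group (∂ (- p)) (∂ p)
    (trans (sym (∂-+ _ _)) (trans (∂-cong (-‿inverseˡ p)) ∂-0))

  ∂-δ : ∀ w (F : Subset n → Carrier) S → ∂ (δ w F S) ≈ δ w (∂ ∘ F) S
  ∂-δ w F S with w ∈? S
  ... | yes _ = refl
  ... | no _  = ∂-0

  δ-suc-∷ : ∀ (w : Fin n) b (S : Subset n) (F : Subset (suc n) → Carrier) →
    δ (suc w) F (b ∷ S) ≡ δ w (F ∘ (b ∷_)) S
  δ-suc-∷ w b S F with w ∈? S
  ... | yes _ = ≡.refl
  ... | no _  = ≡.refl

  δ-scale : ∀ (w : Fin n) c (S : Subset n) F → δ w (λ T → c * F T) S ≈ c * δ w F S
  δ-scale w c S F with w ∈? S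
  ... | yes _ = refl
  ... | no _  = sym (zeroʳ c)

  ∂-monomials : ∀ (S : Subset n) → ∂ (monomials S) ≈ sumOver (allFin n) (λ w → δ w monomials S)
  ∂-monomials [] = ∂-1
  ∂-monomials {suc n} (true ∷ S) = begin
    ∂ (X * monomials S)
      ≈⟨ ∂-X* _ ⟩
    monomials S + X * ∂ (monomials S)
      ≈⟨ +-cong (reflexive (≡.cong monomials (≡.sym (Subₚ.p─⊥≡p S)))) (*-congˡ (∂-monomials S)) ⟩
    monomials (S Sub.─ Sub.⊥) + X * sumOver (allFin n) (λ w → δ w monomials S)
      ≈⟨ +-congˡ (sym (sum-* (allFin n) X _)) ⟩
    monomials (S Sub.─ Sub.⊥) + sumOver (allFin n) (λ w → X * δ w monomials S)
      ≈⟨ +-congˡ (sum-cong (allFin n) (λ w →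
           sym (trans (reflexive (δ-suc-∷ w true S monomials)) (δ-scale w X S monomials)))) ⟩
    monomials (S Sub.─ Sub.⊥) + sumOver (allFin n) (λ w → δ (suc w) monomials (true ∷ S))
      ≡⟨ ≡.cong (monomials (S Sub.─ Sub.⊥) +_) (≡.sym (sum-tabulate {n} suc (λ w → δ w monomials (true ∷ S)))) ⟩
    sumOver (allFin (suc n)) (λ w → δ w monomials (true ∷ S)) ∎
  ∂-monomials {suc n} (false ∷ S) = begin
    ∂ (monomials S)
      ≈⟨ ∂-monomials S ⟩
    sumOver (allFin n) (λ w → δ w monomials S)
      ≈⟨ sum-cong (allFin n) (λ w → reflexive (≡.sym (δ-suc-∷ w false S monomials))) ⟩
    sumOver (allFin n) (λ w → δ (suc w) monomials (false ∷ S))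
      ≡⟨ ≡.sym (sum-tabulate {n} suc (λ w → δ w monomials (false ∷ S))) ⟩
    sumOver (tabulate suc) (λ w → δ w monomials (false ∷ S))
      ≈⟨ sym (+-identityˡ _) ⟩
    sumOver (allFin (suc n)) (λ w → δ w monomials (false ∷ S)) ∎

  -- The edge operators commute with `∂` and with every `δ w`, so the identity reduces to the
  -- edgeless case, where it is the product rule for x^|S| taken vertex by vertex.
  ∂-W : ∀ L (S : Subset n) → ∂ (W L monomials S) ≈ sumOver (allFin n) (λ w → δ w (W L monomials) S)
  ∂-W []            S = ∂-monomials S
  ∂-W {n} ((a , b) ∷ L) S = begin
    ∂ (F S + - δ a (δ b F) S)
      ≈⟨ trans (∂-+ _ _) (+-congˡ (∂-neg _)) ⟩
    ∂ (F S) + - ∂ (δ a (δ b F) S)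
      ≈⟨ +-cong (∂-W L S) (-‿cong (trans (∂-δ a _ S) (δ-cong a (∂-δ b F) S))) ⟩
    sumOver (allFin n) (λ w → δ w F S) + - δ a (δ b (∂ ∘ F)) S
      ≈⟨ +-congˡ (-‿cong (trans (δ-cong a (δ-cong b (∂-W L)) S) (δδ-sum (allFin n) a b (λ w → δ w F) S))) ⟩
    sumOver (allFin n) (λ w → δ w F S) + - sumOver (allFin n) (λ w → δ a (δ b (δ w F)) S)
      ≈⟨ sym (sum-sub (allFin n) _ _) ⟩
    sumOver (allFin n) (λ w → δ w F S + - δ a (δ b (δ w F)) S)
      ≈⟨ sum-cong (allFin n) (λ w → sym (δ-W-∷ w a b L monomials S)) ⟩
    sumOver (allFin n) (λ w → δ w (W ((a , b) ∷ L) monomials) S) ∎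
    where
    F : Subset n → Carrier
    F = W L monomials

-- Multiplicities under deletion of one vertex

module Multiplicity {R : RealField} (Γ : Germs R) {n : ℕ}
                    (L : List (Edge n)) (proper : Proper L) where
  open Germs Γ
  open Order Γ
  open RingIdentities ring
  open Sums ring
  open SetFunctions ring {n} public
  open SumsOfSquares Γ {n} public
  open SetoidReasoning setoid

  open Monomials Γ

  M : Subset n → Carrier
  M = W L monomials

  open Weighted L proper monomials (λ _ → X) monomials-weights

  -- Heilmann–Lieb summed over v, since M′(S) = Σ_v M(S−v).
  christoffel-darboux : ∀ {S u} → u ∈ S →
    Excess (M (S Sub.- u) * ∂ (M S)) (M S * ∂ (M (S Sub.- u))) (u LM.∈ allFin n)
           (M (S Sub.- u) * M (S Sub.- u))
  christoffel-darboux {S} {u} u∈S = Excess-map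
    (*-congˡ (sym (∂-W L S))) (*-congˡ (sym (∂-W L (S Sub.- u)))) id
    (Excess-sum (allFin n) (λ w → each w (w ≟ u) (w ∈? S)))
    where
    each : ∀ w → Dec (w ≡ u) → Dec (w ∈ S) →
      Excess (M (S Sub.- u) * δ w M S) (M S * δ w M (S Sub.- u)) (w ≡ u)
             (M (S Sub.- u) * M (S Sub.- u))
    -- The diagonal term is the bare square: `u` is missing from S-u, so its partner on the right is
    -- zero.
    each w (yes ≡.refl) _ = Excess-square (M (S Sub.- u)) (*-congˡ (reflexive (δ-∈ M u∈S)))
      (trans (*-congˡ (reflexive (δ-∉ M (x∉p-x S u)))) (zeroʳ _))
    each w (no w≢u) (no w∉S) = Excess-trivial
      (trans (*-congˡ (reflexive (δ-∉ M w∉S))) (zeroʳ _))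
      (trans (*-congˡ (reflexive (δ-∉ M (x∉p⇒x∉p-y u w∉S)))) (zeroʳ _)) w≢u
    each w (no w≢u) (yes w∈S) with heilmann-lieb ∣ S ∣ ℕₚ.≤-refl u∈S w∈S (w≢u ∘ ≡.sym)
    ... | excess d g e _ = excess d g
      (trans (*-congˡ (reflexive (δ-∈ M w∈S)))
        (trans e (+-congˡ (*-congˡ (reflexive (≡.sym (δ-∈ M (Subₚ.x∈p∧x≢y⇒x∈p-y w∈S w≢u))))))))
      (⊥-elim ∘ w≢u)

  CD-vanishes : ∀ {S u k} → u ∈ S → Vanishes k (M (S Sub.- u) * ∂ (M S)) →
    Vanishes k (M S * ∂ (M (S Sub.- u))) → Vanishes k (M (S Sub.- u) * M (S Sub.- u))
  CD-vanishes {u = u} u∈S v v′ with christoffel-darboux u∈S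
  ... | excess d _ e a = a (∈-allFin u) (Vanishes-cancel (Vanishes-cong e v) v′)

  -- If `M S` were zero, both products in `christoffel-darboux` would vanish to every order, and
  -- with them the square of `M (S Sub.- u)`, whose order is finite. This is how finite orders pass
  -- from S-u to S.
  M-nonzero : ∀ {S u j} → u ∈ S → Ord j (M (S Sub.- u)) → ¬ (M S ≈ 0#)
  M-nonzero {j = j} u∈S o M≈0 = Ord-¬Vanishes (Ord-* o o) (CD-vanishes u∈S
    (Vanishes-0# _ (trans (*-congˡ (trans (∂-cong M≈0) ∂-0)) (zeroʳ _)))
    (Vanishes-0# _ (trans (*-congʳ M≈0) (zeroˡ _))))

  W-empty : ∀ K {S} → Sub.Empty S → W K monomials S ≈ monomials S
  W-empty []            _  = refl
  W-empty ((a , b) ∷ K) {S} em = trans (+-cong (W-empty K em)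
    (trans (-‿cong (reflexive (δ-∉ _ (λ a∈S → em (a , a∈S))))) -0#≈0#)) (+-identityʳ _)
    where open RingProperties (CommutativeRing.ring ring) using (-0#≈0#)

  M-empty : ∀ {S} → Sub.Empty S → M S ≈ 1#
  M-empty {S} em = trans (W-empty L em) (reflexive (≡.cong (pow X)
    (≡.trans (≡.cong ∣_∣ (Subₚ.Empty-unique em)) (Subₚ.∣⊥∣≡0 n))))

  M-order : ∀ k {S} → ∣ S ∣ ℕ.≤ k → ∃ λ m → Ord m (M S)
  M-order k {S} ∣S∣≤k with Subₚ.nonempty? S
  M-order k {S} ∣S∣≤k | no em = 0 , Ord-cong (sym (M-empty em)) Ord-1
  M-order zero {S} ∣S∣≤0 | yes (u , u∈S) with ≡.trans (∣p-x∣ u∈S) (ℕₚ.n≤0⇒n≡0 ∣S∣≤0)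
  ... | ()
  M-order (suc k) {S} ∣S∣≤k | yes (u , u∈S) with order-Ord (M S)
  ... | inj₂ o   = o
  ... | inj₁ M≈0 = ⊥-elim (M-nonzero u∈S (proj₂ (M-order k
    (ℕₚ.≤-pred (≡.subst (ℕ._≤ suc k) (≡.sym (∣p-x∣ u∈S)) ∣S∣≤k)))) M≈0)

  abstract
    mult : Subset n → ℕ
    mult S = proj₁ (M-order ∣ S ∣ {S} ℕₚ.≤-refl)

    mult-Ord : ∀ S → Ord (mult S) (M S)
    mult-Ord S = proj₂ (M-order ∣ S ∣ {S} ℕₚ.≤-refl)

  mult-Vanishes : ∀ S {k} → k ℕ.≤ mult S → Vanishes k (M S)
  mult-Vanishes S k≤ = Vanishes-mono k≤ (Ord⇒Vanishes (mult-Ord S))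

  mult-bound : ∀ S {k} → Vanishes k (M S) → k ℕ.≤ mult S
  mult-bound S = Ord-bound (mult-Ord S)

  Vanishes-sum : ∀ {A : Set} (N : List A) {k} {f : A → Carrier} →
    (∀ w → Vanishes k (f w)) → Vanishes k (sumOver N f)
  Vanishes-sum []      {k} vs = Vanishes-0# k refl
  Vanishes-sum (w ∷ N) vs = Vanishes-+ (vs w) (Vanishes-sum N vs)

  Vanishes-δ : ∀ {S k} → (∀ {w} → w ∈ S → Vanishes k (M (S Sub.- w))) → ∀ w → Vanishes k (δ w M S)
  Vanishes-δ {S} {k} vs w with w ∈? S
  ... | yes w∈S = vs w∈S
  ... | no _    = Vanishes-0# k refl

  -- Write j = mult(S-u) and mult S = k+1. Both products in `christoffel-darboux` vanish to order
  -- j+k: one derivative costs one order of `M S`, the other one order of `M (S Sub.- u)`. Hence the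
  -- square gives 2j ≥ j+k. For j = 0 the second derivative has no order to lose, and `M S` alone
  -- suffices.
  interlace-≤ : ∀ {S u} → u ∈ S → mult S ℕ.≤ suc (mult (S Sub.- u))
  interlace-≤ {S} {u} u∈S with mult S in eqS
  ... | zero  = z≤n
  ... | suc k = s≤s (ℕₚ.+-cancelˡ-≤ j k j
    (Ord-bound (Ord-* oj oj) (CD-vanishes u∈S (Vanishes-* (Ord⇒Vanishes oj) (Vanishes-∂ vS))
      (low j ≡.refl))))
    where
    j : ℕ
    j = mult (S Sub.- u)
    oj : Ord j (M (S Sub.- u))
    oj = mult-Ord (S Sub.- u)
    vS : Vanishes (suc k) (M S)
    vS = mult-Vanishes S (ℕₚ.≤-reflexive (≡.sym eqS))
    low : ∀ i → mult (S Sub.- u) ≡ i → Vanishes (i ℕ.+ k) (M S * ∂ (M (S Sub.- u)))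
    low zero    _ = Vanishes-mono (ℕₚ.≤-trans (ℕₚ.n≤1+n k) (ℕₚ.m≤m+n (suc k) 0))
      (Vanishes-* vS (Vanishes-zero _))
    low (suc i) e = Vanishes-mono (ℕₚ.≤-reflexive (≡.cong suc (ℕₚ.+-comm i k)))
      (Vanishes-* vS (Vanishes-∂ (mult-Vanishes _ (ℕₚ.≤-reflexive (≡.sym e)))))

  -- In the expansion of `M S` at `u`, each M(S-u-w) has lost at most one order relative to M(S-u),
  -- by `interlace-≤` applied in S-u.
  interlace-≥ : ∀ {S u} → u ∈ S → mult (S Sub.- u) ℕ.≤ suc (mult S)
  interlace-≥ {S} {u} u∈S with mult (S Sub.- u) in eq
  ... | zero  = z≤n
  ... | suc j = s≤s (mult-bound S (Vanishes-cancel
    (Vanishes-cong (sym (vertex-recurrence monomials-weights proper u∈S))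
      (Vanishes-* (Vanishes-zero X) (mult-Vanishes (S Sub.- u)
        (ℕₚ.≤-trans (ℕₚ.n≤1+n j) (ℕₚ.≤-reflexive (≡.sym eq))))))
    (Vanishes-sum (neighbours u L) (Vanishes-δ (λ {w} w∈ → mult-Vanishes _
      (ℕₚ.≤-pred (≡.subst (ℕ._≤ suc (mult (S Sub.- u Sub.- w))) eq (interlace-≤ w∈))))))))

  essential-exists : ∀ {S k} → mult S ≡ suc k → ∃ λ u → u ∈ S × mult (S Sub.- u) ≡ k
  essential-exists {S} {k} eq
    with Finₚ.any? (λ u → (u ∈? S) ×-dec (mult (S Sub.- u) ℕ.≟ k))
  ... | yes found = found
  ... | no  none  = ⊥-elim (Ord-¬Vanishes (Ord-∂ (≡.subst (λ m → Ord m (M S)) eq (mult-Ord S)))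
    (Vanishes-cong (sym (∂-W L S)) (Vanishes-sum (allFin n) (Vanishes-δ (λ {w} w∈ →
      mult-Vanishes _ (ℕₚ.≤∧≢⇒< (ℕₚ.≤-pred (≡.subst (ℕ._≤ suc (mult (S Sub.- w))) eq (interlace-≤ w∈)))
        (λ e → none (w , w∈ , ≡.sym e))))))))

-- Parity for two deleted vertices, and factorisation along components

─-∩-comm : ∀ (p q r : Subset m) → (p ─ q) ∩ r ≡ (p ∩ r) ─ q
─-∩-comm [] [] [] = ≡.refl
─-∩-comm (x ∷ p) (true ∷ q)  (z ∷ r) = ≡.cong (false ∷_) (─-∩-comm p q r)
─-∩-comm (x ∷ p) (false ∷ q) (z ∷ r) = ≡.cong (_ ∷_) (─-∩-comm p q r)

x∉p⇒p-x≡p : ∀ {p : Subset m} {x} → x ∉ p → p Sub.- x ≡ p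
x∉p⇒p-x≡p {p = p} {x} x∉p = Subₚ.⊆-antisym (x∈p-y⇒x∈p x)
  (λ y∈p → Subₚ.x∈p∧x≢y⇒x∈p-y y∈p (λ y≡x → x∉p (≡.subst (_∈ p) y≡x y∈p)))

x∈p─q⇒x∉q : ∀ (p q : Subset m) {x} → x ∈ p ─ q → x ∉ q
x∈p─q⇒x∉q (_ ∷ p) (true ∷ q)  (there x∈) (there x∈q) = x∈p─q⇒x∉q p q x∈ x∈q
x∈p─q⇒x∉q (_ ∷ p) (false ∷ q) (there x∈) (there x∈q) = x∈p─q⇒x∉q p q x∈ x∈q

∣p∩q∣+∣p─q∣≡∣p∣ : ∀ (p q : Subset m) → ∣ p ∩ q ∣ ℕ.+ ∣ p ─ q ∣ ≡ ∣ p ∣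
∣p∩q∣+∣p─q∣≡∣p∣ [] [] = ≡.refl
∣p∩q∣+∣p─q∣≡∣p∣ (true ∷ p)  (true ∷ q)  = ≡.cong suc (∣p∩q∣+∣p─q∣≡∣p∣ p q)
∣p∩q∣+∣p─q∣≡∣p∣ (true ∷ p)  (false ∷ q) =
  ≡.trans (ℕₚ.+-suc _ _) (≡.cong suc (∣p∩q∣+∣p─q∣≡∣p∣ p q))
∣p∩q∣+∣p─q∣≡∣p∣ (false ∷ p) (true ∷ q)  = ∣p∩q∣+∣p─q∣≡∣p∣ p q
∣p∩q∣+∣p─q∣≡∣p∣ (false ∷ p) (false ∷ q) = ∣p∩q∣+∣p─q∣≡∣p∣ p q

m+m≤n+n⇒m≤n : ∀ {m n} → m ℕ.+ m ℕ.≤ n ℕ.+ n → m ℕ.≤ n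
m+m≤n+n⇒m≤n {m} {n} le with m ℕ.≤? n
... | yes m≤n = m≤n
... | no  m≰n = ⊥-elim (ℕₚ.<-irrefl ≡.refl
  (ℕₚ.<-≤-trans (ℕₚ.+-mono-< (ℕₚ.≰⇒> m≰n) (ℕₚ.≰⇒> m≰n)) le))

double-suc : ∀ j → suc j ℕ.+ suc j ≡ suc (suc (j ℕ.+ j))
double-suc j = ≡.cong suc (ℕₚ.+-suc j j)

module Deletion {R : RealField} (Γ : Germs R) {n : ℕ}
                (L : List (Edge n)) (proper : Proper L) where
  open Germs Γ
  open Order Γ
  open RingIdentities ring
  open Monomials Γ
  open Multiplicity Γ L proper public
  open SetoidReasoning setoid
  open Weighted L proper monomials (λ _ → X) monomials-weights

  private
    Adjacent : Fin n → Fin n → Set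
    Adjacent u v = v LM.∈ neighbours u L

  Vanishes-divide : ∀ {a b p q} → Ord a p → Vanishes (a ℕ.+ b) (p * q) → Vanishes b q
  Vanishes-divide {a} {b} {p} {q} o v with order-Ord q
  ... | inj₁ q≈0      = Vanishes-0# b q≈0
  ... | inj₂ (c , o′) = Vanishes-mono (ℕₚ.+-cancelˡ-≤ a b c (Ord-bound (Ord-* o o′) v)) (Ord⇒Vanishes o′)

  HL-absorbs : ∀ {S u v m} → u ∈ S → v ∈ S → u ≢ v → Adjacent u v →
    Vanishes m (M (S Sub.- u) * M (S Sub.- v)) → Vanishes m (M S * M (S Sub.- u Sub.- v)) →
    m ℕ.≤ mult (S Sub.- u Sub.- v) ℕ.+ mult (S Sub.- u Sub.- v)
  HL-absorbs {S} {u} {v} u∈S v∈S u≢v adj v₁ v₂ with heilmann-lieb ∣ S ∣ ℕₚ.≤-refl u∈S v∈S u≢v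
  ... | excess d g e a = Ord-bound (Ord-* (mult-Ord Suv) (mult-Ord Suv))
    (a adj (Vanishes-cancel (Vanishes-cong e v₁) v₂))
    where
    Suv : Subset n
    Suv = S Sub.- u Sub.- v

  -- Otherwise M(S-u) M(S-v) has the odd order 2k+1. Since M(S) M(S-u-v) vanishes to order 2k+1, so
  -- does the excess, and by parity to order 2k+2. Adjacency makes M(S-u-v)² a summand of the
  -- excess, so M(S-u-v) vanishes to order k+1. Then both terms on the right vanish to order 2k+2,
  -- contradicting the exact order on the left.
  not-neutral : ∀ {S u v k} → u ∈ S → v ∈ S → u ≢ v → Adjacent u v →
    mult S ≡ suc k → mult (S Sub.- v) ≡ k → mult (S Sub.- u) ≢ suc k
  not-neutral {S} {u} {v} {k} u∈S v∈S u≢v adj eS ev eu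
    with heilmann-lieb ∣ S ∣ ℕₚ.≤-refl u∈S v∈S u≢v
  ... | excess d g e a = Ord-¬Vanishes first (Vanishes-cong (sym e) (Vanishes-+ d-vanishes (rhs-vanishes
      (m+m≤n+n⇒m≤n (≡.subst (ℕ._≤ j ℕ.+ j) (≡.sym (double-suc k))
        (Ord-bound (Ord-* (mult-Ord Suv) (mult-Ord Suv)) (a adj d-vanishes)))))))
    where
    Suv : Subset n
    Suv = S Sub.- u Sub.- v
    j : ℕ
    j = mult Suv
    first : Ord (suc (k ℕ.+ k)) (M (S Sub.- u) * M (S Sub.- v))
    first = Ord-* (≡.subst (λ i → Ord i (M (S Sub.- u))) eu (mult-Ord _))
                  (≡.subst (λ i → Ord i (M (S Sub.- v))) ev (mult-Ord _))
    vS : Vanishes (suc k) (M S)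
    vS = mult-Vanishes S (ℕₚ.≤-reflexive (≡.sym eS))
    k≤j : k ℕ.≤ j
    k≤j = ℕₚ.≤-pred (≡.subst (ℕ._≤ suc j) eu
      (interlace-≤ (Subₚ.x∈p∧x≢y⇒x∈p-y v∈S (u≢v ∘ ≡.sym))))
    d-vanishes : Vanishes (suc (suc (k ℕ.+ k))) d
    d-vanishes = Positive-Vanishes-suc {k} g (Vanishes-cancel (Vanishes-cong e (Ord⇒Vanishes first))
      (Vanishes-* vS (mult-Vanishes Suv k≤j)))
    rhs-vanishes : suc k ℕ.≤ j → Vanishes (suc (suc (k ℕ.+ k))) (M S * M Suv)
    rhs-vanishes sk≤j = ≡.subst (λ i → Vanishes i (M S * M Suv)) (double-suc k)
      (Vanishes-* vS (mult-Vanishes Suv sk≤j))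

  -- Parity: the excess vanishes to order 2j+1, hence to order 2j+2.
  Excess-parity : ∀ {l p q A s} j → Excess l (p * q) A s → Vanishes (suc j ℕ.+ suc j) l →
    Ord (suc j) p → Vanishes j q → Vanishes (suc j) q
  Excess-parity {l} {p} {q} j (excess d g e _) v o vq = Vanishes-divide o
    (Vanishes-cancel (Vanishes-cong (trans e (+-comm _ _)) v)
      (≡.subst (λ i → Vanishes i d) (≡.sym (double-suc j)) (Positive-Vanishes-suc {j} g
        (Vanishes-cancel
          (Vanishes-cong e (Vanishes-mono (ℕₚ.≤-trans (ℕₚ.n≤1+n _) (ℕₚ.≤-reflexive (≡.sym (double-suc j)))) v))
          (Vanishes-* (Ord⇒Vanishes o) vq)))))

  module Gallai {S : Subset n} {j : ℕ} (multS : mult S ≡ suc (suc j))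
                (critical : ∀ {u} → u ∈ S → mult (S Sub.- u) ≡ suc j) where

    -- As mult(S-u) = j+1, this says for distinct u, v in S that v is not essential in S-u.
    Parallel : Fin n → Fin n → Set
    Parallel u v = suc j ℕ.≤ mult (S Sub.- u Sub.- v)

    Parallel-sym : ∀ {u v} → Parallel u v → Parallel v u
    Parallel-sym {u} {v} = ≡.subst (λ T → suc j ℕ.≤ mult T) (Subₚ.p─x─y≡p─y─x S u v)

    two-deleted : ∀ {u v} → u ∈ S → v ∈ S → u ≢ v → j ℕ.≤ mult (S Sub.- u Sub.- v)
    two-deleted {u} {v} u∈S v∈S u≢v = ℕₚ.≤-pred (≡.subst (ℕ._≤ suc (mult (S Sub.- u Sub.- v))) (critical u∈S)
      (interlace-≤ (Subₚ.x∈p∧x≢y⇒x∈p-y v∈S (u≢v ∘ ≡.sym))))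

    one-deleted : ∀ {u} → u ∈ S → Vanishes (suc j) (M (S Sub.- u))
    one-deleted u∈S = mult-Vanishes _ (ℕₚ.≤-reflexive (≡.sym (critical u∈S)))

    -- M(S-u) M(S-v) vanishes to order 2(j+1), and M(S) M(S-u-v) to order (j+2)+j, the same number.
    -- For adjacent vertices M(S-u-v)² is a summand of the difference.
    adjacent⇒Parallel : ∀ {u v} → u ∈ S → v ∈ S → u ≢ v → Adjacent u v → Parallel u v
    adjacent⇒Parallel {u} {v} u∈S v∈S u≢v adj = m+m≤n+n⇒m≤n (HL-absorbs u∈S v∈S u≢v adj
      (Vanishes-* (one-deleted u∈S) (one-deleted v∈S))
      (Vanishes-mono (ℕₚ.≤-reflexive (≡.cong suc (ℕₚ.+-suc j j)))
        (Vanishes-* (mult-Vanishes S (ℕₚ.≤-reflexive (≡.sym multS)))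
                    (mult-Vanishes _ (two-deleted u∈S v∈S u≢v)))))

    -- Heilmann–Lieb for u and w, once in S − v and once with the weight of v raised by 1.
    Parallel-trans : ∀ {u v w} → u ∈ S → v ∈ S → w ∈ S → u ≢ v → v ≢ w → u ≢ w →
      Parallel u v → Parallel v w → Parallel u w
    Parallel-trans {u} {v} {w} u∈S v∈S w∈S u≢v v≢w u≢w uv vw = mult-bound _
      (Vanishes-cancel raised-vanishes (Vanishes-cong (reflexive (≡.cong M Svuw≡)) Svuw-vanishes))
      where
      Sv : Subset n
      Sv = S Sub.- v
      u∈Sv : u ∈ Sv
      u∈Sv = Subₚ.x∈p∧x≢y⇒x∈p-y u∈S u≢v
      w∈Sv : w ∈ Sv
      w∈Sv = Subₚ.x∈p∧x≢y⇒x∈p-y w∈S (v≢w ∘ ≡.sym)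
      w∈Svu : w ∈ Sv Sub.- u
      w∈Svu = Subₚ.x∈p∧x≢y⇒x∈p-y w∈Sv (u≢w ∘ ≡.sym)
      Svuw≡ : Sv Sub.- u Sub.- w ≡ S Sub.- u Sub.- w Sub.- v
      Svuw≡ = ≡.trans (≡.cong (Sub._- w) (Subₚ.p─x─y≡p─y─x S v u)) (Subₚ.p─x─y≡p─y─x (S Sub.- u) v w)
      Sv-Ord : Ord (suc j) (M Sv)
      Sv-Ord = ≡.subst (λ i → Ord i (M Sv)) (critical v∈S) (mult-Ord Sv)
      Svu-vanishes : Vanishes (suc j) (M (Sv Sub.- u))
      Svu-vanishes = mult-Vanishes _ (Parallel-sym uv)

      three-deleted : Vanishes j (M (Sv Sub.- u Sub.- w))
      three-deleted = mult-Vanishes _ (ℕₚ.≤-pred (ℕₚ.≤-trans (Parallel-sym uv) (interlace-≤ w∈Svu)))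
      -- In S-v the three one- and two-vertex hypotheses are exactly those of parity: M(S-v) has
      -- order j+1, and both M(S-v-u) and M(S-v-w) vanish to that order.
      Svuw-vanishes : Vanishes (suc j) (M (Sv Sub.- u Sub.- w))
      Svuw-vanishes = Excess-parity j (heilmann-lieb ∣ Sv ∣ ℕₚ.≤-refl u∈Sv w∈Sv u≢w)
        (Vanishes-* Svu-vanishes (mult-Vanishes _ vw)) Sv-Ord three-deleted

      B′ : SetFunction
      B′ T = monomials T + δ v monomials T
      F : SetFunction
      F = W L B′
      F≈ : ∀ {T} → v ∈ T → M T + M (T Sub.- v) ≈ F T
      F≈ {T} v∈T = sym (trans (W-raise v L monomials T) (+-congˡ (reflexive (δ-∈ M v∈T))))
      raised : Excess _ _ _ _
      raised = Weighted.heilmann-lieb L proper B′ (proj₁ (Weights-raise v monomials-weights))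
        (proj₂ (Weights-raise v monomials-weights)) ∣ S ∣ ℕₚ.≤-refl u∈S w∈S u≢w
      v∈Su : v ∈ S Sub.- u
      v∈Su = Subₚ.x∈p∧x≢y⇒x∈p-y v∈S (u≢v ∘ ≡.sym)
      v∈Sw : v ∈ S Sub.- w
      v∈Sw = Subₚ.x∈p∧x≢y⇒x∈p-y v∈S v≢w
      v∈Suw : v ∈ S Sub.- u Sub.- w
      v∈Suw = Subₚ.x∈p∧x≢y⇒x∈p-y v∈Su v≢w
      -- The raised weight replaces M(T) by M(T) + M(T-v) for every T containing v. At S this sum
      -- has order exactly j+1, since M(S) vanishes to order j+2. Parity then bounds the sum at
      -- S-u-w, from which the already known term M(S-u-w-v) is subtracted.
      raised-vanishes : Vanishes (suc j) (M (S Sub.- u Sub.- w) + M (S Sub.- u Sub.- w Sub.- v))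
      raised-vanishes = Vanishes-cong (sym (F≈ v∈Suw)) (Excess-parity j raised
        (Vanishes-*
          (Vanishes-cong (F≈ v∈Su) (Vanishes-+ (one-deleted u∈S) (mult-Vanishes _ uv)))
          (Vanishes-cong (F≈ v∈Sw) (Vanishes-+ (one-deleted w∈S) (mult-Vanishes _ (Parallel-sym vw)))))
        (Ord-cong (trans (+-comm _ _) (F≈ v∈S)) (Ord-+ Sv-Ord (mult-Vanishes S (ℕₚ.≤-reflexive (≡.sym multS)))))
        (Vanishes-cong (F≈ v∈Suw) (Vanishes-+ (mult-Vanishes _ (two-deleted u∈S w∈S u≢w))
          (Vanishes-cong (reflexive (≡.cong M Svuw≡)) three-deleted))))

  Separates : Subset n → Subset n → List (Edge n) → Set
  Separates C S = All (λ e → proj₁ e ∈ S → proj₂ e ∈ S →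
    (proj₁ e ∈ C × proj₂ e ∈ C) ⊎ (proj₁ e ∉ C × proj₂ e ∉ C))

  Separates-delete : ∀ {C S} u {K} → Separates C S K → Separates C (S Sub.- u) K
  Separates-delete u = All.map (λ f a∈ b∈ → f (x∈p-y⇒x∈p u a∈) (x∈p-y⇒x∈p u b∈))

  -- An edge inside `S` lies on one side of `C`, so its operator acts on one of the two factors
  -- only; an edge not inside `S` acts trivially on all three sets.
  W-split : ∀ K → Proper K → ∀ {C S} → Separates C S K →
    W K monomials S ≈ W K monomials (S ∩ C) * W K monomials (S ─ C)
  W-split [] _ {C} {S} _ = trans
    (reflexive (≡.cong (pow X) (≡.sym (∣p∩q∣+∣p─q∣≡∣p∣ S C)))) (pow-X-+ ∣ S ∩ C ∣ _)
    where
    pow-X-+ : ∀ k l → pow X (k ℕ.+ l) ≈ pow X k * pow X l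
    pow-X-+ zero    l = sym (*-identityˡ _)
    pow-X-+ (suc k) l = trans (*-congˡ (pow-X-+ k l)) (sym (*-assoc _ _ _))
  W-split ((a , b) ∷ K) (a≢b ∷ pr) {C} {S} (sep ∷ seps) = by-cases (a ∈? S) (b ∈? S)
    where
    open RingProperties (CommutativeRing.ring ring) using (-0#≈0#; -‿distribˡ-*)
    F G : SetFunction
    F = W K monomials
    G = W ((a , b) ∷ K) monomials
    skip : ∀ {T} → δ a (δ b F) T ≡ 0# → G T ≈ F T
    skip z = trans (+-congˡ (trans (-‿cong (reflexive z)) -0#≈0#)) (+-identityʳ _)
    take : ∀ {T} → a ∈ T → b ∈ T → G T ≈ F T + - F (T Sub.- a Sub.- b)
    take a∈T b∈T = +-congˡ (-‿cong (reflexive (δδ-∈ F a≢b a∈T b∈T)))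
    ∩-delete : (S Sub.- a Sub.- b) ∩ C ≡ (S ∩ C) Sub.- a Sub.- b
    ∩-delete = ≡.trans (─-∩-comm (S Sub.- a) _ C) (≡.cong (Sub._- b) (─-∩-comm S _ C))
    ─-delete : (S Sub.- a Sub.- b) ─ C ≡ (S ─ C) Sub.- a Sub.- b
    ─-delete = ≡.trans (Subₚ.p─q─r≡p─r─q (S Sub.- a) _ C) (≡.cong (Sub._- b) (Subₚ.p─q─r≡p─r─q S _ C))
    lower : F (S Sub.- a Sub.- b) ≈ F ((S ∩ C) Sub.- a Sub.- b) * F ((S ─ C) Sub.- a Sub.- b)
    lower = trans (W-split K pr (Separates-delete b (Separates-delete a seps)))
      (reflexive (≡.cong₂ (λ T U → F T * F U) ∩-delete ─-delete))
    off : (∀ {T} → T Sub.⊆ S → δ a (δ b F) T ≡ 0#) → G S ≈ G (S ∩ C) * G (S ─ C)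
    off z = trans (skip (z id)) (trans (W-split K pr seps)
      (sym (*-cong (skip (z (Subₚ.p∩q⊆p S C))) (skip (z (Subₚ.p─q⊆p S C))))))
    by-cases : Dec (a ∈ S) → Dec (b ∈ S) → G S ≈ G (S ∩ C) * G (S ─ C)
    by-cases (no a∉S) _       = off (λ T⊆S → δδ-∉ˡ a b F (a∉S ∘ T⊆S))
    by-cases (yes _) (no b∉S) = off (λ T⊆S → δδ-∉ʳ a b F (b∉S ∘ T⊆S))
    by-cases (yes a∈S) (yes b∈S) with sep a∈S b∈S
    ... | inj₁ (a∈C , b∈C) = begin
      G S
        ≈⟨ take a∈S b∈S ⟩
      F S + - F (S Sub.- a Sub.- b)
        ≈⟨ +-cong (W-split K pr seps) (-‿cong (trans lower
             (*-congˡ (reflexive (≡.cong F (≡.trans (≡.cong (Sub._- b) (x∉p⇒p-x≡p a∉)) (x∉p⇒p-x≡p b∉))))))) ⟩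
      F (S ∩ C) * F (S ─ C) + - (F ((S ∩ C) Sub.- a Sub.- b) * F (S ─ C))
        ≈⟨ +-congˡ (-‿distribˡ-* _ _) ⟩
      F (S ∩ C) * F (S ─ C) + - F ((S ∩ C) Sub.- a Sub.- b) * F (S ─ C)
        ≈⟨ sym (distribʳ _ _ _) ⟩
      (F (S ∩ C) + - F ((S ∩ C) Sub.- a Sub.- b)) * F (S ─ C)
        ≈⟨ sym (*-cong (take (Subₚ.x∈p∩q⁺ (a∈S , a∈C)) (Subₚ.x∈p∩q⁺ (b∈S , b∈C)))
                       (skip (δδ-∉ˡ a b F a∉))) ⟩
      G (S ∩ C) * G (S ─ C) ∎
      where
      a∉ : a ∉ S ─ C
      a∉ a∈ = x∈p─q⇒x∉q S C a∈ a∈C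
      b∉ : b ∉ S ─ C
      b∉ b∈ = x∈p─q⇒x∉q S C b∈ b∈C
    ... | inj₂ (a∉C , b∉C) = begin
      G S
        ≈⟨ take a∈S b∈S ⟩
      F S + - F (S Sub.- a Sub.- b)
        ≈⟨ +-cong (W-split K pr seps) (-‿cong (trans lower
             (*-congʳ (reflexive (≡.cong F (≡.trans (≡.cong (Sub._- b) (x∉p⇒p-x≡p a∉)) (x∉p⇒p-x≡p b∉))))))) ⟩
      F (S ∩ C) * F (S ─ C) + - (F (S ∩ C) * F ((S ─ C) Sub.- a Sub.- b))
        ≈⟨ *-sub _ _ _ ⟩
      F (S ∩ C) * (F (S ─ C) + - F ((S ─ C) Sub.- a Sub.- b))
        ≈⟨ sym (*-cong (skip (δδ-∉ˡ a b F a∉))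
                       (take (Subₚ.x∈p∧x∉q⇒x∈p─q a∈S a∉C) (Subₚ.x∈p∧x∉q⇒x∈p─q b∈S b∉C))) ⟩
      G (S ∩ C) * G (S ─ C) ∎
      where
      a∉ : a ∉ S ∩ C
      a∉ a∈ = a∉C (proj₂ (Subₚ.x∈p∩q⁻ S C a∈))
      b∉ : b ∉ S ∩ C
      b∉ b∈ = b∉C (proj₂ (Subₚ.x∈p∩q⁻ S C b∈))

  mult-split : ∀ {C S} → Separates C S L → mult S ≡ mult (S ∩ C) ℕ.+ mult (S ─ C)
  mult-split {C} {S} sep = Ord-unique (mult-Ord S)
    (Ord-cong (sym (W-split L proper sep)) (Ord-* (mult-Ord (S ∩ C)) (mult-Ord (S ─ C))))

-- Components, critical components and extreme sets

∁-∪ : ∀ (p q : Subset m) → ∁ (p ∪ q) ≡ ∁ p ─ q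
∁-∪ [] [] = ≡.refl
∁-∪ (true ∷ p)  (true ∷ q)  = ≡.cong (false ∷_) (∁-∪ p q)
∁-∪ (true ∷ p)  (false ∷ q) = ≡.cong (false ∷_) (∁-∪ p q)
∁-∪ (false ∷ p) (true ∷ q)  = ≡.cong (false ∷_) (∁-∪ p q)
∁-∪ (false ∷ p) (false ∷ q) = ≡.cong (true ∷_) (∁-∪ p q)

∪-─ : ∀ (p q : Subset m) → (p ∪ q) ─ q ≡ p ─ q
∪-─ [] [] = ≡.refl
∪-─ (x ∷ p)     (true ∷ q)  = ≡.cong (false ∷_) (∪-─ p q)
∪-─ (true ∷ p)  (false ∷ q) = ≡.cong (true ∷_) (∪-─ p q)
∪-─ (false ∷ p) (false ∷ q) = ≡.cong (false ∷_) (∪-─ p q)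

∣p∪⁅x⁆∣ : ∀ {p : Subset m} {x} → x ∉ p → ∣ p ∪ ⁅ x ⁆ ∣ ≡ suc ∣ p ∣
∣p∪⁅x⁆∣ {p = p} {x} x∉p = ≡.trans (≡.sym (∣p-x∣ (Subₚ.q⊆p∪q p ⁅ x ⁆ (Subₚ.x∈⁅x⁆ x))))
  (≡.cong (suc ∘ ∣_∣) (≡.trans (∪-─ p ⁅ x ⁆) (x∉p⇒p-x≡p x∉p)))

∁-delete : ∀ {p : Subset m} {x} → x ∈ p → ∁ p ≡ ∁ (p Sub.- x) Sub.- x
∁-delete {p = true ∷ p}  here       =
  ≡.cong (false ∷_) (≡.trans (≡.cong ∁ (≡.sym (Subₚ.p─⊥≡p p))) (≡.sym (Subₚ.p─⊥≡p _)))
∁-delete {p = true ∷ p}  (there x∈) = ≡.cong (false ∷_) (∁-delete x∈)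
∁-delete {p = false ∷ p} (there x∈) = ≡.cong (true ∷_) (∁-delete x∈)

p⊆q⇒q∩p≡p : ∀ {p q : Subset m} → p ⊆ q → q ∩ p ≡ p
p⊆q⇒q∩p≡p {p = p} {q} p⊆q =
  Subₚ.⊆-antisym (Subₚ.p∩q⊆q q p) (λ x∈p → Subₚ.x∈p∩q⁺ (p⊆q x∈p , x∈p))

module Structure {R : RealField} (Γ : Germs R) (G : Graph)
    (L : List (Edge (Graph.n G))) (proper : Proper L)
    (adj⇒neighbours : ∀ {u v} → Graph.adj G u v ≡ true → v LM.∈ neighbours u L)
    (edge⇒adj : All (λ e → Graph.adj G (proj₁ e) (proj₂ e) ≡ true) L) where
  open GraphDefs G
  open Deletion Γ L proper

  adj-sym : ∀ {u v} → adj u v ≡ true → adj v u ≡ true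
  adj-sym {u} {v} = ≡.trans (sym v u)

  adj-≢ : ∀ {u v} → adj u v ≡ true → u ≢ v
  adj-≢ {u} a ≡.refl with ≡.trans (≡.sym a) (irrefl u)
  ... | ()

  Connected : Subset n → Set
  Connected C = ∀ u v → u ∈ C → v ∈ C → Reach C u v

  Critical′ : Subset n → Set
  Critical′ C = ∀ {u} → u ∈ C → mult C ≡ suc (mult (C Sub.- u))

  NoPositive : Subset n → Set
  NoPositive S = ∀ {u} → u ∈ S → mult (S Sub.- u) ℕ.≤ mult S

  Reach-start : ∀ {C u v} → Reach C u v → u ∈ C
  Reach-start (here u∈C)     = u∈C
  Reach-start (step u∈C _ _) = u∈C

  gallai : ∀ {C} → Sub.Nonempty C → Connected C → Critical′ C → mult C ≡ 1
  gallai {C} (u , u∈C) conn crit = by-mult (mult C) ≡.refl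
    where
    by-mult : ∀ k → mult C ≡ k → k ≡ 1
    by-mult zero e with ≡.trans (≡.sym (crit u∈C)) e
    ... | ()
    by-mult (suc zero) e = ≡.refl
    by-mult (suc (suc j)) e = ⊥-elim (impossible (essential-exists (crit′ u∈C)))
      where
      crit′ : ∀ {v} → v ∈ C → mult (C Sub.- v) ≡ suc j
      crit′ v∈C = ℕₚ.suc-injective (≡.trans (≡.sym (crit v∈C)) e)
      open Gallai e crit′
      -- `Parallel-trans` asks for three distinct vertices, so a walk whose second vertex is already
      -- `w` is settled by adjacency alone.
      parallel : ∀ {v w} → Reach C v w → w ∈ C → v ≢ w → Parallel v w
      parallel (here _) _ v≢w = ⊥-elim (v≢w ≡.refl)
      parallel {v} {w} (step {w = x} v∈C a r) w∈C v≢w with x ≟ w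
      ... | yes ≡.refl = adjacent⇒Parallel v∈C w∈C v≢w (adj⇒neighbours a)
      ... | no x≢w = Parallel-trans v∈C (Reach-start r) w∈C (adj-≢ a) x≢w v≢w
        (adjacent⇒Parallel v∈C (Reach-start r) (adj-≢ a) (adj⇒neighbours a)) (parallel r w∈C x≢w)
      impossible : (∃ λ w → w ∈ C Sub.- u × mult (C Sub.- u Sub.- w) ≡ j) → ⊥
      impossible (w , w∈ , ew) = ℕₚ.<-irrefl ≡.refl (≡.subst (suc j ℕ.≤_) ew
        (parallel (conn u w u∈C w∈C) w∈C (λ { ≡.refl → x∉p-x C u w∈ })))
        where
        w∈C : w ∈ C
        w∈C = x∈p-y⇒x∈p u w∈

  noPositive⇒critical : ∀ {C k} → Connected C → NoPositive C → mult C ≡ suc k → Critical′ C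
  noPositive⇒critical {C} {k} conn nopos e {u} u∈C with essential-exists e
  ... | v , v∈C , ev = ≡.trans e (≡.cong suc (≡.sym (essential (conn u v u∈C v∈C))))
    where
    essential : ∀ {w} → Reach C w v → mult (C Sub.- w) ≡ k
    essential (here _) = ev
    -- Interlacing leaves the values k, k+1, k+2. `nopos` rules out k+2, and `not-neutral`, with the
    -- next vertex of the walk as the essential neighbour, rules out k+1.
    essential {w} (step {w = x} w∈C a r) = ℕₚ.≤-antisym
      (ℕₚ.≤-pred (ℕₚ.≤∧≢⇒< (≡.subst (mult (C Sub.- w) ℕ.≤_) e (nopos w∈C))
        (not-neutral w∈C (Reach-start r) (adj-≢ a) (adj⇒neighbours a) e (essential r))))
      (ℕₚ.≤-pred (≡.subst (ℕ._≤ suc (mult (C Sub.- w))) e (interlace-≤ w∈C)))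

  module _ {S C : Subset n} (comp : Component S C) where
    private
      C⊆S : C ⊆ S
      C⊆S = proj₁ comp
      closed : ∀ u v → u ∈ C → v ∈ S → adj u v ≡ true → v ∈ C
      closed = proj₂ (proj₂ (proj₂ comp))

    component-separates : Separates C S L
    component-separates = All.map separate edge⇒adj
      where
      separate : ∀ {e : Edge n} → adj (proj₁ e) (proj₂ e) ≡ true → proj₁ e ∈ S → proj₂ e ∈ S →
        (proj₁ e ∈ C × proj₂ e ∈ C) ⊎ (proj₁ e ∉ C × proj₂ e ∉ C)
      separate {a , b} ab a∈S b∈S with a ∈? C
      ... | yes a∈C = inj₁ (a∈C , closed a b a∈C b∈S ab)
      ... | no  a∉C = inj₂ (a∉C , λ b∈C → a∉C (closed b a b∈C a∈S (adj-sym ab)))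

    mult-component : mult S ≡ mult C ℕ.+ mult (S ─ C)
    mult-component = ≡.trans (mult-split component-separates)
      (≡.cong (λ T → mult T ℕ.+ mult (S ─ C)) (p⊆q⇒q∩p≡p C⊆S))

    -- Deleting `u` from both pieces serves vertices inside and outside `C` alike, as one of the two
    -- deletions is void. Hence being positive is a property within a component.
    mult-component-delete : ∀ u →
      mult (S Sub.- u) ≡ mult (C Sub.- u) ℕ.+ mult ((S ─ C) Sub.- u)
    mult-component-delete u = ≡.trans (mult-split (Separates-delete u component-separates))
      (≡.cong₂ (λ T U → mult T ℕ.+ mult U)
        (≡.trans (─-∩-comm S ⁅ u ⁆ C) (≡.cong (Sub._- u) (p⊆q⇒q∩p≡p C⊆S)))
        (Subₚ.p─q─r≡p─r─q S ⁅ u ⁆ C))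

    noPositive-component : NoPositive S → NoPositive C
    noPositive-component nopos {u} u∈C = ℕₚ.+-cancelʳ-≤ (mult (S ─ C)) _ _
      (≡.subst₂ ℕ._≤_
        (≡.trans (mult-component-delete u) (≡.cong (λ T → mult (C Sub.- u) ℕ.+ mult T)
          (x∉p⇒p-x≡p (λ u∈ → x∈p─q⇒x∉q S C u∈ u∈C))))
        mult-component (nopos (C⊆S u∈C)))

    noPositive-rest : NoPositive S → NoPositive (S ─ C)
    noPositive-rest nopos {u} u∈ = ℕₚ.+-cancelˡ-≤ (mult C) _ _
      (≡.subst₂ ℕ._≤_
        (≡.trans (mult-component-delete u) (≡.cong (λ T → mult T ℕ.+ mult ((S ─ C) Sub.- u))
          (x∉p⇒p-x≡p (x∈p─q⇒x∉q S C u∈))))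
        mult-component (nopos (Subₚ.p─q⊆p S C u∈)))

    component-in-rest⁻ : ∀ {D} → Component (S ─ C) D → Component S D
    component-in-rest⁻ {D} (D⊆ , ne , conn , cl) = Subₚ.p─q⊆p S C ∘ D⊆ , ne , conn , cl′
      where
      cl′ : ∀ u v → u ∈ D → v ∈ S → adj u v ≡ true → v ∈ D
      cl′ u v u∈D v∈S uv with v ∈? C
      ... | no v∉C  = cl u v u∈D (Subₚ.x∈p∧x∉q⇒x∈p─q v∈S v∉C) uv
      ... | yes v∈C = ⊥-elim (x∈p─q⇒x∉q S C (D⊆ u∈D)
        (closed v u v∈C (Subₚ.p─q⊆p S C (D⊆ u∈D)) (adj-sym uv)))

  component-meet-⊆ : ∀ {S C D v} → Component S C → Component S D → v ∈ C → v ∈ D → C ⊆ D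
  component-meet-⊆ {S} {C} {D} {v} (C⊆S , _ , conn , _) (_ , _ , _ , closed) v∈C v∈D {y} y∈C =
    walk (conn v y v∈C y∈C) v∈D
    where
    walk : ∀ {w} → Reach C w y → w ∈ D → y ∈ D
    walk (here _)     w∈D = w∈D
    walk {w} (step {w = z} _ a r) w∈D = walk r (closed w z w∈D (C⊆S (Reach-start r)) a)

  component-meet : ∀ {S C D v} → Component S C → Component S D → v ∈ C → v ∈ D → C ≡ D
  component-meet c d v∈C v∈D =
    Subₚ.⊆-antisym (component-meet-⊆ c d v∈C v∈D) (component-meet-⊆ d c v∈D v∈C)

  component-in-rest⁺ : ∀ {S C D} → Component S C → Component S D → D ≢ C → Component (S ─ C) D
  component-in-rest⁺ {S} {C} {D} c d@(D⊆S , ne , conn , cl) D≢C =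
    (λ {x} x∈D → Subₚ.x∈p∧x∉q⇒x∈p─q (D⊆S x∈D) (λ x∈C → D≢C (component-meet d c x∈D x∈C))) ,
    ne , conn , λ u v u∈D v∈ uv → cl u v u∈D (Subₚ.p─q⊆p S C v∈) uv

  -- Multiplicities add over components, so splitting off a listed component uses up at least 1. By
  -- uniqueness of the list the other entries remain components of what is left.
  length-components : ∀ {S} (Cs : List (Subset n)) → Unique Cs →
    All (λ C → Component S C × 1 ℕ.≤ mult C) Cs → length Cs ℕ.≤ mult S
  length-components [] _ _ = z≤n
  length-components {S} (C ∷ Cs) (C∉ ∷ uniq) ((comp , 1≤) ∷ comps) =
    ≡.subst (suc (length Cs) ℕ.≤_) (≡.sym (mult-component comp))
      (ℕₚ.+-mono-≤ 1≤ (length-components Cs uniq (All.zipWith rest (C∉ , comps))))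
    where
    rest : ∀ {D} → C ≢ D × (Component S D × 1 ℕ.≤ mult D) → Component (S ─ C) D × 1 ℕ.≤ mult D
    rest (C≢D , d , 1≤D) = component-in-rest⁺ comp d (C≢D ∘ ≡.sym) , 1≤D

  Reach-mono : ∀ {C D u v} → C ⊆ D → Reach C u v → Reach D u v
  Reach-mono C⊆D (here u∈C)     = here (C⊆D u∈C)
  Reach-mono C⊆D (step u∈C a r) = step (C⊆D u∈C) a (Reach-mono C⊆D r)

  Reach-trans : ∀ {C u v w} → Reach C u v → Reach C v w → Reach C u w
  Reach-trans (here _)       r = r
  Reach-trans (step u∈C a q) r = step u∈C a (Reach-trans q r)

  Reach-sym : ∀ {C u v} → Reach C u v → Reach C v u
  Reach-sym (here u∈C)     = here u∈C
  Reach-sym (step u∈C a r) =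
    Reach-trans (Reach-sym r) (step (Reach-start r) (adj-sym a) (here u∈C))

  component-of : ∀ {S u} → u ∈ S → ∃ λ C → Component S C × u ∈ C
  component-of {S} {u} u∈S = grow ∣ S ─ ⁅ u ⁆ ∣ ⁅ u ⁆ ℕₚ.≤-refl
    (λ {x} x∈ → ≡.subst (_∈ S) (≡.sym (Subₚ.x∈⁅y⁆⇒x≡y u x∈)) u∈S) (Subₚ.x∈⁅x⁆ u)
    (λ {x} x∈ → ≡.subst (Reach ⁅ u ⁆ u) (≡.sym (Subₚ.x∈⁅y⁆⇒x≡y u x∈)) (here (Subₚ.x∈⁅x⁆ u)))
    where
    Exit : Subset n → Set
    Exit C = ∃ λ a → ∃ λ b → a ∈ C × (b ∈ S × b ∉ C) × adj a b ≡ true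
    exit? : ∀ C → Dec (Exit C)
    exit? C = Finₚ.any? λ a → Finₚ.any? λ b →
      (a ∈? C) ×-dec ((b ∈? S) ×-dec ¬? (b ∈? C)) ×-dec (adj a b Bool.≟ true)
    -- `C` absorbs the far end of an edge leaving it within `S`, keeping every vertex reachable from
    -- `u` inside `C`. The bound `k` on the vertices still outside ends the process.
    grow : ∀ k C → ∣ S ─ C ∣ ℕ.≤ k → C ⊆ S → u ∈ C → (∀ {x} → x ∈ C → Reach C u x) →
      ∃ λ C → Component S C × u ∈ C
    grow k C ≤k C⊆S u∈C reach with exit? C
    ... | no closed = C , (C⊆S , (u , u∈C) ,
      (λ v w v∈C w∈C → Reach-trans (Reach-sym (reach v∈C)) (reach w∈C)) ,
      λ v w v∈C w∈S vw → by-dec v w v∈C w∈S vw (w ∈? C)) , u∈C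
      where
      by-dec : ∀ v w → v ∈ C → w ∈ S → adj v w ≡ true → Dec (w ∈ C) → w ∈ C
      by-dec v w _   _   _  (yes w∈C) = w∈C
      by-dec v w v∈C w∈S vw (no w∉C)  = ⊥-elim (closed (v , w , v∈C , (w∈S , w∉C) , vw))
    ... | yes (a , b , a∈C , (b∈S , b∉C) , ab) = next k ≤k
      where
      D : Subset n
      D = C ∪ ⁅ b ⁆
      C⊆D : C ⊆ D
      C⊆D = Subₚ.p⊆p∪q ⁅ b ⁆
      b∈D : b ∈ D
      b∈D = Subₚ.q⊆p∪q C ⁅ b ⁆ (Subₚ.x∈⁅x⁆ b)
      D⊆S : D ⊆ S
      D⊆S {x} x∈D with Subₚ.x∈p∪q⁻ C ⁅ b ⁆ x∈D
      ... | inj₁ x∈C = C⊆S x∈C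
      ... | inj₂ x∈b = ≡.subst (_∈ S) (≡.sym (Subₚ.x∈⁅y⁆⇒x≡y b x∈b)) b∈S
      reach′ : ∀ {x} → x ∈ D → Reach D u x
      reach′ {x} x∈D with Subₚ.x∈p∪q⁻ C ⁅ b ⁆ x∈D
      ... | inj₁ x∈C = Reach-mono C⊆D (reach x∈C)
      ... | inj₂ x∈b = ≡.subst (Reach D u) (≡.sym (Subₚ.x∈⁅y⁆⇒x≡y b x∈b))
        (Reach-trans (Reach-mono C⊆D (reach a∈C)) (step (C⊆D a∈C) ab (here b∈D)))
      shrinks : suc ∣ S ─ D ∣ ≡ ∣ S ─ C ∣
      shrinks = ≡.trans (≡.cong (suc ∘ ∣_∣) (≡.sym (Subₚ.p─q─r≡p─q∪r S C ⁅ b ⁆)))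
        (∣p-x∣ (Subₚ.x∈p∧x∉q⇒x∈p─q b∈S b∉C))
      next : ∀ k → ∣ S ─ C ∣ ℕ.≤ k → ∃ λ C → Component S C × u ∈ C
      next zero ≤0 with ≡.trans shrinks (ℕₚ.n≤0⇒n≡0 ≤0)
      ... | ()
      next (suc k) ≤k = grow k D (ℕₚ.≤-pred (≡.subst (ℕ._≤ suc k) (≡.sym shrinks) ≤k))
        D⊆S (C⊆D u∈C) reach′

  critical⇒1≤mult : ∀ {C} → Sub.Nonempty C → Critical′ C → 1 ℕ.≤ mult C
  critical⇒1≤mult (u , u∈C) crit = ≡.subst (1 ℕ.≤_) (≡.sym (crit u∈C)) (s≤s z≤n)

  CriticalComponents : Subset n → List (Subset n) → Set
  CriticalComponents S Cs = Unique Cs × (∀ C → (C LM.∈ Cs) ⇔ (Component S C × Critical′ C))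

  length-criticalComponents : ∀ {S Cs} → CriticalComponents S Cs → length Cs ℕ.≤ mult S
  length-criticalComponents {S} {Cs} (uniq , char) = length-components Cs uniq (All.tabulate λ {C} C∈ →
    let comp , crit = Equivalence.to (char C) C∈ in comp , critical⇒1≤mult (proj₁ (proj₂ comp)) crit)

  -- A component either has multiplicity 0 and is not critical, or is critical with multiplicity 1,
  -- so it adds equally to the count and to the multiplicity. The rest `S ─ C` inherits `NoPositive`
  -- because multiplicities add.
  criticalComponents : ∀ k {S} → ∣ S ∣ ℕ.≤ k → NoPositive S →
    ∃ λ Cs → CriticalComponents S Cs × length Cs ≡ mult S
  criticalComponents k {S} ≤k nopos with Subₚ.nonempty? S
  ... | no empty = [] , ([] , λ C → mk⇔ (λ ())
      (λ ((C⊆S , (x , x∈C) , _) , _) → ⊥-elim (empty (x , C⊆S x∈C)))) ,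
    Ord-unique (Ord-cong (Germs.sym Γ (M-empty empty)) Ord-1) (mult-Ord S)
    where open Order Γ
  criticalComponents zero {S} ≤0 nopos | yes (u , u∈S) with ≡.trans (∣p-x∣ u∈S) (ℕₚ.n≤0⇒n≡0 ≤0)
  ... | ()
  criticalComponents (suc k) {S} ≤k nopos | yes (u , u∈S) with component-of u∈S
  ... | C , comp , u∈C
    with criticalComponents k {S ─ C}
           (ℕₚ.≤-pred (ℕₚ.≤-trans (Subₚ.p∩q≢∅⇒∣p─q∣<∣p∣ S C (u , Subₚ.x∈p∩q⁺ (u∈S , u∈C))) ≤k))
           (noPositive-rest comp nopos)
  ... | Cs , (uniq , char) , len = by-mult (mult C) ≡.refl
    where
    ne : Sub.Nonempty C
    ne = u , u∈C
    C∉Cs : ¬ (C LM.∈ Cs)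
    C∉Cs C∈ = x∈p─q⇒x∉q S C (proj₁ (proj₁ (Equivalence.to (char C) C∈)) u∈C) u∈C
    from-rest : ∀ {D} → D LM.∈ Cs → Component S D × Critical′ D
    from-rest {D} D∈ with Equivalence.to (char D) D∈
    ... | comp′ , crit = component-in-rest⁻ comp comp′ , crit
    to-rest : ∀ {D} → D ≢ C → Component S D → Critical′ D → D LM.∈ Cs
    to-rest {D} D≢C comp′ crit = Equivalence.from (char D) (component-in-rest⁺ comp comp′ D≢C , crit)
    _≟C : ∀ D → Dec (D ≡ C)
    D ≟C = Vecₚ.≡-dec Bool._≟_ D C
    by-mult : ∀ j → mult C ≡ j → ∃ λ Cs → CriticalComponents S Cs × length Cs ≡ mult S
    by-mult zero e = Cs , (uniq , λ D → mk⇔ from-rest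
        (λ (comp′ , crit) → to-rest (λ { ≡.refl → not-critical crit }) comp′ crit)) ,
      ≡.trans len (≡.sym (≡.trans (mult-component comp) (≡.cong (ℕ._+ mult (S ─ C)) e)))
      where
      not-critical : ¬ Critical′ C
      not-critical crit with ≡.subst (1 ℕ.≤_) e (critical⇒1≤mult ne crit)
      ... | ()
    by-mult (suc j) e = C ∷ Cs ,
      (All.tabulate (λ D∈ C≡D → C∉Cs (≡.subst (LM._∈ Cs) (≡.sym C≡D) D∈)) ∷ uniq , λ D → mk⇔
        (λ { (here ≡.refl) → comp , critC ; (there D∈) → from-rest D∈ })
        (λ (comp′ , crit) → by-dec comp′ crit (D ≟C))) ,
      ≡.trans (≡.cong suc len)
        (≡.sym (≡.trans (mult-component comp) (≡.cong (ℕ._+ mult (S ─ C)) (gallai ne conn critC))))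
      where
      conn : Connected C
      conn = proj₁ (proj₂ (proj₂ comp))
      critC : Critical′ C
      critC = noPositive⇒critical conn (noPositive-component comp nopos) e
      by-dec : ∀ {D} → Component S D → Critical′ D → Dec (D ≡ C) → D LM.∈ C ∷ Cs
      by-dec comp′ crit (yes D≡C) = here D≡C
      by-dec comp′ crit (no D≢C)  = there (to-rest D≢C comp′ crit)

  Extreme : Subset n → Set
  Extreme X = mult (∁ X) ≡ mult Sub.⊤ ℕ.+ ∣ X ∣

  mult-∁-≤ : ∀ k {X} → ∣ X ∣ ℕ.≤ k → mult (∁ X) ℕ.≤ mult Sub.⊤ ℕ.+ ∣ X ∣
  mult-∁-≤ k {X} ≤k with Subₚ.nonempty? X
  ... | no empty = ℕₚ.≤-trans (ℕₚ.≤-reflexive (≡.cong mult (Subₚ.⊆-antisym Subₚ.⊆⊤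
      (λ _ → Subₚ.x∉p⇒x∈∁p (λ x∈X → empty (_ , x∈X)))))) (ℕₚ.m≤m+n _ _)
  mult-∁-≤ zero {X} ≤0 | yes (u , u∈X) with ≡.trans (∣p-x∣ u∈X) (ℕₚ.n≤0⇒n≡0 ≤0)
  ... | ()
  mult-∁-≤ (suc k) {X} ≤k | yes (u , u∈X) = begin
    mult (∁ X)                                ≡⟨ ≡.cong mult (∁-delete u∈X) ⟩
    mult (∁ (X Sub.- u) Sub.- u)              ≤⟨ interlace-≥ (Subₚ.x∉p⇒x∈∁p (x∉p-x X u)) ⟩
    suc (mult (∁ (X Sub.- u)))                ≤⟨ s≤s (mult-∁-≤ k (ℕₚ.≤-pred
                                                   (≡.subst (ℕ._≤ suc k) (≡.sym (∣p-x∣ u∈X)) ≤k))) ⟩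
    suc (mult Sub.⊤ ℕ.+ ∣ X Sub.- u ∣)        ≡⟨ ≡.sym (ℕₚ.+-suc _ _) ⟩
    mult Sub.⊤ ℕ.+ suc ∣ X Sub.- u ∣          ≡⟨ ≡.cong (mult Sub.⊤ ℕ.+_) (∣p-x∣ u∈X) ⟩
    mult Sub.⊤ ℕ.+ ∣ X ∣                      ∎
    where open ℕₚ.≤-Reasoning

  -- By `interlace-≥` a positive vertex raises the multiplicity by exactly 1, just as moving it into
  -- `X` raises the size of `X`; the set therefore stays extreme.
  extreme-extend : ∀ k {X} → ∣ ∁ X ∣ ℕ.≤ k → Extreme X →
    ∃ λ Z → X ⊆ Z × Extreme Z × NoPositive (∁ Z)
  extreme-extend k {X} ≤k ext
    with Finₚ.any? (λ u → (u ∈? ∁ X) ×-dec (suc (mult (∁ X)) ℕ.≤? mult (∁ X Sub.- u)))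
  ... | no none = X , id , ext , λ {u} u∈ → ℕₚ.≮⇒≥ (λ lt → none (u , u∈ , lt))
  extreme-extend zero {X} ≤0 ext | yes (u , u∈ , _) with ≡.trans (∣p-x∣ u∈) (ℕₚ.n≤0⇒n≡0 ≤0)
  ... | ()
  extreme-extend (suc k) {X} ≤k ext | yes (u , u∈ , pos)
    with extreme-extend k {X ∪ ⁅ u ⁆}
           (ℕₚ.≤-pred (≡.subst (ℕ._≤ suc k)
             (≡.trans (≡.sym (∣p-x∣ u∈)) (≡.cong (suc ∘ ∣_∣) (≡.sym (∁-∪ X ⁅ u ⁆)))) ≤k))
           (begin
             mult (∁ (X ∪ ⁅ u ⁆))           ≡⟨ ≡.cong mult (∁-∪ X ⁅ u ⁆) ⟩
             mult (∁ X Sub.- u)             ≡⟨ ℕₚ.≤-antisym (interlace-≥ u∈) pos ⟩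
             suc (mult (∁ X))               ≡⟨ ≡.cong suc ext ⟩
             suc (mult Sub.⊤ ℕ.+ ∣ X ∣)     ≡⟨ ≡.sym (ℕₚ.+-suc _ _) ⟩
             mult Sub.⊤ ℕ.+ suc ∣ X ∣       ≡⟨ ≡.cong (mult Sub.⊤ ℕ.+_) (≡.sym (∣p∪⁅x⁆∣ (Subₚ.x∈∁p⇒x∉p u∈))) ⟩
             mult Sub.⊤ ℕ.+ ∣ X ∪ ⁅ u ⁆ ∣   ∎)
    where open ≡.≡-Reasoning
  ... | Z , X⊆Z , rest = Z , X⊆Z ∘ Subₚ.p⊆p∪q ⁅ u ⁆ , rest

-- The polynomial ring, its derivation and division by x - θ

module Polynomials (R : RealField) where
  open RealField R hiding (zero)
  open Poly R
  open RingProperties ring using (-0#≈0#)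

  -- Wrapping coefficientwise equality lets Agda infer the polynomials it relates.
  infix 4 _≋_
  record _≋_ (p q : Pol) : Set where
    constructor mk≋
    field
      coefficients : p ≃ q
  open _≋_ public

  coeff-⊕ : ∀ p q i → coeff (p ⊕ q) i ≈ coeff p i + coeff q i
  coeff-⊕ []      q       i       = sym (+-identityˡ _)
  coeff-⊕ (a ∷ p) []      i       = sym (+-identityʳ _)
  coeff-⊕ (a ∷ p) (b ∷ q) zero    = refl
  coeff-⊕ (a ∷ p) (b ∷ q) (suc i) = coeff-⊕ p q i

  coeff-scale : ∀ c p i → coeff (scale c p) i ≈ c * coeff p i
  coeff-scale c []      i       = sym (zeroʳ c)
  coeff-scale c (a ∷ p) zero    = refl
  coeff-scale c (a ∷ p) (suc i) = coeff-scale c p i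

  negate : Pol → Pol
  negate = map (-_)

  coeff-negate : ∀ p i → coeff (negate p) i ≈ - coeff p i
  coeff-negate []      i       = sym -0#≈0#
  coeff-negate (a ∷ p) zero    = refl
  coeff-negate (a ∷ p) (suc i) = coeff-negate p i

  ⊕-cong : ∀ {p p′ q q′} → p ≋ p′ → q ≋ q′ → p ⊕ q ≋ p′ ⊕ q′
  ⊕-cong {p} {p′} {q} {q′} e f = mk≋ λ i →
    trans (coeff-⊕ p q i) (trans (+-cong (coefficients e i) (coefficients f i)) (sym (coeff-⊕ p′ q′ i)))

  ⊕-abelianGroup : AbelianGroup 0ℓ 0ℓ
  ⊕-abelianGroup = record
    { Carrier = Pol
    ; _≈_ = _≋_
    ; _∙_ = _⊕_
    ; ε = []
    ; _⁻¹ = negate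
    ; isAbelianGroup = record
      { isGroup = record
        { isMonoid = record
          { isSemigroup = record
            { isMagma = record
              { isEquivalence = record
                { refl  = mk≋ λ _ → refl
                ; sym   = λ e → mk≋ λ i → sym (coefficients e i)
                ; trans = λ e f → mk≋ λ i → trans (coefficients e i) (coefficients f i)
                }
              ; ∙-cong = ⊕-cong
              }
            ; assoc = λ p q r → mk≋ λ i → trans (coeff-⊕ (p ⊕ q) r i)
                (trans (+-congʳ (coeff-⊕ p q i)) (trans (+-assoc _ _ _)
                  (sym (trans (coeff-⊕ p (q ⊕ r) i) (+-congˡ (coeff-⊕ q r i))))))
            }
          ; identity = (λ p → mk≋ λ i → refl) ,
              λ p → mk≋ λ i → trans (coeff-⊕ p [] i) (+-identityʳ _)
          }
        ; inverse = (λ p → mk≋ λ i → trans (coeff-⊕ (negate p) p i)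
              (trans (+-congʳ (coeff-negate p i)) (-‿inverseˡ _))) ,
            λ p → mk≋ λ i → trans (coeff-⊕ p (negate p) i)
              (trans (+-congˡ (coeff-negate p i)) (-‿inverseʳ _))
        ; ⁻¹-cong = λ {p} {q} e → mk≋ λ i → trans (coeff-negate p i)
            (trans (-‿cong (coefficients e i)) (sym (coeff-negate q i)))
        }
      ; comm = λ p q → mk≋ λ i → trans (coeff-⊕ p q i)
          (trans (+-comm _ _) (sym (coeff-⊕ q p i)))
      }
    }

  private
    module A = AbelianGroup ⊕-abelianGroup
    module C = CommutativeSemigroupProperties A.commutativeSemigroup
  open SetoidReasoning A.setoid

  ⊕-congˡ : ∀ p {q r} → q ≋ r → p ⊕ q ≋ p ⊕ r
  ⊕-congˡ p = ⊕-cong {p} A.refl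

  ∷-cong : ∀ {a b p q} → a ≈ b → p ≋ q → a ∷ p ≋ b ∷ q
  ∷-cong {a} {b} {p} {q} a≈b e = mk≋ go
    where
    go : (a ∷ p) ≃ (b ∷ q)
    go zero    = a≈b
    go (suc i) = coefficients e i

  0∷[] : ∀ {a p} → a ≈ 0# → p ≋ [] → a ∷ p ≋ []
  0∷[] {a} {p} a≈0 e = mk≋ go
    where
    go : (a ∷ p) ≃ []
    go zero    = a≈0
    go (suc i) = coefficients e i

  head-≈0 : ∀ {a p} → a ∷ p ≋ [] → a ≈ 0#
  head-≈0 e = coefficients e 0

  tail-≋[] : ∀ {a p} → a ∷ p ≋ [] → p ≋ []
  tail-≋[] e = mk≋ λ i → coefficients e (suc i)

  tail-cong : ∀ {a b p q} → a ∷ p ≋ b ∷ q → p ≋ q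
  tail-cong e = mk≋ λ i → coefficients e (suc i)

  scale-cong : ∀ {c d p q} → c ≈ d → p ≋ q → scale c p ≋ scale d q
  scale-cong {c} {d} {p} {q} c≈d e = mk≋ λ i → trans (coeff-scale c p i)
    (trans (*-cong c≈d (coefficients e i)) (sym (coeff-scale d q i)))

  scale-⊕ : ∀ c p q → scale c (p ⊕ q) ≋ scale c p ⊕ scale c q
  scale-⊕ c p q = mk≋ λ i → trans (coeff-scale c (p ⊕ q) i) (trans (*-congˡ (coeff-⊕ p q i))
    (trans (distribˡ c _ _) (sym (trans (coeff-⊕ (scale c p) (scale c q) i)
      (+-cong (coeff-scale c p i) (coeff-scale c q i))))))

  scale-scale : ∀ c d p → scale c (scale d p) ≋ scale (c * d) p
  scale-scale c d p = mk≋ λ i → trans (coeff-scale c (scale d p) i)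
    (trans (*-congˡ (coeff-scale d p i)) (trans (sym (*-assoc c d _)) (sym (coeff-scale (c * d) p i))))

  scale-0 : ∀ p → scale 0# p ≋ []
  scale-0 p = mk≋ λ i → trans (coeff-scale 0# p i) (zeroˡ _)

  scale-1 : ∀ p → scale 1# p ≋ p
  scale-1 p = mk≋ λ i → trans (coeff-scale 1# p i) (*-identityˡ _)

  ⊕-0∷ : ∀ p q → (0# ∷ p) ⊕ (0# ∷ q) ≋ 0# ∷ (p ⊕ q)
  ⊕-0∷ p q = ∷-cong (+-identityˡ 0#) A.refl

  scale-0∷ : ∀ c p → scale c (0# ∷ p) ≋ 0# ∷ scale c p
  scale-0∷ c p = ∷-cong (zeroʳ c) A.refl

  ⊗-congˡ : ∀ p {q r} → q ≋ r → p ⊗ q ≋ p ⊗ r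
  ⊗-congˡ []      e = A.refl
  ⊗-congˡ (a ∷ p) e = ⊕-cong (scale-cong refl e) (∷-cong refl (⊗-congˡ p e))

  ⊗-[] : ∀ p → p ⊗ [] ≋ []
  ⊗-[] []      = A.refl
  ⊗-[] (a ∷ p) = 0∷[] refl (⊗-[] p)

  -- The mirror image of the defining clause of `⊗`. It yields commutativity, which then carries
  -- congruence and distributivity from one factor to the other.
  ⊗-∷ : ∀ p b q → p ⊗ (b ∷ q) ≋ scale b p ⊕ (0# ∷ (p ⊗ q))
  ⊗-∷ []      b q = A.sym (0∷[] refl A.refl)
  ⊗-∷ (a ∷ p) b q = ∷-cong (+-congʳ (*-comm a b)) (begin
    scale a q ⊕ (p ⊗ (b ∷ q))                  ≈⟨ ⊕-congˡ (scale a q) (⊗-∷ p b q) ⟩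
    scale a q ⊕ (scale b p ⊕ (0# ∷ (p ⊗ q)))   ≈⟨ C.x∙yz≈y∙xz (scale a q) (scale b p) _ ⟩
    scale b p ⊕ (scale a q ⊕ (0# ∷ (p ⊗ q)))   ∎)

  ⊗-comm : ∀ p q → p ⊗ q ≋ q ⊗ p
  ⊗-comm []      q = A.sym (⊗-[] q)
  ⊗-comm (a ∷ p) q = A.trans (⊕-congˡ (scale a q) (∷-cong refl (⊗-comm p q))) (A.sym (⊗-∷ q a p))

  ⊗-cong : ∀ {p p′ q q′} → p ≋ p′ → q ≋ q′ → p ⊗ q ≋ p′ ⊗ q′
  ⊗-cong {p} {p′} {q} {q′} e f = begin
    p ⊗ q    ≈⟨ ⊗-congˡ p f ⟩
    p ⊗ q′   ≈⟨ ⊗-comm p q′ ⟩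
    q′ ⊗ p   ≈⟨ ⊗-congˡ q′ e ⟩
    q′ ⊗ p′  ≈⟨ ⊗-comm q′ p′ ⟩
    p′ ⊗ q′  ∎

  ⊗-distribˡ : ∀ p q r → p ⊗ (q ⊕ r) ≋ (p ⊗ q) ⊕ (p ⊗ r)
  ⊗-distribˡ []      q r = A.refl
  ⊗-distribˡ (a ∷ p) q r = begin
    scale a (q ⊕ r) ⊕ (0# ∷ (p ⊗ (q ⊕ r)))
      ≈⟨ ⊕-cong (scale-⊕ a q r) (A.trans (∷-cong refl (⊗-distribˡ p q r)) (A.sym (⊕-0∷ (p ⊗ q) (p ⊗ r)))) ⟩
    (scale a q ⊕ scale a r) ⊕ ((0# ∷ (p ⊗ q)) ⊕ (0# ∷ (p ⊗ r)))
      ≈⟨ C.interchange (scale a q) (scale a r) (0# ∷ (p ⊗ q)) (0# ∷ (p ⊗ r)) ⟩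
    (scale a q ⊕ (0# ∷ (p ⊗ q))) ⊕ (scale a r ⊕ (0# ∷ (p ⊗ r))) ∎

  ⊗-distribʳ : ∀ r p q → (p ⊕ q) ⊗ r ≋ (p ⊗ r) ⊕ (q ⊗ r)
  ⊗-distribʳ r p q = begin
    (p ⊕ q) ⊗ r        ≈⟨ ⊗-comm (p ⊕ q) r ⟩
    r ⊗ (p ⊕ q)        ≈⟨ ⊗-distribˡ r p q ⟩
    (r ⊗ p) ⊕ (r ⊗ q)  ≈⟨ ⊕-cong (⊗-comm r p) (⊗-comm r q) ⟩
    (p ⊗ r) ⊕ (q ⊗ r)  ∎

  scale-⊗ : ∀ c p q → scale c p ⊗ q ≋ scale c (p ⊗ q)
  scale-⊗ c []      q = A.refl
  scale-⊗ c (a ∷ p) q = begin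
    scale (c * a) q ⊕ (0# ∷ (scale c p ⊗ q))
      ≈⟨ ⊕-cong (A.sym (scale-scale c a q)) (A.trans (∷-cong refl (scale-⊗ c p q)) (A.sym (scale-0∷ c _))) ⟩
    scale c (scale a q) ⊕ scale c (0# ∷ (p ⊗ q))
      ≈⟨ A.sym (scale-⊕ c (scale a q) (0# ∷ (p ⊗ q))) ⟩
    scale c (scale a q ⊕ (0# ∷ (p ⊗ q))) ∎

  0∷-⊗ : ∀ p q → (0# ∷ p) ⊗ q ≋ 0# ∷ (p ⊗ q)
  0∷-⊗ p q = ⊕-cong (scale-0 q) A.refl

  ⊗-assoc : ∀ p q r → (p ⊗ q) ⊗ r ≋ p ⊗ (q ⊗ r)
  ⊗-assoc []      q r = A.refl
  ⊗-assoc (a ∷ p) q r = begin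
    (scale a q ⊕ (0# ∷ (p ⊗ q))) ⊗ r           ≈⟨ ⊗-distribʳ r (scale a q) (0# ∷ (p ⊗ q)) ⟩
    (scale a q ⊗ r) ⊕ ((0# ∷ (p ⊗ q)) ⊗ r)     ≈⟨ ⊕-cong (scale-⊗ a q r) (0∷-⊗ (p ⊗ q) r) ⟩
    scale a (q ⊗ r) ⊕ (0# ∷ ((p ⊗ q) ⊗ r))     ≈⟨ ⊕-congˡ (scale a (q ⊗ r)) (∷-cong refl (⊗-assoc p q r)) ⟩
    scale a (q ⊗ r) ⊕ (0# ∷ (p ⊗ (q ⊗ r)))     ∎

  constant-⊗ : ∀ c p → (c ∷ []) ⊗ p ≋ scale c p
  constant-⊗ c p = A.trans (⊕-congˡ (scale c p) (0∷[] refl A.refl)) (A.identityʳ (scale c p))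

  ⊗-identityˡ : ∀ p → (1# ∷ []) ⊗ p ≋ p
  ⊗-identityˡ p = A.trans (constant-⊗ 1# p) (scale-1 p)

  polynomialRing : CommutativeRing 0ℓ 0ℓ
  polynomialRing = record
    { Carrier = Pol
    ; _≈_ = _≋_
    ; _+_ = _⊕_
    ; _*_ = _⊗_
    ; -_ = negate
    ; 0# = []
    ; 1# = 1# ∷ []
    ; isCommutativeRing = record
      { isRing = record
        { +-isAbelianGroup = A.isAbelianGroup
        ; *-cong = ⊗-cong
        ; *-assoc = ⊗-assoc
        ; *-identity = ⊗-identityˡ , λ p → A.trans (⊗-comm p _) (⊗-identityˡ p)
        ; distrib = ⊗-distribˡ , ⊗-distribʳ
        }
      ; *-comm = ⊗-comm
      }
    }

  linear-⊗ : ∀ c p → (c ∷ 1# ∷ []) ⊗ p ≋ scale c p ⊕ (0# ∷ p)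
  linear-⊗ c p = ⊕-congˡ (scale c p) (∷-cong refl (⊗-identityˡ p))

  X-⊗ : ∀ p → (0# ∷ 1# ∷ []) ⊗ p ≋ 0# ∷ p
  X-⊗ p = A.trans (linear-⊗ 0# p) (⊕-cong (scale-0 p) A.refl)

  -- The rule (a + x p)′ = p + x p′ follows the shape of the list and avoids integer multiples of
  -- coefficients.
  derivative : Pol → Pol
  derivative []      = []
  derivative (a ∷ p) = p ⊕ (0# ∷ derivative p)

  derivative-[] : ∀ {p} → p ≋ [] → derivative p ≋ []
  derivative-[] {[]}    e = A.refl
  derivative-[] {a ∷ p} e = ⊕-cong (tail-≋[] e) (0∷[] refl (derivative-[] (tail-≋[] e)))

  derivative-cong : ∀ {p q} → p ≋ q → derivative p ≋ derivative q
  derivative-cong {[]}    {q}     e = A.sym (derivative-[] (A.sym e))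
  derivative-cong {a ∷ p} {[]}    e = derivative-[] e
  derivative-cong {a ∷ p} {b ∷ q} e =
    ⊕-cong (tail-cong e) (∷-cong refl (derivative-cong (tail-cong e)))

  derivative-⊕ : ∀ p q → derivative (p ⊕ q) ≋ derivative p ⊕ derivative q
  derivative-⊕ []      q       = A.refl
  derivative-⊕ (a ∷ p) []      = A.sym (A.identityʳ _)
  derivative-⊕ (a ∷ p) (b ∷ q) = begin
    (p ⊕ q) ⊕ (0# ∷ derivative (p ⊕ q))
      ≈⟨ ⊕-congˡ (p ⊕ q) (A.trans (∷-cong refl (derivative-⊕ p q))
           (A.sym (⊕-0∷ (derivative p) (derivative q)))) ⟩
    (p ⊕ q) ⊕ ((0# ∷ derivative p) ⊕ (0# ∷ derivative q))
      ≈⟨ C.interchange p q (0# ∷ derivative p) (0# ∷ derivative q) ⟩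
    (p ⊕ (0# ∷ derivative p)) ⊕ (q ⊕ (0# ∷ derivative q)) ∎

  derivative-scale : ∀ c p → derivative (scale c p) ≋ scale c (derivative p)
  derivative-scale c []      = A.refl
  derivative-scale c (a ∷ p) = begin
    scale c p ⊕ (0# ∷ derivative (scale c p))
      ≈⟨ ⊕-congˡ (scale c p) (A.trans (∷-cong refl (derivative-scale c p)) (A.sym (scale-0∷ c _))) ⟩
    scale c p ⊕ scale c (0# ∷ derivative p)
      ≈⟨ A.sym (scale-⊕ c p (0# ∷ derivative p)) ⟩
    scale c (p ⊕ (0# ∷ derivative p)) ∎

  -- The product rule for a linear factor x + c: `Germs` asks for it at c = -θ, for the uniformiser,
  -- and at c = 0, for the variable.
  derivative-linear : ∀ c p →
    derivative ((c ∷ 1# ∷ []) ⊗ p) ≋ p ⊕ ((c ∷ 1# ∷ []) ⊗ derivative p)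
  derivative-linear c p = begin
    derivative ((c ∷ 1# ∷ []) ⊗ p)
      ≈⟨ derivative-cong (linear-⊗ c p) ⟩
    derivative (scale c p ⊕ (0# ∷ p))
      ≈⟨ derivative-⊕ (scale c p) (0# ∷ p) ⟩
    derivative (scale c p) ⊕ (p ⊕ (0# ∷ derivative p))
      ≈⟨ ⊕-cong (derivative-scale c p) A.refl ⟩
    scale c (derivative p) ⊕ (p ⊕ (0# ∷ derivative p))
      ≈⟨ C.x∙yz≈y∙xz (scale c (derivative p)) p _ ⟩
    p ⊕ (scale c (derivative p) ⊕ (0# ∷ derivative p))
      ≈⟨ ⊕-congˡ p (A.sym (linear-⊗ c (derivative p))) ⟩
    p ⊕ ((c ∷ 1# ∷ []) ⊗ derivative p) ∎

  module Evaluation (θ : Carrier) where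
    private module F = SetoidReasoning setoid
    open CommutativeSemigroupProperties +-commutativeSemigroup using () renaming (interchange to +-interchange)

    evaluate : Pol → Carrier
    evaluate []      = 0#
    evaluate (a ∷ p) = a + θ * evaluate p

    evaluate-[] : ∀ {p} → p ≋ [] → evaluate p ≈ 0#
    evaluate-[] {[]}    e = refl
    evaluate-[] {a ∷ p} e = trans
      (+-cong (head-≈0 e) (trans (*-congˡ (evaluate-[] (tail-≋[] e))) (zeroʳ θ))) (+-identityˡ 0#)

    evaluate-cong : ∀ {p q} → p ≋ q → evaluate p ≈ evaluate q
    evaluate-cong {[]}    {q}     e = sym (evaluate-[] (A.sym e))
    evaluate-cong {a ∷ p} {[]}    e = evaluate-[] e
    evaluate-cong {a ∷ p} {b ∷ q} e =
      +-cong (coefficients e 0) (*-congˡ (evaluate-cong (tail-cong e)))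

    evaluate-⊕ : ∀ p q → evaluate (p ⊕ q) ≈ evaluate p + evaluate q
    evaluate-⊕ []      q       = sym (+-identityˡ _)
    evaluate-⊕ (a ∷ p) []      = sym (+-identityʳ _)
    evaluate-⊕ (a ∷ p) (b ∷ q) = trans
      (+-congˡ (trans (*-congˡ (evaluate-⊕ p q)) (distribˡ θ _ _))) (+-interchange a b _ _)

    evaluate-scale : ∀ c p → evaluate (scale c p) ≈ c * evaluate p
    evaluate-scale c []      = sym (zeroʳ c)
    evaluate-scale c (a ∷ p) = F.begin
      c * a + θ * evaluate (scale c p)  F.≈⟨ +-congˡ (*-congˡ (evaluate-scale c p)) ⟩
      c * a + θ * (c * evaluate p)      F.≈⟨ +-congˡ (x∙yz≈y∙xz θ c _) ⟩
      c * a + c * (θ * evaluate p)      F.≈⟨ sym (distribˡ c a _) ⟩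
      c * (a + θ * evaluate p)          F.∎
      where open CommutativeSemigroupProperties *-commutativeSemigroup using (x∙yz≈y∙xz)

    evaluate-⊗ : ∀ p q → evaluate (p ⊗ q) ≈ evaluate p * evaluate q
    evaluate-⊗ []      q = sym (zeroˡ _)
    evaluate-⊗ (a ∷ p) q = F.begin
      evaluate (scale a q ⊕ (0# ∷ (p ⊗ q)))
        F.≈⟨ evaluate-⊕ (scale a q) (0# ∷ (p ⊗ q)) ⟩
      evaluate (scale a q) + (0# + θ * evaluate (p ⊗ q))
        F.≈⟨ +-cong (evaluate-scale a q) (trans (+-identityˡ _)
             (trans (*-congˡ (evaluate-⊗ p q)) (sym (*-assoc θ _ _)))) ⟩
      a * evaluate q + θ * evaluate p * evaluate q
        F.≈⟨ sym (distribʳ _ a _) ⟩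
      (a + θ * evaluate p) * evaluate q F.∎

    -- Synthetic division by x − θ.
    quotient : Pol → Pol
    quotient []      = []
    quotient (a ∷ p) = evaluate p ∷ quotient p

    -θx+a+θx : ∀ a x → - θ * x + (a + θ * x) ≈ a
    -θx+a+θx a x = F.begin
      - θ * x + (a + θ * x)  F.≈⟨ x∙yz≈y∙xz _ a _ ⟩
      a + (- θ * x + θ * x)  F.≈⟨ +-congˡ (sym (distribʳ x (- θ) θ)) ⟩
      a + (- θ + θ) * x      F.≈⟨ +-congˡ (trans (*-congʳ (-‿inverseˡ θ)) (zeroˡ x)) ⟩
      a + 0#                 F.≈⟨ +-identityʳ a ⟩
      a                      F.∎
      where open CommutativeSemigroupProperties +-commutativeSemigroup using (x∙yz≈y∙xz)

    -- Division with remainder, p = (x - θ) q + p(θ), with the remainder stored as the constant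
    -- coefficient next to x q.
    division : ∀ p → scale (- θ) (quotient p) ⊕ (evaluate p ∷ quotient p) ≋ p
    division []      = 0∷[] refl A.refl
    division (a ∷ p) = ∷-cong (-θx+a+θx a (evaluate p)) (division p)

    factor-theorem : ∀ p → evaluate p ≈ 0# → p ≋ (- θ ∷ 1# ∷ []) ⊗ quotient p
    factor-theorem p e = begin
      p                                                       ≈⟨ A.sym (division p) ⟩
      scale (- θ) (quotient p) ⊕ (evaluate p ∷ quotient p)    ≈⟨ ⊕-congˡ (scale (- θ) (quotient p)) (∷-cong e A.refl) ⟩
      scale (- θ) (quotient p) ⊕ (0# ∷ quotient p)            ≈⟨ A.sym (linear-⊗ (- θ) (quotient p)) ⟩
      (- θ ∷ 1# ∷ []) ⊗ quotient p                            ∎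

    quotient-[] : ∀ {p} → p ≋ [] → quotient p ≋ []
    quotient-[] {[]}    e = A.refl
    quotient-[] {a ∷ p} e = 0∷[] (evaluate-[] (tail-≋[] e)) (quotient-[] (tail-≋[] e))

    quotient-cong : ∀ {p q} → p ≋ q → quotient p ≋ quotient q
    quotient-cong {[]}    {q}     e = A.sym (quotient-[] (A.sym e))
    quotient-cong {a ∷ p} {[]}    e = quotient-[] e
    quotient-cong {a ∷ p} {b ∷ q} e =
      ∷-cong (evaluate-cong (tail-cong e)) (quotient-cong (tail-cong e))

    quotient-⊕ : ∀ p q → quotient (p ⊕ q) ≋ quotient p ⊕ quotient q
    quotient-⊕ []      q       = A.refl
    quotient-⊕ (a ∷ p) []      = A.refl
    quotient-⊕ (a ∷ p) (b ∷ q) = ∷-cong (evaluate-⊕ p q) (quotient-⊕ p q)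

    quotient-scale : ∀ c p → quotient (scale c p) ≋ scale c (quotient p)
    quotient-scale c []      = A.refl
    quotient-scale c (a ∷ p) = ∷-cong (evaluate-scale c p) (quotient-scale c p)

    -- Synthetic division is linear, and on x p it returns p(θ) + x q with q the quotient of p. So
    -- the claim turns into `division` for `p`; it makes multiplication by x - θ cancellable.
    quotient-⊗ : ∀ p → quotient ((- θ ∷ 1# ∷ []) ⊗ p) ≋ p
    quotient-⊗ p = begin
      quotient ((- θ ∷ 1# ∷ []) ⊗ p)                          ≈⟨ quotient-cong (linear-⊗ (- θ) p) ⟩
      quotient (scale (- θ) p ⊕ (0# ∷ p))                     ≈⟨ quotient-⊕ (scale (- θ) p) (0# ∷ p) ⟩
      quotient (scale (- θ) p) ⊕ (evaluate p ∷ quotient p)    ≈⟨ ⊕-cong (quotient-scale (- θ) p) A.refl ⟩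
      scale (- θ) (quotient p) ⊕ (evaluate p ∷ quotient p)    ≈⟨ division p ⟩
      p                                                       ∎

    -- A degree bound blind to trailing zeros. `quotient` keeps the length of the list, so it is
    -- this bound that decreases under division.
    Bounded : ℕ → Pol → Set
    Bounded k p = ∀ i → k ℕ.≤ i → coeff p i ≈ 0#

    Bounded-length : ∀ p → Bounded (length p) p
    Bounded-length []      i       _         = refl
    Bounded-length (a ∷ p) (suc i) (s≤s le) = Bounded-length p i le

    Bounded-quotient : ∀ k p → Bounded (suc k) p → Bounded k (quotient p)
    Bounded-quotient k       []      b i       _        = refl
    Bounded-quotient zero    (a ∷ p) b zero    _        =
      evaluate-[] {p} (mk≋ λ i → b (suc i) (s≤s z≤n))
    Bounded-quotient zero    (a ∷ p) b (suc i) _        =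
      Bounded-quotient zero p (λ j _ → b (suc j) (s≤s z≤n)) i z≤n
    Bounded-quotient (suc k) (a ∷ p) b (suc i) (s≤s le) =
      Bounded-quotient k p (λ j le′ → b (suc j) (s≤s le′)) i le

    open Power polynomialRing using (pow)

    -- Divide by x - θ while θ is a root. Trichotomy decides whether it is one, and the degree bound
    -- ends the process.
    vanishing-order : ∀ k p → Bounded k p →
      p ≋ [] ⊎ ∃₂ λ j q → p ≋ pow (- θ ∷ 1# ∷ []) j ⊗ q × ¬ (evaluate q ≈ 0#)
    vanishing-order zero    p b = inj₁ (mk≋ λ i → b i z≤n)
    vanishing-order (suc k) p b with <-tri (evaluate p) 0#
    ... | tri< _ p≉0 _ = inj₂ (0 , p , A.sym (⊗-identityˡ p) , p≉0)
    ... | tri> _ p≉0 _ = inj₂ (0 , p , A.sym (⊗-identityˡ p) , p≉0)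
    ... | tri≈ _ p≈0 _ with vanishing-order k (quotient p) (Bounded-quotient k p b)
    ... | inj₁ z = inj₁ (A.trans (factor-theorem p p≈0) (A.trans (⊗-congˡ (- θ ∷ 1# ∷ []) z) (⊗-[] (- θ ∷ 1# ∷ []))))
    ... | inj₂ (j , q , e , q≉0) = inj₂ (suc j , q ,
      A.trans (factor-theorem p p≈0) (A.trans (⊗-congˡ (- θ ∷ 1# ∷ []) e)
        (A.sym (⊗-assoc (- θ ∷ 1# ∷ []) (pow (- θ ∷ 1# ∷ []) j) q))) , q≉0)

    polynomialGerms : Germs R
    polynomialGerms = record
      { ring = polynomialRing
      ; eval = evaluate
      ; eval-cong = evaluate-cong
      ; eval-+ = evaluate-⊕
      ; eval-* = evaluate-⊗
      ; eval-1 = trans (+-congˡ (zeroʳ θ)) (+-identityʳ 1#)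
      ; t = - θ ∷ 1# ∷ []
      ; eval-t = trans (+-congˡ (trans (*-congˡ (trans (+-congˡ (zeroʳ θ)) (+-identityʳ 1#)))
          (*-identityʳ θ))) (-‿inverseˡ θ)
      ; factor = λ p e → quotient p , factor-theorem p e
      ; t-cancel = λ p q e → A.trans (A.sym (quotient-⊗ p)) (A.trans (quotient-cong e) (quotient-⊗ q))
      ; order = λ p → vanishing-order (length p) p (Bounded-length p)
      ; ∂ = derivative
      ; ∂-cong = derivative-cong
      ; ∂-+ = derivative-⊕
      ; ∂-1 = 0∷[] refl A.refl
      ; ∂-t* = derivative-linear (- θ)
      ; X = 0# ∷ 1# ∷ []
      ; ∂-X* = derivative-linear 0#
      }

-- Counting matchings by edge recurrences

filterᵇ-cong : ∀ {p q : A → Bool} → (∀ x → p x ≡ q x) → ∀ xs → filterᵇ p xs ≡ filterᵇ q xs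
filterᵇ-cong p≗q [] = ≡.refl
filterᵇ-cong {p = p} {q} p≗q (x ∷ xs) with p x | q x | p≗q x
... | true  | true  | ≡.refl = ≡.cong (x ∷_) (filterᵇ-cong p≗q xs)
... | false | false | ≡.refl = filterᵇ-cong p≗q xs

filterᵇ-++ : ∀ (p : A → Bool) xs ys → filterᵇ p (xs ++ ys) ≡ filterᵇ p xs ++ filterᵇ p ys
filterᵇ-++ p []       ys = ≡.refl
filterᵇ-++ p (x ∷ xs) ys with p x
... | true  = ≡.cong (x ∷_) (filterᵇ-++ p xs ys)
... | false = filterᵇ-++ p xs ys

filterᵇ-map-filterᵇ : ∀ (q : B → Bool) (f : A → B) (p : A → Bool) xs →
  filterᵇ q (map f (filterᵇ p xs)) ≡ map f (filterᵇ (λ x → p x ∧ q (f x)) xs)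
filterᵇ-map-filterᵇ q f p [] = ≡.refl
filterᵇ-map-filterᵇ q f p (x ∷ xs) with p x
... | false = filterᵇ-map-filterᵇ q f p xs
... | true with q (f x)
...   | true  = ≡.cong (f x ∷_) (filterᵇ-map-filterᵇ q f p xs)
...   | false = filterᵇ-map-filterᵇ q f p xs

filterᵇ-concatMap : ∀ (q : B → Bool) {f g : A → List B} → (∀ x → filterᵇ q (f x) ≡ g x) →
  ∀ xs → filterᵇ q (concatMap f xs) ≡ concatMap g xs
filterᵇ-concatMap q e []       = ≡.refl
filterᵇ-concatMap q {f} e (x ∷ xs) = ≡.trans (filterᵇ-++ q (f x) _)
  (≡.cong₂ _++_ (e x) (filterᵇ-concatMap q e xs))

count : (A → Bool) → List A → ℕ
count p xs = length (filterᵇ p xs)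

count-cong : ∀ {p q : A → Bool} → (∀ x → p x ≡ q x) → ∀ xs → count p xs ≡ count q xs
count-cong p≗q xs = ≡.cong length (filterᵇ-cong p≗q xs)

count-++ : ∀ (p : A → Bool) xs ys → count p (xs ++ ys) ≡ count p xs ℕ.+ count p ys
count-++ p []       ys = ≡.refl
count-++ p (x ∷ xs) ys with p x
... | true  = ≡.cong suc (count-++ p xs ys)
... | false = count-++ p xs ys

count-map : ∀ (p : B → Bool) (f : A → B) xs → count p (map f xs) ≡ count (p ∘ f) xs
count-map p f []       = ≡.refl
count-map p f (x ∷ xs) with p (f x)
... | true  = ≡.cong suc (count-map p f xs)
... | false = count-map p f xs

count-false : ∀ (xs : List A) → count (λ _ → false) xs ≡ 0
count-false []       = ≡.refl
count-false (x ∷ xs) = count-false xs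

count-sublists-∷ : ∀ (p : List A → Bool) x xs →
  count p (sublists (x ∷ xs)) ≡ count p (sublists xs) ℕ.+ count (p ∘ (x ∷_)) (sublists xs)
count-sublists-∷ p x xs = ≡.trans (count-++ p (sublists xs) _)
  (≡.cong (count p (sublists xs) ℕ.+_) (count-map p (x ∷_) (sublists xs)))

allᵇ : (A → Bool) → List A → Bool
allᵇ q []       = true
allᵇ q (x ∷ xs) = q x ∧ allᵇ q xs

-- Moves the restriction to a vertex set from the edge list into the predicate, so that one edge
-- list serves all vertex sets.
count-sublists-filterᵇ : ∀ (p : List A → Bool) (q : A → Bool) xs →
  count p (sublists (filterᵇ q xs)) ≡ count (λ ys → allᵇ q ys ∧ p ys) (sublists xs)
count-sublists-filterᵇ p q [] with p []
... | true  = ≡.refl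
... | false = ≡.refl
count-sublists-filterᵇ p q (x ∷ xs) with q x in eq
... | true  = ≡.trans (count-sublists-∷ p x (filterᵇ q xs)) (≡.trans
  (≡.cong₂ ℕ._+_ (count-sublists-filterᵇ p q xs) (≡.trans (count-sublists-filterᵇ (p ∘ (x ∷_)) q xs)
    (count-cong (λ ys → ≡.cong (λ b → (b ∧ allᵇ q ys) ∧ p (x ∷ ys)) (≡.sym eq)) (sublists xs))))
  (≡.sym (count-sublists-∷ _ x xs)))
... | false = ≡.trans (count-sublists-filterᵇ p q xs) (≡.sym (≡.trans (count-sublists-∷ _ x xs)
  (≡.trans (≡.cong (count (λ ys → allᵇ q ys ∧ p ys) (sublists xs) ℕ.+_)
    (≡.trans (count-cong (λ ys → ≡.cong (λ b → (b ∧ allᵇ q ys) ∧ p (x ∷ ys)) eq) (sublists xs))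
      (count-false (sublists xs)))) (ℕₚ.+-identityʳ _))))

contains : Subset m → Edge m → Bool
contains S (a , b) = lookup S a ∧ lookup S b

∉⇒lookup : ∀ {S : Subset m} {a} → a ∉ S → lookup S a ≡ false
∉⇒lookup {S = S} {a} a∉S with lookup S a in eq
... | true  = ⊥-elim (a∉S (Vecₚ.lookup⇒[]= a S eq))
... | false = ≡.refl

lookup-delete : ∀ (S : Subset m) a c → lookup (S Sub.- a) c ≡ lookup S c ∧ not (does (a ≟ c))
lookup-delete S a c with a ≟ c
... | yes ≡.refl = ≡.trans (∉⇒lookup (x∉p-x S a)) (≡.sym (Boolₚ.∧-zeroʳ _))
... | no a≢c with c ∈? S
...   | yes c∈S = ≡.trans (Vecₚ.[]=⇒lookup (Subₚ.x∈p∧x≢y⇒x∈p-y c∈S (a≢c ∘ ≡.sym)))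
          (≡.sym (≡.trans (Boolₚ.∧-identityʳ _) (Vecₚ.[]=⇒lookup c∈S)))
...   | no c∉S = ≡.trans (∉⇒lookup (x∉p⇒x∉p-y a c∉S))
          (≡.sym (≡.trans (Boolₚ.∧-identityʳ _) (∉⇒lookup c∉S)))

-- Being a matching inside `S`, in a form where each edge uses up its endpoints; this is the
-- deletion that the edge operator of `W` performs.
fits : Subset m → List (Edge m) → Bool
fits S []            = true
fits S ((a , b) ∷ M) = contains S (a , b) ∧ fits (S Sub.- a Sub.- b) M

fitting : Subset m → List (Edge m) → ℕ → ℕ
fitting S L r = count (λ M → (length M ℕ.≡ᵇ r) ∧ fits S M) (sublists L)

fitting-∷-zero : ∀ (S : Subset m) e L → fitting S (e ∷ L) 0 ≡ fitting S L 0
fitting-∷-zero S e L = ≡.trans (count-sublists-∷ _ e L)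
  (≡.trans (≡.cong (fitting S L 0 ℕ.+_) (count-false (sublists L))) (ℕₚ.+-identityʳ _))

-- The edge recurrence for matching numbers: a matching avoids the new edge, or contains it and the
-- rest avoids both its ends.
fitting-∷-suc : ∀ {S : Subset m} {a b} L r → a ∈ S → b ∈ S →
  fitting S ((a , b) ∷ L) (suc r) ≡ fitting S L (suc r) ℕ.+ fitting (S Sub.- a Sub.- b) L r
fitting-∷-suc {S = S} {a} {b} L r a∈S b∈S = ≡.trans (count-sublists-∷ _ (a , b) L)
  (≡.cong (fitting S L (suc r) ℕ.+_) (count-cong (λ M → ≡.cong
    (λ x → (length M ℕ.≡ᵇ r) ∧ (x ∧ fits (S Sub.- a Sub.- b) M))
    (≡.cong₂ _∧_ (Vecₚ.[]=⇒lookup a∈S) (Vecₚ.[]=⇒lookup b∈S))) (sublists L)))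

fitting-∷-skip : ∀ {S : Subset m} {e} L r → contains S e ≡ false → fitting S (e ∷ L) r ≡ fitting S L r
fitting-∷-skip {S = S} {e} L r c = ≡.trans (count-sublists-∷ _ e L) (≡.trans
  (≡.cong (fitting S L r ℕ.+_) (≡.trans (count-cong (λ M → ≡.trans
    (≡.cong (λ x → (suc (length M) ℕ.≡ᵇ r) ∧ (x ∧ fits (S Sub.- proj₁ e Sub.- proj₂ e) M)) c)
    (Boolₚ.∧-zeroʳ _)) (sublists L)) (count-false (sublists L))))
  (ℕₚ.+-identityʳ _))

module Edges (G : Graph) where
  open GraphDefs G

  contains-delete : ∀ S (e f : Edge n) →
    contains (S Sub.- proj₁ e Sub.- proj₂ e) f ≡ contains S f ∧ disjointᵇ e f
  contains-delete S (a , b) (c , d) = ≡.trans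
    (≡.cong₂ _∧_ (twice c) (twice d))
    (solve 6 (λ s u v t w x → ((s :* u) :* v) :* ((t :* w) :* x) :=
      (s :* t) :* (u :* (w :* (v :* x)))) ≡.refl
      (lookup S c) (not (a =ᶠ c)) (not (b =ᶠ c)) (lookup S d) (not (a =ᶠ d)) (not (b =ᶠ d)))
    where
    open ∨-∧-Solver
    twice : ∀ c → lookup (S Sub.- a Sub.- b) c ≡ (lookup S c ∧ not (a =ᶠ c)) ∧ not (b =ᶠ c)
    twice c = ≡.trans (lookup-delete (S Sub.- a) b c) (≡.cong (_∧ not (b =ᶠ c)) (lookup-delete S a c))

  allᵇ-contains-delete : ∀ S (e : Edge n) M →
    allᵇ (contains (S Sub.- proj₁ e Sub.- proj₂ e)) M ≡
    allᵇ (contains S) M ∧ foldr (λ f b → disjointᵇ e f ∧ b) true M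
  allᵇ-contains-delete S e []      = ≡.refl
  allᵇ-contains-delete S e (f ∷ M) = ≡.trans
    (≡.cong₂ _∧_ (contains-delete S e f) (allᵇ-contains-delete S e M))
    (solve 4 (λ s u t v → (s :* u) :* (t :* v) := (s :* t) :* (u :* v)) ≡.refl
      (contains S f) (disjointᵇ e f) _ _)
    where open ∨-∧-Solver

  -- Deleting the ends of `e` excludes from `contains` exactly the edges that meet `e`, so using up
  -- endpoints amounts to pairwise disjointness.
  fits-matching : ∀ S M → fits S M ≡ allᵇ (contains S) M ∧ isMatchingᵇ M
  fits-matching S []              = ≡.refl
  fits-matching S (e@(a , b) ∷ M) = ≡.trans
    (≡.cong (contains S e ∧_) (≡.trans (fits-matching (S Sub.- a Sub.- b) M)
      (≡.cong (_∧ isMatchingᵇ M) (allᵇ-contains-delete S e M))))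
    (solve 4 (λ s t u v → s :* ((t :* u) :* v) := (s :* t) :* (u :* v)) ≡.refl
      (contains S e) (allᵇ (contains S) M) _ _)
    where open ∨-∧-Solver

  lookup-⊤ : ∀ (i : Fin n) → lookup {n = n} Sub.⊤ i ≡ true
  lookup-⊤ i = Vecₚ.lookup-replicate i true

  edges-filterᵇ : ∀ S → edges S ≡ filterᵇ (contains S) (edges Sub.⊤)
  edges-filterᵇ S = ≡.sym (filterᵇ-concatMap (contains S) (λ i → ≡.trans
    (filterᵇ-map-filterᵇ (contains S) (i ,_) _ (allFin n))
    (≡.cong (map (i ,_)) (filterᵇ-cong (inner i) (allFin n)))) (allFin n))
    where
    open ∨-∧-Solver
    inner : ∀ i j →
      (does (toℕ i ℕ.<? toℕ j) ∧ (adj i j ∧ (lookup {n = n} Sub.⊤ i ∧ lookup {n = n} Sub.⊤ j))) ∧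
        (lookup S i ∧ lookup S j) ≡
      does (toℕ i ℕ.<? toℕ j) ∧ (adj i j ∧ (lookup S i ∧ lookup S j))
    inner i j rewrite lookup-⊤ i | lookup-⊤ j =
      solve 3 (λ x y z → (x :* (y :* con true)) :* z := x :* (y :* z)) ≡.refl
        (does (toℕ i ℕ.<? toℕ j)) (adj i j) (lookup S i ∧ lookup S j)

  numMatchings-fitting : ∀ S r → numMatchings S r ≡ fitting S (edges Sub.⊤) r
  numMatchings-fitting S r = ≡.trans
    (≡.cong (λ L → count (λ M → (length M ℕ.≡ᵇ r) ∧ isMatchingᵇ M) (sublists L)) (edges-filterᵇ S))
    (≡.trans (count-sublists-filterᵇ _ (contains S) (edges Sub.⊤))
      (count-cong (λ M → ≡.trans
        (solve 3 (λ x y z → x :* (y :* z) := y :* (x :* z)) ≡.refl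
          (allᵇ (contains S) M) (length M ℕ.≡ᵇ r) (isMatchingᵇ M))
        (≡.cong ((length M ℕ.≡ᵇ r) ∧_) (≡.sym (fits-matching S M)))) (sublists (edges Sub.⊤))))
    where open ∨-∧-Solver

  private
    present : Fin n → Fin n → Bool
    present i j =
      does (toℕ i ℕ.<? toℕ j) ∧ (adj i j ∧ (lookup {n = n} Sub.⊤ i ∧ lookup {n = n} Sub.⊤ j))

  ∈-edges⁻ : ∀ {e} → e LM.∈ edges Sub.⊤ → toℕ (proj₁ e) ℕ.< toℕ (proj₂ e) × adj (proj₁ e) (proj₂ e) ≡ true
  ∈-edges⁻ {e} e∈ with Any.satisfied (∈-concatMap⁻ (λ i → map (i ,_) (filterᵇ (present i) (allFin n))) {xs = allFin n} e∈)
  ... | i , e∈i with ∈-map⁻ (i ,_) e∈i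
  ... | j , j∈ , ≡.refl with Equivalence.to Boolₚ.T-∧ (proj₂ (∈-filter⁻ (T? ∘ present i) {xs = allFin n} j∈))
  ... | i<j , rest = ℕₚ.<ᵇ⇒< (toℕ i) (toℕ j) i<j ,
    Equivalence.to Boolₚ.T-≡ (proj₁ (Equivalence.to Boolₚ.T-∧ rest))

  ∈-edges⁺ : ∀ {i j} → toℕ i ℕ.< toℕ j → adj i j ≡ true → (i , j) LM.∈ edges Sub.⊤
  ∈-edges⁺ {i} {j} i<j ij = ∈-concatMap⁺ (λ i → map (i ,_) (filterᵇ (present i) (allFin n)))
    (Any.map (λ { ≡.refl → ∈-map⁺ (i ,_) (∈-filter⁺ (T? ∘ present i) (∈-allFin j) present!) }) (∈-allFin i))
    where
    present! : T (present i j)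
    present! = Equivalence.from Boolₚ.T-∧ (ℕₚ.<⇒<ᵇ i<j ,
      Equivalence.from Boolₚ.T-≡ (≡.cong₂ _∧_ ij (≡.cong₂ _∧_ (lookup-⊤ i) (lookup-⊤ j))))

  edges-proper : Proper (edges Sub.⊤)
  edges-proper = All.tabulate (λ e∈ a≡b → ℕₚ.<-irrefl (≡.cong toℕ a≡b) (proj₁ (∈-edges⁻ e∈)))

  edges-adj : All (λ e → adj (proj₁ e) (proj₂ e) ≡ true) (edges Sub.⊤)
  edges-adj = All.tabulate (λ e∈ → proj₂ (∈-edges⁻ e∈))

  adj⇒neighbours : ∀ {u v} → adj u v ≡ true → v LM.∈ neighbours u (edges Sub.⊤)
  adj⇒neighbours {u} {v} uv with ℕₚ.<-cmp (toℕ u) (toℕ v)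
  ... | tri< u<v _ _ = neighboursˡ (∈-edges⁺ u<v uv)
  ... | tri> _ u≢v v<u = neighboursʳ (u≢v ∘ ≡.cong toℕ) (∈-edges⁺ v<u (≡.trans (sym v u) uv))
  ... | tri≈ _ u≡v _ with Finₚ.toℕ-injective u≡v
  ... | ≡.refl with ≡.trans (≡.sym uv) (irrefl u)
  ... | ()

-- Under the shift of `r` by one and `d` by two, the test 2r ≤ d in `term` computes to the strict
-- form on the left.
≤ᵇ-as-<ᵇ : ∀ k l → (k ℕ.<ᵇ suc l) ≡ (k ℕ.≤ᵇ l)
≤ᵇ-as-<ᵇ zero    l = ≡.refl
≤ᵇ-as-<ᵇ (suc k) l = ≡.refl

-- The alternating sum of matching numbers equals the edge-operator polynomial

module MatchingPolynomial (R : RealField) (θ : RealField.Carrier R) where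
  open RealField R hiding (zero)
  open Poly R
  open Polynomials R
  open Evaluation θ
  open Germs polynomialGerms using (pow; X) renaming (refl to ≋-refl; sym to ≋-sym; trans to ≋-trans;
    setoid to ≋-setoid; +-identityʳ to ⊕-identityʳ; +-comm to ⊕-comm; +-assoc to ⊕-assoc;
    -‿cong to negate-cong)
  open SetoidReasoning ≋-setoid
  open AbelianGroupProperties ⊕-abelianGroup using () renaming (⁻¹-∙-comm to negate-⊕; ε⁻¹≈ε to negate-[])
  module PI = RingIdentities polynomialRing

  -- signedSum d c = Σ_r (−1)^r c(r) x^(d − 2r), over the r with 2r ≤ d.
  signedSum : ℕ → (ℕ → ℕ) → Pol
  signedSum zero          c = monomial (fromℕ (c 0)) 0
  signedSum (suc zero)    c = monomial (fromℕ (c 0)) 1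
  signedSum (suc (suc d)) c = monomial (fromℕ (c 0)) (suc (suc d)) ⊕ negate (signedSum d (c ∘ suc))

  signedSum-cong : ∀ d {c c′} → (∀ r → c r ≡ c′ r) → signedSum d c ≡ signedSum d c′
  signedSum-cong zero          e = ≡.cong (λ x → monomial (fromℕ x) 0) (e 0)
  signedSum-cong (suc zero)    e = ≡.cong (λ x → monomial (fromℕ x) 1) (e 0)
  signedSum-cong (suc (suc d)) e = ≡.cong₂ (λ x q → monomial (fromℕ x) (suc (suc d)) ⊕ negate q)
    (e 0) (signedSum-cong d (e ∘ suc))

  fromℕ-+ : ∀ a b → fromℕ (a ℕ.+ b) ≈ fromℕ a + fromℕ b
  fromℕ-+ zero    b = sym (+-identityˡ _)
  fromℕ-+ (suc a) b = trans (+-congˡ (fromℕ-+ a b)) (sym (+-assoc _ _ _))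

  monomial-cong : ∀ d {a b} → a ≈ b → monomial a d ≋ monomial b d
  monomial-cong zero    e = ∷-cong e ≋-refl
  monomial-cong (suc d) e = ∷-cong refl (monomial-cong d e)

  monomial-+ : ∀ d a b → monomial (a + b) d ≋ monomial a d ⊕ monomial b d
  monomial-+ zero    a b = ≋-refl
  monomial-+ (suc d) a b = ∷-cong (sym (+-identityˡ 0#)) (monomial-+ d a b)

  monomial-0 : ∀ d → monomial 0# d ≋ []
  monomial-0 zero    = 0∷[] refl ≋-refl
  monomial-0 (suc d) = 0∷[] refl (monomial-0 d)

  monomial-negate : ∀ d a → monomial (- a) d ≋ negate (monomial a d)
  monomial-negate zero    a = ≋-refl
  monomial-negate (suc d) a = ∷-cong (sym -0#≈0#) (monomial-negate d a)
    where open RingProperties ring using (-0#≈0#)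

  monomial-pow : ∀ d → monomial 1# d ≋ pow X d
  monomial-pow zero    = ≋-refl
  monomial-pow (suc d) = ≋-trans (∷-cong refl (monomial-pow d)) (≋-sym (X-⊗ (pow X d)))

  signedSum-+ : ∀ d c c′ → signedSum d (λ r → c r ℕ.+ c′ r) ≋ signedSum d c ⊕ signedSum d c′
  signedSum-+ zero          c c′ = ≋-trans (monomial-cong 0 (fromℕ-+ (c 0) (c′ 0))) (monomial-+ 0 _ _)
  signedSum-+ (suc zero)    c c′ = ≋-trans (monomial-cong 1 (fromℕ-+ (c 0) (c′ 0))) (monomial-+ 1 _ _)
  signedSum-+ (suc (suc d)) c c′ = begin
    monomial (fromℕ (c 0 ℕ.+ c′ 0)) (suc (suc d)) ⊕ negate (signedSum d (λ r → c (suc r) ℕ.+ c′ (suc r)))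
      ≈⟨ ⊕-cong (≋-trans (monomial-cong (suc (suc d)) (fromℕ-+ (c 0) (c′ 0))) (monomial-+ (suc (suc d)) _ _))
                (≋-trans (negate-cong (signedSum-+ d (c ∘ suc) (c′ ∘ suc)))
                         (≋-sym (negate-⊕ (signedSum d (c ∘ suc)) (signedSum d (c′ ∘ suc))))) ⟩
    (monomial (fromℕ (c 0)) (suc (suc d)) ⊕ monomial (fromℕ (c′ 0)) (suc (suc d))) ⊕
      (negate (signedSum d (c ∘ suc)) ⊕ negate (signedSum d (c′ ∘ suc)))
      ≈⟨ PI.+-interchange (monomial (fromℕ (c 0)) (suc (suc d))) (monomial (fromℕ (c′ 0)) (suc (suc d)))
           (negate (signedSum d (c ∘ suc))) (negate (signedSum d (c′ ∘ suc))) ⟩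
    signedSum (suc (suc d)) c ⊕ signedSum (suc (suc d)) c′ ∎

  -- Shifting `r` by one lowers the degree by two and flips the sign, which turns the additive
  -- recurrence for the counts into the subtraction in `W`.
  signedSum-step : ∀ d {c c₁ c₂} → c 0 ≡ c₁ 0 → (∀ r → c (suc r) ≡ c₁ (suc r) ℕ.+ c₂ r) →
    signedSum (suc (suc d)) c ≋ signedSum (suc (suc d)) c₁ ⊕ negate (signedSum d c₂)
  signedSum-step d {c} {c₁} {c₂} e₀ eₛ = begin
    monomial (fromℕ (c 0)) (suc (suc d)) ⊕ negate (signedSum d (c ∘ suc))
      ≡⟨ ≡.cong₂ (λ x q → monomial (fromℕ x) (suc (suc d)) ⊕ negate q) e₀ (signedSum-cong d eₛ) ⟩
    top ⊕ negate (signedSum d (λ r → c₁ (suc r) ℕ.+ c₂ r))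
      ≈⟨ ⊕-congˡ top (≋-trans (negate-cong (signedSum-+ d (c₁ ∘ suc) c₂))
           (≋-sym (negate-⊕ (signedSum d (c₁ ∘ suc)) (signedSum d c₂)))) ⟩
    top ⊕ (negate (signedSum d (c₁ ∘ suc)) ⊕ negate (signedSum d c₂))
      ≈⟨ ≋-sym (⊕-assoc top (negate (signedSum d (c₁ ∘ suc))) (negate (signedSum d c₂))) ⟩
    signedSum (suc (suc d)) c₁ ⊕ negate (signedSum d c₂) ∎
    where
    top : Pol
    top = monomial (fromℕ (c₁ 0)) (suc (suc d))

  signedSum-0 : ∀ d → signedSum d (λ _ → 0) ≋ []
  signedSum-0 zero          = monomial-0 0
  signedSum-0 (suc zero)    = monomial-0 1
  signedSum-0 (suc (suc d)) = ⊕-cong (monomial-0 (suc (suc d))) (≋-trans (negate-cong (signedSum-0 d)) negate-[])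

  signedSum-empty : ∀ {n} (S : Subset n) d → signedSum d (fitting S []) ≋ pow X d
  signedSum-empty S zero          = ≋-trans (monomial-cong 0 (+-identityʳ 1#)) (monomial-pow 0)
  signedSum-empty S (suc zero)    = ≋-trans (monomial-cong 1 (+-identityʳ 1#)) (monomial-pow 1)
  signedSum-empty S (suc (suc d)) = ≋-trans
    (⊕-cong (≋-trans (monomial-cong (suc (suc d)) (+-identityʳ 1#)) (monomial-pow (suc (suc d))))
      (≋-trans (negate-cong (signedSum-0 d)) negate-[]))
    (⊕-identityʳ _)

  term : ℕ → (ℕ → ℕ) → ℕ → Pol
  term d c r = if (r ℕ.+ r) ℕ.≤ᵇ d then monomial (signed r (fromℕ (c r))) (d ℕ.∸ (r ℕ.+ r)) else []

  sumTo : ℕ → (ℕ → Pol) → Pol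
  sumTo zero    f = []
  sumTo (suc k) f = f 0 ⊕ sumTo k (f ∘ suc)

  sumTo-foldr : ∀ k (f : ℕ → Pol) (g : ℕ → ℕ) →
    foldr (λ r acc → f r ⊕ acc) [] (applyUpTo g k) ≡ sumTo k (f ∘ g)
  sumTo-foldr zero    f g = ≡.refl
  sumTo-foldr (suc k) f g = ≡.cong (f (g 0) ⊕_) (sumTo-foldr k f (g ∘ suc))

  sumTo-[] : ∀ k {f} → (∀ r → f r ≋ []) → sumTo k f ≋ []
  sumTo-[] zero    e = ≋-refl
  sumTo-[] (suc k) e = ⊕-cong (e 0) (sumTo-[] k (e ∘ suc))

  sumTo-negate : ∀ k {f g} → (∀ r → f r ≋ negate (g r)) → sumTo k f ≋ negate (sumTo k g)
  sumTo-negate zero        e = ≋-sym negate-[]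
  sumTo-negate (suc k) {f} {g} e =
    ≋-trans (⊕-cong (e 0) (sumTo-negate k (e ∘ suc))) (negate-⊕ (g 0) (sumTo k (g ∘ suc)))

  term-suc : ∀ d c r → term (suc (suc d)) c (suc r) ≋ negate (term d (c ∘ suc) r)
  term-suc d c r rewrite ℕₚ.+-suc r r | ≤ᵇ-as-<ᵇ (r ℕ.+ r) d with (r ℕ.+ r) ℕ.≤ᵇ d
  ... | true  = monomial-negate (d ℕ.∸ (r ℕ.+ r)) _
  ... | false = ≋-sym negate-[]

  term-one : ∀ c r → term 1 c (suc r) ≋ []
  term-one c r rewrite ℕₚ.+-suc r r = ≋-refl

  -- The number `k` of summands is only bounded below, since a step lowers `d` by two but `k` by
  -- one. The surplus terms have 2r > d and are empty.
  sumTo-term : ∀ d c k → suc d ℕ.≤ k → sumTo k (term d c) ≋ signedSum d c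
  sumTo-term zero c (suc k) _ = ≋-trans
    (⊕-congˡ (monomial (fromℕ (c 0)) 0) (sumTo-[] k (λ _ → ≋-refl))) (⊕-identityʳ _)
  sumTo-term (suc zero) c (suc k) _ = ≋-trans
    (⊕-congˡ (monomial (fromℕ (c 0)) 1) (sumTo-[] k (term-one c))) (⊕-identityʳ _)
  sumTo-term (suc (suc d)) c (suc k) (s≤s le) = ⊕-congˡ (monomial (fromℕ (c 0)) (suc (suc d)))
    (≋-trans (sumTo-negate k (term-suc d c))
      (negate-cong (sumTo-term d (c ∘ suc) k (ℕₚ.≤-trans (ℕₚ.n≤1+n (suc d)) le))))

  module _ {n : ℕ} where
    open SetFunctions polynomialRing {n}
    open Monomials polynomialGerms using (monomials)

    P : List (Edge n) → Subset n → Pol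
    P L S = signedSum ∣ S ∣ (fitting S L)

    signedSum-W : ∀ {L} → Proper L → ∀ S → P L S ≋ W L monomials S
    signedSum-W [] S = signedSum-empty S ∣ S ∣
    signedSum-W {(a , b) ∷ L} (a≢b ∷ pr) S = by-cases (a ∈? S) (b ∈? S)
      where
      skip : contains S (a , b) ≡ false → δ a (δ b (W L monomials)) S ≡ [] →
        P ((a , b) ∷ L) S ≋ W ((a , b) ∷ L) monomials S
      skip c z = begin
        P ((a , b) ∷ L) S
          ≡⟨ signedSum-cong ∣ S ∣ (λ r → fitting-∷-skip L r c) ⟩
        P L S
          ≈⟨ signedSum-W pr S ⟩
        W L monomials S
          ≈⟨ ≋-sym (⊕-identityʳ (W L monomials S)) ⟩
        W L monomials S ⊕ []
          ≡⟨ ≡.cong (λ q → W L monomials S ⊕ negate q) (≡.sym z) ⟩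
        W ((a , b) ∷ L) monomials S ∎
      by-cases : Dec (a ∈ S) → Dec (b ∈ S) →
        P ((a , b) ∷ L) S ≋ W ((a , b) ∷ L) monomials S
      by-cases (no a∉S) _ = skip (≡.cong (_∧ lookup S b) (∉⇒lookup a∉S)) (δδ-∉ˡ a b _ a∉S)
      by-cases (yes _) (no b∉S) = skip
        (≡.trans (≡.cong (lookup S a ∧_) (∉⇒lookup b∉S)) (Boolₚ.∧-zeroʳ _)) (δδ-∉ʳ a b _ b∉S)
      by-cases (yes a∈S) (yes b∈S) = begin
        P ((a , b) ∷ L) S
          ≡⟨ ≡.cong (λ i → signedSum i (fitting S ((a , b) ∷ L))) (≡.sym size) ⟩
        signedSum d (fitting S ((a , b) ∷ L))
          ≈⟨ signedSum-step ∣ Sab ∣ {fitting S ((a , b) ∷ L)} {fitting S L} {fitting Sab L}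
               (fitting-∷-zero S (a , b) L) (λ r → fitting-∷-suc L r a∈S b∈S) ⟩
        signedSum d (fitting S L) ⊕ negate (P L Sab)
          ≡⟨ ≡.cong (λ i → signedSum i (fitting S L) ⊕ negate (P L Sab)) size ⟩
        P L S ⊕ negate (P L Sab)
          ≈⟨ ⊕-cong (signedSum-W pr S) (negate-cong (signedSum-W pr Sab)) ⟩
        W L monomials S ⊕ negate (W L monomials Sab)
          ≡⟨ ≡.cong (λ q → W L monomials S ⊕ negate q) (≡.sym (δδ-∈ (W L monomials) a≢b a∈S b∈S)) ⟩
        W ((a , b) ∷ L) monomials S ∎
        where
        d : ℕ
        d = suc (suc ∣ S Sub.- a Sub.- b ∣)
        Sab : Subset n
        Sab = S Sub.- a Sub.- b
        size : d ≡ ∣ S ∣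
        size = ≡.trans (≡.cong suc (∣p-x∣ (Subₚ.x∈p∧x≢y⇒x∈p-y b∈S (a≢b ∘ ≡.sym)))) (∣p-x∣ a∈S)

-- Transfer to the stated definitions, and comparison of maximal sets

module MaximalSets (R : RealField) (G : Graph) (θ : RealField.Carrier R) where
  open Poly R
  open GraphDefs G
  open Theory R G θ
  open Polynomials R
  open Evaluation θ
  open MatchingPolynomial R θ
  open Edges G
  open Structure polynomialGerms G (edges Sub.⊤) edges-proper adj⇒neighbours edges-adj
  open Deletion polynomialGerms (edges Sub.⊤) edges-proper
  open Order polynomialGerms
  open Germs polynomialGerms using (pow; t) renaming (sym to ≋-sym; trans to ≋-trans; reflexive to ≋-reflexive)

  μ≋M : ∀ S → μ S ≋ M S
  μ≋M S = ≋-trans (≋-reflexive (sumTo-foldr (suc ∣ S ∣) (term ∣ S ∣ (numMatchings S)) id))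
    (≋-trans (sumTo-term ∣ S ∣ (numMatchings S) (suc ∣ S ∣) ℕₚ.≤-refl)
      (≋-trans (≋-reflexive (signedSum-cong ∣ S ∣ (numMatchings-fitting S))) (signedSum-W edges-proper S)))

  pow≡^ₚ : ∀ k → pow t k ≡ t ^ₚ k
  pow≡^ₚ zero    = ≡.refl
  pow≡^ₚ (suc k) = ≡.cong (t ⊗_) (pow≡^ₚ k)

  Divides⇒Vanishes : ∀ S k → Divides θ k (μ S) → Vanishes k (M S)
  Divides⇒Vanishes S k (q , e) = Vanishes-cong (μ≋M S)
    (vanishes q (≋-trans (mk≋ e) (≋-reflexive (≡.cong (_⊗ q) (≡.sym (pow≡^ₚ k))))))

  Vanishes⇒Divides : ∀ S k → Vanishes k (M S) → Divides θ k (μ S)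
  Vanishes⇒Divides S k (vanishes q e) =
    q , coefficients (≋-trans (μ≋M S) (≋-trans e (≋-reflexive (≡.cong (_⊗ q) (pow≡^ₚ k)))))

  Mult-mult : ∀ S → Mult S (mult S)
  Mult-mult S = Vanishes⇒Divides S (mult S) (Ord⇒Vanishes (mult-Ord S)) ,
    Ord-¬Vanishes (mult-Ord S) ∘ Divides⇒Vanishes S (suc (mult S))

  Mult⇒≡ : ∀ S k → Mult S k → k ≡ mult S
  Mult⇒≡ S k (v , ¬v) =
    Ord-unique (Ord-intro (Divides⇒Vanishes S k v) (¬v ∘ Vanishes⇒Divides S (suc k))) (mult-Ord S)

  ≡⇒Mult : ∀ S {k} → k ≡ mult S → Mult S k
  ≡⇒Mult S ≡.refl = Mult-mult S

  Critical⇒Critical′ : ∀ {C} → Critical C → Critical′ C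
  Critical⇒Critical′ {C} crit {u} u∈C with crit u u∈C
  ... | k , mult-k , mult-suc =
    ≡.trans (≡.sym (Mult⇒≡ C (suc k) mult-suc)) (≡.cong suc (Mult⇒≡ (C Sub.- u) k mult-k))

  Critical′⇒Critical : ∀ {C} → Critical′ C → Critical C
  Critical′⇒Critical {C} crit u u∈C =
    mult (C Sub.- u) , Mult-mult (C Sub.- u) , ≡⇒Mult C (≡.sym (crit u∈C))

  critical-⇔ : ∀ S C → (Component S C × Critical C) ⇔ (Component S C × Critical′ C)
  critical-⇔ S C = mk⇔ to from
    where
    to : Component S C × Critical C → Component S C × Critical′ C
    to (comp , crit) = comp , Critical⇒Critical′ crit
    from : Component S C × Critical′ C → Component S C × Critical C
    from (comp , crit) = comp , Critical′⇒Critical crit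

  TutteSet⇒Extreme : ∀ X → TutteSet X → Extreme X
  TutteSet⇒Extreme X (k , multV , Cs , len , uniq , char) = ℕₚ.≤-antisym (mult-∁-≤ ∣ X ∣ ℕₚ.≤-refl)
    (≡.subst (ℕ._≤ mult (∁ X)) (≡.trans len (≡.cong (ℕ._+ ∣ X ∣) (Mult⇒≡ Sub.⊤ k multV)))
      (length-criticalComponents (uniq , λ C → critical-⇔ (∁ X) C ⇔-∘ char C)))

  Extreme⇒TutteSet : ∀ X → Extreme X → NoPositive (∁ X) → TutteSet X
  Extreme⇒TutteSet X ext nopos =
    let Cs , (uniq , char) , len = criticalComponents ∣ ∁ X ∣ ℕₚ.≤-refl nopos
    in mult Sub.⊤ , Mult-mult Sub.⊤ , Cs , ≡.trans len ext , uniq ,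
       λ C → ⇔-sym (critical-⇔ (∁ X) C) ⇔-∘ char C

  ExtremeSet⇒Extreme : ∀ X → ExtremeSet X → Extreme X
  ExtremeSet⇒Extreme X (k , multV , mult∁) =
    ≡.trans (≡.sym (Mult⇒≡ (∁ X) (k ℕ.+ ∣ X ∣) mult∁)) (≡.cong (ℕ._+ ∣ X ∣) (Mult⇒≡ Sub.⊤ k multV))

  Extreme⇒ExtremeSet : ∀ X → Extreme X → ExtremeSet X
  Extreme⇒ExtremeSet X ext = mult Sub.⊤ , Mult-mult Sub.⊤ , ≡⇒Mult (∁ X) (≡.sym ext)

  TutteSet⇒ExtremeSet : ∀ X → TutteSet X → ExtremeSet X
  TutteSet⇒ExtremeSet X = Extreme⇒ExtremeSet X ∘ TutteSet⇒Extreme X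

  ExtremeSet-extend : ∀ X → ExtremeSet X → ∃ λ Z → X ⊆ Z × ExtremeSet Z × TutteSet Z
  ExtremeSet-extend X ext =
    let Z , X⊆Z , extZ , nopos = extreme-extend ∣ ∁ X ∣ ℕₚ.≤-refl (ExtremeSet⇒Extreme X ext)
    in Z , X⊆Z , Extreme⇒ExtremeSet Z extZ , Extreme⇒TutteSet Z extZ nopos

  -- An extreme `Y` above `X` lies below some `Z` that is also Tutte. Maximality of `X` among Tutte
  -- sets gives `Z ≡ X`, which squeezes `Y`.
  maximalTutte⇒maximalExtreme : ∀ X → MaximalTutteSet X → MaximalExtremeSet X
  maximalTutte⇒maximalExtreme X (tutte , maximal) = TutteSet⇒ExtremeSet X tutte , λ Y X⊆Y ext →
    let Z , Y⊆Z , _ , tutteZ = ExtremeSet-extend Y ext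
        Z≡X = maximal Z (λ x∈X → Y⊆Z (X⊆Y x∈X)) tutteZ
    in Subₚ.⊆-antisym (λ {y} y∈Y → ≡.subst (y ∈_) Z≡X (Y⊆Z y∈Y)) X⊆Y

  -- The Tutte extension of `X` is itself extreme, so maximality identifies it with `X`. Any larger
  -- Tutte set is extreme and falls to the same maximality.
  maximalExtreme⇒maximalTutte : ∀ X → MaximalExtremeSet X → MaximalTutteSet X
  maximalExtreme⇒maximalTutte X (ext , maximal) =
    let Z , X⊆Z , extZ , tutteZ = ExtremeSet-extend X ext
    in ≡.subst TutteSet (maximal Z X⊆Z extZ) tutteZ ,
       λ Y X⊆Y tutteY → maximal Y X⊆Y (TutteSet⇒ExtremeSet Y tutteY)

theorem3p1 : (R : RealField) (G : Graph) (θ : RealField.Carrier R) (X : Subset (Graph.n G)) →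
    Theory.MaximalTutteSet R G θ X ⇔ Theory.MaximalExtremeSet R G θ X
theorem3p1 R G θ X =
  mk⇔ (MaximalSets.maximalTutte⇒maximalExtreme R G θ X) (MaximalSets.maximalExtreme⇒maximalTutte R G θ X)
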